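{- Let $\alpha$ be a set with an involution $\tau$, let $\pi=\pi(\alpha,\tau)$, and let $\varphi:\pi\to\mathbb Z$ be an additive homomorphism such that $\varphi(a)\in\{+1,-1\}$ for all $a\in\alpha$. For any nanowords $w,v$ over $\alpha$, $$\rho_{br}(w,v)\ \ge\ \tfrac12\,\sigma_\varphi(p_w\oplus p_v^-),$$ where $p_w=p(w)$ and $p_v=p(v)$ are the $\alpha$-pairings of $w$ and $v$, $\sigma_\varphi$ is the $\varphi$-genus, and $\rho_{br}(w,v)=\|wv^-\|_{br}$ is the bridge metric.
   Context: **Nanowords.** $\alpha$ is a set with an involution $\tau:\alpha\to\alpha$ ($\tau^2=\mathrm{id}$). An $\alpha$-alphabet is a set $\mathcal A$ with a map $\mathcal A\to\alpha$, $A\mapsto|A|$. A nanoword of length $n$ over $\alpha$ is a pair $(\mathcal A,w)$ with $\mathcal A$ an $\alpha$-alphabet and $w:\{1,\dots,n\}\to\mathcal A$ a map (written $w(1)\cdots w(n)$) taking every value in $\mathcal A$ exactly twice; $\emptyset$ is the empty nanoword. Nanowords $(\mathcal A,w),(\mathcal A',w')$ are isomorphic if $w'=fw$ for a bijection $f:\mathcal A\to\mathcal A'$ with $|f(A)|=|A|$. The opposite word is $w^-=w(n)\cdots w(1)$. The product of nanowords is concatenation, after making the alphabets disjoint. **Homotopy moves.** (1) $(\mathcal A,xAAy)\mapsto(\mathcal A-\{A\},xy)$; (2) $(\mathcal A,xAByBAz)\mapsto(\mathcal A-\{A,B\},xyz)$ if $|B|=\tau(|A|)$; (3) $(\mathcal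 A,xAByACzBCt)\mapsto(\mathcal A,xBAyCAzCBt)$ for distinct $A,B,C$ with $|A|=|B|=|C|$. **Bridge moves.** A factor of $(\mathcal A,w)$ is a sequence of words $\nabla=(\mathcal B,(v_1|\cdots|v_k))$ in a subset $\mathcal B\subset\mathcal A$, each letter of $\mathcal B$ occurring exactly twice in $v_1\cdots v_k$, such that $w=x_1v_1x_2v_2\cdots x_kv_kx_{k+1}$ with $x_i$ words in $\mathcal A-\mathcal B$. A quasi-bridge in $w$ is a pair $(\nabla,\kappa)$ with $\nabla=(\mathcal B,(v_1|\cdots|v_k))$ a factor of $(\mathcal A,w)$, $k\ge1$, and $\kappa$ an involutive permutation of $\{1,\dots,k\}$ such that (a) $v_r$ has even length whenever $\kappa(r)=r$; (b) there is a map $\iota:\mathcal B\to\mathcal B$ with $\iota v_r=v_{\kappa(r)}^-$ for all $r$. The occurrence of $B\in\mathcal B$ in position $j$ of $v_r$ is symmetric to the occurrence of $\iota(B)$ in position $n_r+1-j$ of $v_{\kappa(r)}$, where $n_r$ is the length of $v_r$. Put $\varepsilon(B)=1$ if the occurrence symmetric to the leftmost occurrence of $B$ in $w$ is the leftmost occurrence of $\iota(B)$ in $w$, and $\varepsilon(B)=0$ otherwise. A quasi-bridge is a bridge if $|\iota(B)|=\tau^{\varepsilon(B)}(|B|)$ for all $B\in\mathcal B$. The corresponding bridge move $m$ transforms $(\mathcal A,w)$ into $(\mathcal A-\mathcal B,x_1x_2\cdots x_{k+1})$; its number of arches $g(m)=g(m^{ -1})$ is the number of 2-element orbits of $\kappa$.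 (A bridge move is always considered together with the bridge defining it.) **Bridge norm and metric.** A metamorphosis $m:v\to w$ is a finite sequence $m=(m_1,\dots,m_n)$ of isomorphisms, homotopy moves, bridge moves, and inverses of such moves, transforming $v$ into $w$; $g(m)=\sum_ig(m_i)$ where $g(m_i)$ is the number of arches if $m_i$ is a bridge move or the inverse of one, and $g(m_i)=0$ otherwise. $\|w\|_{br}=\min_mg(m)$ over all metamorphoses $m:w\to\emptyset$. Set $\rho_{br}(w,v)=\|wv^-\|_{br}$. **$\alpha$-pairings.** $\pi=\pi(\alpha,\tau)$ is the additive abelian group with generators $a\in\alpha$ and relations $a+\tau(a)=0$. An $\alpha$-pairing is a triple $p=(S,s,e)$: a set $S$ (here finite), $s\in S$, a map $S^\circ=S-\{s\}\to\alpha$, $A\mapsto|A|$, and a map $e:S\times S\to\pi$, extended to a bilinear form $\tilde e:\mathbb ZS\times\mathbb ZS\to\pi$. The opposite is $p^-=(S,s,-e)$. The sum $p_1\oplus p_2$ of $p_i=(S_i,s_i,e_i)$ is $(S_1^\circ\sqcup S_2^\circ\sqcup\{s\},s,e)$ with inherited projections, $e=e_i$ on $S_i^\circ\times S_i^\circ$, $e(S_1^\circ,S_2^\circ)=e(S_2^\circ,S_1^\circ)=0$, $e(A,s)=e_i(A,s_i)$, $e(s,A)=e_i(s_i,A)$ for $A\in S_i^\circ$, $e(s,s)=e_1(s_1,s_1)+e_2(s_2,s_2)$. A vector $x\in\mathbb ZS$ is short if $x=A\in S^\circ$, or $x=A+B$ with $A\ne B\in S^\circ$, $|A|=|B|$,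 or $x=A-B$ with $A\ne B\in S^\circ$, $|A|=\tau(|B|)$. A filling of $p$ is a finite family $\{\lambda_i\}$ in $\mathbb ZS$ such that one $\lambda_i$ equals $s$, all others are short, and every element of $S^\circ$ occurs with non-zero coefficient in exactly one $\lambda_i$. The $\varphi$-genus is $\sigma_\varphi(p)=\min_\lambda\frac12\operatorname{rk}\big(\varphi\tilde e(\lambda_i,\lambda_j)\big)_{i,j}$, the minimum over all fillings $\lambda$ of $p$ (rank over $\mathbb Q$). **The $\alpha$-pairing of a nanoword $(\mathcal A,w)$.** $p_w=p(w)=(\mathcal A\cup\{s\},s,e_w)$ with the given projection $\mathcal A\to\alpha$. For $A,B\in\mathcal A$ let $n_w(A,B)=1$ if $w=\cdots A\cdots B\cdots A\cdots B\cdots$, $-1$ if $w=\cdots B\cdots A\cdots B\cdots A\cdots$, $0$ otherwise. Let $i_A<j_A$ be the elements of $w^{ -1}(A)$, and $A\circ_wB=\sum|D|\in\pi$ over $D\in\mathcal A$ with $i_A<i_D<j_A$ and $i_B<j_D<j_B$. Then $e_w(A,B)=2(A\circ_wB-B\circ_wA)+n_w(A,B)(|A|+|B|)$, $e_w(A,s)=-e_w(s,A)=\sum_{D\in\mathcal A}n_w(A,D)|D|$, $e_w(s,s)=0$. -}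

module Defs where

open import Algebra.Bundles using (AbelianGroup; RawMonoid)
open import Algebra.Definitions using (Involutive)
import Algebra.Definitions.RawMonoid as RawMonoidOps
open import Data.Bool.Base using (if_then_else_)
open import Data.Empty using (⊥)
open import Data.Fin.Base as Fin using (Fin; zero; suc; toℕ)
import Data.Fin.Properties as Fin
open import Data.Integer.Base as ℤ using (ℤ; +_; -[1+_]; 0ℤ; 1ℤ; -1ℤ)
open import Data.List.Base
  using (List; []; _∷_; _++_; _ʳ++_; map; reverse; concat; tabulate; filter; allFin; length; lookup)
open import Data.List.Membership.Propositional using (_∈_)
open import Data.Maybe.Base using (Maybe; just; nothing)
import Data.Maybe.Properties as Maybe
open import Data.Nat.Base as ℕ using (ℕ; zero; suc)
import Data.Nat.Properties as ℕ
open import Data.Nat.Divisibility using (_∣_)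
open import Data.Nat.GeneralisedArithmetic using (iterate)
open import Data.Product.Base using (Σ; ∃; ∃-syntax; _×_; _,_)
open import Data.Product using (∃!)
open import Data.Rational.Base as ℚ using (ℚ; 0ℚ; ½; _/_)
import Data.Rational.Properties as ℚ
open import Data.Sum.Base as Sum using (_⊎_; inj₁; inj₂; [_,_]′)
open import Data.Sum.Function.Propositional using (_⊎-↔_)
open import Function.Base using (_∘_; case_of_)
open import Function.Bundles using (_↔_; _⇔_; mk↔ₛ′; module Inverse)
open import Function.Definitions using (Injective)
open import Function.Construct.Composition using (_↔-∘_)
open import Function.Construct.Symmetry using (↔-sym)
open import Function.Properties.Inverse using (↔⇒↣)
open import Level using (_⊔_) renaming (zero to 0ℓ; suc to lsuc)
open import Relation.Binary.Core using (Rel)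
open import Relation.Binary.Definitions using (DecidableEquality)
open import Relation.Binary.Construct.Closure.Equivalence using (EqClosure)
open import Relation.Binary.Construct.Closure.ReflexiveTransitive using (ε; _◅_)
open import Relation.Binary.Construct.Closure.Symmetric using (SymClosure; fwd; bwd)
open import Relation.Binary.PropositionalEquality
open import Relation.Nullary using (¬_; does; _×-dec_)
open import Relation.Nullary.Decidable using (via-injection)
open import Relation.Unary using (Pred)

-- m = min_{i ∈ I} f i.  A minimum is a relation rather than a function because
-- the minima below cannot be computed (or shown to be attained) constructively.
IsMinimum : ∀ {a b ℓ} {I : Set a} {B : Set b} → Rel B ℓ → (I → B) → B → Set (a ⊔ b ⊔ ℓ)
IsMinimum _≤_ f m = (∃[ i ] f i ≡ m) × (∀ i → m ≤ f i)

ℚ-sum : ∀ {n} → (Fin n → ℚ) → ℚ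
ℚ-sum = RawMonoidOps.sum ℚ.+-0-rawMonoid

LinearlyIndependent : ∀ {k n} → (Fin k → Fin n → ℚ) → Set
LinearlyIndependent {k} {n} v =
  (c : Fin k → ℚ) →
  (∀ (j : Fin n) → ℚ-sum (λ i → c i ℚ.* v i j) ≡ 0ℚ) →
  ∀ i → c i ≡ 0ℚ

-- r is the largest number of linearly independent rows of M.
IsRank : ∀ {m n} → (Fin m → Fin n → ℚ) → ℕ → Set
IsRank {m} M r =
  (∃[ f ] LinearlyIndependent {r} (M ∘ f)) ×
  (∀ k (f : Fin k → Fin m) → LinearlyIndependent (M ∘ f) → k ℕ.≤ r)

-- The enumeration only serves to form finite sums and to decide equality.
record FiniteSet : Set₁ where
  field
    Carrier : Set
    size    : ℕ
    enum    : Fin size ↔ Carrier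

  element : Fin size → Carrier
  element = Inverse.to enum

  infix 4 _≟_
  _≟_ : DecidableEquality Carrier
  _≟_ = via-injection (↔⇒↣ (↔-sym enum)) Fin._≟_

open FiniteSet using (Carrier)

∅ᶠ : FiniteSet
∅ᶠ = record { Carrier = ⊥ ; size = 0 ; enum = Fin.0↔⊥ }

_⊎ᶠ_ : FiniteSet → FiniteSet → FiniteSet
X ⊎ᶠ Y = record
  { Carrier = Carrier X ⊎ Carrier Y
  ; size    = X.size ℕ.+ Y.size
  ; enum    = (X.enum ⊎-↔ Y.enum) ↔-∘ Fin.+↔⊎
  }
  where module X = FiniteSet X
        module Y = FiniteSet Y

-- first and last are the elements i_A < j_A of w⁻¹(A).
record Twice {X : Set} (w : List X) (A : X) : Set where
  field
    first last : Fin (length w)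
    first<last : first Fin.< last
    at-first   : lookup w first ≡ A
    at-last    : lookup w last ≡ A
    only       : ∀ k → lookup w k ≡ A → k ≡ first ⊎ k ≡ last

private
  module _ {X Z : Set} (f : X → Z) where
    posˡ : ∀ xs zs → Fin (length xs) → Fin (length (map f xs ++ zs))
    posˡ (x ∷ xs) zs zero    = zero
    posˡ (x ∷ xs) zs (suc i) = suc (posˡ xs zs i)

    posˡ-lookup : ∀ xs zs i → lookup (map f xs ++ zs) (posˡ xs zs i) ≡ f (lookup xs i)
    posˡ-lookup (x ∷ xs) zs zero    = refl
    posˡ-lookup (x ∷ xs) zs (suc i) = posˡ-lookup xs zs i

    posˡ-< : ∀ xs zs {i j} → i Fin.< j → posˡ xs zs i Fin.< posˡ xs zs j
    posˡ-< (x ∷ xs) zs {zero}  {suc j} _   = ℕ.s≤s ℕ.z≤n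
    posˡ-< (x ∷ xs) zs {suc i} {suc j} i<j = ℕ.s≤s (posˡ-< xs zs (ℕ.s≤s⁻¹ i<j))

    posʳ : ∀ zs xs → Fin (length xs) → Fin (length (zs ++ map f xs))
    posʳ (z ∷ zs) xs       i       = suc (posʳ zs xs i)
    posʳ []       (x ∷ xs) zero    = zero
    posʳ []       (x ∷ xs) (suc i) = suc (posʳ [] xs i)

    posʳ-lookup : ∀ zs xs i → lookup (zs ++ map f xs) (posʳ zs xs i) ≡ f (lookup xs i)
    posʳ-lookup (z ∷ zs) xs       i       = posʳ-lookup zs xs i
    posʳ-lookup []       (x ∷ xs) zero    = refl
    posʳ-lookup []       (x ∷ xs) (suc i) = posʳ-lookup [] xs i

    posʳ-< : ∀ zs xs {i j} → i Fin.< j → posʳ zs xs i Fin.< posʳ zs xs j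
    posʳ-< (z ∷ zs) xs i<j = ℕ.s≤s (posʳ-< zs xs i<j)
    posʳ-< [] (x ∷ xs) {zero}  {suc j} _   = ℕ.s≤s ℕ.z≤n
    posʳ-< [] (x ∷ xs) {suc i} {suc j} i<j = ℕ.s≤s (posʳ-< [] xs (ℕ.s≤s⁻¹ i<j))

    posʳ-[]-cover : ∀ xs (k : Fin (length (map f xs))) → ∃[ i ] k ≡ posʳ [] xs i
    posʳ-[]-cover (x ∷ xs) zero    = zero , refl
    posʳ-[]-cover (x ∷ xs) (suc k) =
      case posʳ-[]-cover xs k of λ { (i , refl) → suc i , refl }

  pos-cover : ∀ {X Y Z : Set} (f : X → Z) (g : Y → Z) xs ys →
              (k : Fin (length (map f xs ++ map g ys))) →
              (∃[ i ] k ≡ posˡ f xs (map g ys) i) ⊎ (∃[ j ] k ≡ posʳ g (map f xs) ys j)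
  pos-cover f g []       ys k       = inj₂ (posʳ-[]-cover g ys k)
  pos-cover f g (x ∷ xs) ys zero    = inj₁ (zero , refl)
  pos-cover f g (x ∷ xs) ys (suc k) = case pos-cover f g xs ys k of λ where
    (inj₁ (i , refl)) → inj₁ (suc i , refl)
    (inj₂ (j , refl)) → inj₂ (j , refl)

  module _ {X : Set} where
    revʳ : ∀ (xs ys : List X) → Fin (length ys) → Fin (length (xs ʳ++ ys))
    revʳ []       ys j = j
    revʳ (x ∷ xs) ys j = revʳ xs (x ∷ ys) (suc j)

    revˡ : ∀ (xs ys : List X) → Fin (length xs) → Fin (length (xs ʳ++ ys))
    revˡ (x ∷ xs) ys zero    = revʳ xs (x ∷ ys) zero
    revˡ (x ∷ xs) ys (suc i) = revˡ xs (x ∷ ys) i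

    revʳ-lookup : ∀ xs ys j → lookup (xs ʳ++ ys) (revʳ xs ys j) ≡ lookup ys j
    revʳ-lookup []       ys j = refl
    revʳ-lookup (x ∷ xs) ys j = revʳ-lookup xs (x ∷ ys) (suc j)

    revˡ-lookup : ∀ xs ys i → lookup (xs ʳ++ ys) (revˡ xs ys i) ≡ lookup xs i
    revˡ-lookup (x ∷ xs) ys zero    = revʳ-lookup xs (x ∷ ys) zero
    revˡ-lookup (x ∷ xs) ys (suc i) = revˡ-lookup xs (x ∷ ys) i

    revʳ-< : ∀ xs ys {i j} → i Fin.< j → revʳ xs ys i Fin.< revʳ xs ys j
    revʳ-< []       ys i<j = i<j
    revʳ-< (x ∷ xs) ys i<j = revʳ-< xs (x ∷ ys) (ℕ.s≤s i<j)

    revˡ<revʳ : ∀ xs ys i j → revˡ xs ys i Fin.< revʳ xs ys j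
    revˡ<revʳ (x ∷ xs) ys zero    j = revʳ-< xs (x ∷ ys) (ℕ.s≤s ℕ.z≤n)
    revˡ<revʳ (x ∷ xs) ys (suc i) j = revˡ<revʳ xs (x ∷ ys) i (suc j)

    revˡ-> : ∀ xs ys {i j} → i Fin.< j → revˡ xs ys j Fin.< revˡ xs ys i
    revˡ-> (x ∷ xs) ys {zero}  {suc j} _   = revˡ<revʳ xs (x ∷ ys) j zero
    revˡ-> (x ∷ xs) ys {suc i} {suc j} i<j = revˡ-> xs (x ∷ ys) (ℕ.s≤s⁻¹ i<j)

    rev-cover : ∀ xs ys (k : Fin (length (xs ʳ++ ys))) →
                (∃[ i ] k ≡ revˡ xs ys i) ⊎ (∃[ j ] k ≡ revʳ xs ys j)
    rev-cover []       ys k = inj₂ (k , refl)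
    rev-cover (x ∷ xs) ys k = case rev-cover xs (x ∷ ys) k of λ where
      (inj₁ (i , eq))     → inj₁ (suc i , eq)
      (inj₂ (zero , eq))  → inj₁ (zero , eq)
      (inj₂ (suc j , eq)) → inj₂ (j , eq)

  inj₁-injective : ∀ {X Y : Set} {x y : X} → inj₁ {B = Y} x ≡ inj₁ y → x ≡ y
  inj₁-injective refl = refl

  inj₂-injective : ∀ {X Y : Set} {x y : Y} → inj₂ {A = X} x ≡ inj₂ y → x ≡ y
  inj₂-injective refl = refl

twice-[] : ∀ (A : ⊥) → Twice [] A
twice-[] ()

twice-reverse : ∀ {X : Set} {w : List X} {A} → Twice w A → Twice (reverse w) A
twice-reverse {w = w} t = record
  { first      = revˡ w [] last
  ; last       = revˡ w [] first
  ; first<last = revˡ-> w [] first<last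
  ; at-first   = trans (revˡ-lookup w [] last) at-last
  ; at-last    = trans (revˡ-lookup w [] first) at-first
  ; only       = λ k eq → case rev-cover w [] k of λ where
      (inj₁ (i , refl)) → Sum.swap (Sum.map (cong (revˡ w [])) (cong (revˡ w []))
                            (only i (trans (sym (revˡ-lookup w [] i)) eq)))
  }
  where open Twice t

twice-⊎ : ∀ {X Y : Set} {w : List X} {v : List Y} →
          (∀ A → Twice w A) → (∀ B → Twice v B) →
          ∀ C → Twice (map inj₁ w ++ map inj₂ v) C
twice-⊎ {w = w} {v} tw tv (inj₁ A) = record
  { first      = pos first
  ; last       = pos last
  ; first<last = posˡ-< inj₁ w (map inj₂ v) first<last
  ; at-first   = trans (posˡ-lookup inj₁ w _ first) (cong inj₁ at-first)
  ; at-last    = trans (posˡ-lookup inj₁ w _ last) (cong inj₁ at-last)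
  ; only       = λ k eq → case pos-cover inj₁ inj₂ w v k of λ where
      (inj₁ (i , refl)) → Sum.map (cong pos) (cong pos)
        (only i (inj₁-injective (trans (sym (posˡ-lookup inj₁ w _ i)) eq)))
      (inj₂ (j , refl)) → case trans (sym (posʳ-lookup inj₂ (map inj₁ w) v j)) eq of λ ()
  }
  where open Twice (tw A)
        pos = posˡ inj₁ w (map inj₂ v)
twice-⊎ {w = w} {v} tw tv (inj₂ B) = record
  { first      = pos first
  ; last       = pos last
  ; first<last = posʳ-< inj₂ (map inj₁ w) v first<last
  ; at-first   = trans (posʳ-lookup inj₂ (map inj₁ w) v first) (cong inj₂ at-first)
  ; at-last    = trans (posʳ-lookup inj₂ (map inj₁ w) v last) (cong inj₂ at-last)
  ; only       = λ k eq → case pos-cover inj₁ inj₂ w v k of λ where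
      (inj₁ (i , refl)) → case trans (sym (posˡ-lookup inj₁ w _ i)) eq of λ ()
      (inj₂ (j , refl)) → Sum.map (cong pos) (cong pos)
        (only j (inj₂-injective (trans (sym (posʳ-lookup inj₂ (map inj₁ w) v j)) eq)))
  }
  where open Twice (tv B)
        pos = posʳ inj₂ (map inj₁ w) v

-- Since every letter occurs exactly twice in word, requiring the alphabet to be
-- finite is no restriction.
record Nanoword {a} (α : Set a) : Set (a ⊔ lsuc 0ℓ) where
  field
    alphabet : FiniteSet

  Letter : Set
  Letter = Carrier alphabet

  field
    ∣_∣   : Letter → α
    word  : List Letter
    twice : ∀ A → Twice word A

open Nanoword using (Letter; word)

module _ {a} {α : Set a} where

  ∅ : Nanoword α
  ∅ = record { alphabet = ∅ᶠ ; ∣_∣ = λ () ; word = [] ; twice = twice-[] }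

  infix 8 _⁻
  _⁻ : Nanoword α → Nanoword α
  w ⁻ = record
    { alphabet = alphabet
    ; ∣_∣      = ∣_∣
    ; word     = reverse (word w)
    ; twice    = λ A → twice-reverse (twice A)
    }
    where open Nanoword w using (alphabet; ∣_∣; twice)

  infixl 7 _·_
  _·_ : Nanoword α → Nanoword α → Nanoword α
  w · v = record
    { alphabet = w.alphabet ⊎ᶠ v.alphabet
    ; ∣_∣      = [ w.∣_∣ , v.∣_∣ ]′
    ; word     = map inj₁ w.word ++ map inj₂ v.word
    ; twice    = twice-⊎ w.twice v.twice
    }
    where module w = Nanoword w
          module v = Nanoword v

  record _≅_ (w v : Nanoword α) : Set a where
    private
      module w = Nanoword w
      module v = Nanoword v
    field
      bijection  : w.Letter ↔ v.Letter
    open Inverse bijection using (to)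
    field
      projection : ∀ A → v.∣ to A ∣ ≡ w.∣ A ∣
      relabelled : v.word ≡ map to w.word

  -- The alphabet of v is the α-alphabet 𝒜 − ℬ, where 𝒜 is the alphabet of w.
  -- Subsets being injections, 𝒜 − ℬ comes with its inclusion into 𝒜.
  record _IsAlphabetOf_Minus_ (v w : Nanoword α) (ℬ : Pred (Letter w) 0ℓ) : Set a where
    private
      module w = Nanoword w
      module v = Nanoword v
    field
      incl       : v.Letter → w.Letter
      injective  : Injective _≡_ _≡_ incl
      projection : ∀ A → w.∣ incl A ∣ ≡ v.∣ A ∣
      image      : ∀ A → (∃[ A′ ] incl A′ ≡ A) ⇔ (¬ ℬ A)

open _IsAlphabetOf_Minus_ using (incl)

module _ {a} {α : Set a} (τ : α → α) where

  data HomotopyMove (w v : Nanoword α) : Set a where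

    move₁ : ∀ x A y →
            word w ≡ x ++ A ∷ A ∷ y →
            (sub : v IsAlphabetOf w Minus (λ D → D ≡ A)) →
            map (incl sub) (word v) ≡ x ++ y →
            HomotopyMove w v

    move₂ : (let open Nanoword w using (∣_∣)) →
            ∀ x A B y z →
            word w ≡ x ++ A ∷ B ∷ y ++ B ∷ A ∷ z →
            ∣ B ∣ ≡ τ ∣ A ∣ →
            (sub : v IsAlphabetOf w Minus (λ D → D ≡ A ⊎ D ≡ B)) →
            map (incl sub) (word v) ≡ x ++ y ++ z →
            HomotopyMove w v

    move₃ : (let open Nanoword w using (∣_∣)) →
            ∀ x A B y C z t →
            word w ≡ x ++ A ∷ B ∷ y ++ A ∷ C ∷ z ++ B ∷ C ∷ t →
            A ≢ B → A ≢ C → B ≢ C →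
            ∣ A ∣ ≡ ∣ B ∣ → ∣ B ∣ ≡ ∣ C ∣ →
            (sub : v IsAlphabetOf w Minus (λ _ → ⊥)) →
            map (incl sub) (word v) ≡ x ++ B ∷ A ∷ y ++ C ∷ A ∷ z ++ C ∷ B ∷ t →
            HomotopyMove w v

-- x₁ v₁ x₂ v₂ ⋯ x_k v_k x_{k+1}
interleave : ∀ {X : Set} k → (Fin (suc k) → List X) → (Fin k → List X) → List X
interleave zero    x v = x zero
interleave (suc k) x v = x zero ++ v zero ++ interleave k (x ∘ suc) (v ∘ suc)

record Factor {a} {α : Set a} (w : Nanoword α) : Set₁ where
  field
    ℬ         : Pred (Letter w) 0ℓ
    k         : ℕ
    v         : Fin k → List (Letter w)
    x         : Fin (suc k) → List (Letter w)
    v-in-ℬ    : ∀ r {A} → A ∈ v r → ℬ A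
    x-not-ℬ   : ∀ r {A} → A ∈ x r → ¬ ℬ A
    ℬ-twice   : ∀ B → ℬ B → Twice (concat (tabulate v)) B
    factorise : word w ≡ interleave k x v

  -- (r , j) is the position j of the word v r.
  Position : Set
  Position = Σ (Fin k) λ r → Fin (length (v r))

  letter : Position → Letter w
  letter (r , j) = lookup (v r) j

  -- The order in which these positions appear in w.
  _≺_ : Rel Position 0ℓ
  (r , j) ≺ (r′ , j′) = r Fin.< r′ ⊎ (r ≡ r′ × toℕ j ℕ.< toℕ j′)

  -- The letters of ℬ do not occur in the words x r, so that this is the leftmost
  -- occurrence of B in the whole of w.
  LeftmostOccurrence : Letter w → Position → Set
  LeftmostOccurrence B p = letter p ≡ B × (∀ q → letter q ≡ B → ¬ (q ≺ p))

record QuasiBridge {a} {α : Set a} (w : Nanoword α) : Set₁ where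
  field
    factor : Factor w
  open Factor factor public
  field
    k≥1          : 1 ℕ.≤ k
    κ            : Fin k → Fin k
    κ-involutive : Involutive _≡_ κ
    even         : ∀ r → κ r ≡ r → 2 ∣ length (v r)
    -- Only the values of ι on ℬ are relevant.
    ι            : Letter w → Letter w
    ι-in-ℬ       : ∀ B → ℬ B → ℬ (ι B)
    ι-reverse    : ∀ r → map ι (v r) ≡ reverse (v (κ r))

  -- Positions are counted from 0, so n_r + 1 − j becomes n_r − 1 − j.
  Symmetric : Position → Position → Set
  Symmetric (r , j) (r′ , j′) = r′ ≡ κ r × suc (toℕ j ℕ.+ toℕ j′) ≡ length (v r)

  -- The graph of ε : ℬ → {0, 1}.
  data ε[_]≡_ (B : Letter w) : ℕ → Set where
    one  : ∀ p q → LeftmostOccurrence B p → Symmetric p q →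
           LeftmostOccurrence (ι B) q → ε[ B ]≡ 1
    zero : ∀ p q → LeftmostOccurrence B p → Symmetric p q →
           ¬ LeftmostOccurrence (ι B) q → ε[ B ]≡ 0

  -- Each two-element orbit contains exactly one r with r < κ r.
  arches : ℕ
  arches = length (filter (λ r → r Fin.<? κ r) (allFin k))

module _ {a} {α : Set a} (τ : α → α) where

  record Bridge (w : Nanoword α) : Set (a ⊔ lsuc 0ℓ) where
    field
      quasiBridge : QuasiBridge w
    open QuasiBridge quasiBridge public
    open Nanoword w using (∣_∣)
    field
      isBridge : ∀ B → ℬ B → ∀ e → ε[ B ]≡ e → ∣ ι B ∣ ≡ iterate τ ∣ B ∣ e

  record BridgeMove (w v : Nanoword α) : Set (a ⊔ lsuc 0ℓ) where
    field
      bridge : Bridge w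
    open Bridge bridge public using (ℬ; x; arches)
    field
      sub     : v IsAlphabetOf w Minus ℬ
      deleted : map (incl sub) (word v) ≡ concat (tabulate x)

  data Move (w v : Nanoword α) : Set (a ⊔ lsuc 0ℓ) where
    isomorphism : w ≅ v → Move w v
    homotopy    : HomotopyMove τ w v → Move w v
    bridge      : BridgeMove w v → Move w v

  Metamorphosis : Rel (Nanoword α) (a ⊔ lsuc 0ℓ)
  Metamorphosis = EqClosure Move

  move-arches : ∀ {w v} → Move w v → ℕ
  move-arches (isomorphism _) = 0
  move-arches (homotopy _)    = 0
  move-arches (bridge m)      = BridgeMove.arches m

  g : ∀ {w v} → Metamorphosis w v → ℕ
  g ε            = 0
  g (fwd m ◅ ms) = move-arches m ℕ.+ g ms
  g (bwd m ◅ ms) = move-arches m ℕ.+ g ms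

  IsBridgeNorm : Nanoword α → ℕ → Set (a ⊔ lsuc 0ℓ)
  IsBridgeNorm w r = IsMinimum ℕ._≤_ (g {w} {∅}) r

  IsBridgeDistance : Nanoword α → Nanoword α → ℕ → Set (a ⊔ lsuc 0ℓ)
  IsBridgeDistance w v r = IsBridgeNorm (w · v ⁻) r

infixl 6 _⊞_
infix  8 ⊟_

data Term {a} (α : Set a) : Set a where
  gen : α → Term α
  𝟘   : Term α
  _⊞_ : Term α → Term α → Term α
  ⊟_  : Term α → Term α

module _ {a} {α : Set a} (τ : α → α) where

  infix 4 _≈π_
  data _≈π_ : Rel (Term α) a where
    refl≈     : ∀ {s} → s ≈π s
    sym≈      : ∀ {s t} → s ≈π t → t ≈π s
    trans≈    : ∀ {s t u} → s ≈π t → t ≈π u → s ≈π u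
    ⊞-cong    : ∀ {s s′ t t′} → s ≈π s′ → t ≈π t′ → s ⊞ t ≈π s′ ⊞ t′
    ⊟-cong    : ∀ {s t} → s ≈π t → ⊟ s ≈π ⊟ t
    ⊞-assoc   : ∀ s t u → (s ⊞ t) ⊞ u ≈π s ⊞ (t ⊞ u)
    ⊞-comm    : ∀ s t → s ⊞ t ≈π t ⊞ s
    ⊞-𝟘       : ∀ s → s ⊞ 𝟘 ≈π s
    ⊞-inverse : ∀ s → s ⊞ ⊟ s ≈π 𝟘
    relation  : ∀ b → gen b ⊞ gen (τ b) ≈π 𝟘

  π : AbelianGroup a a
  π = record
    { Carrier = Term α
    ; _≈_ = _≈π_
    ; _∙_ = _⊞_
    ; ε   = 𝟘
    ; _⁻¹ = ⊟_
    ; isAbelianGroup = record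
      { isGroup = record
        { isMonoid = record
          { isSemigroup = record
            { isMagma = record
              { isEquivalence = record { refl = refl≈ ; sym = sym≈ ; trans = trans≈ }
              ; ∙-cong = ⊞-cong
              }
            ; assoc = ⊞-assoc
            }
          ; identity = (λ s → trans≈ (⊞-comm 𝟘 s) (⊞-𝟘 s)) , ⊞-𝟘
          }
        ; inverse = (λ s → trans≈ (⊞-comm (⊟ s) s) (⊞-inverse s)) , ⊞-inverse
        ; ⁻¹-cong = ⊟-cong
        }
      ; comm = ⊞-comm
      }
    }

module _ {a} {α : Set a} where

  -- Multiples and sums in π use only its operations, hence do not depend on τ.
  term-rawMonoid : RawMonoid a a
  term-rawMonoid = record { Carrier = Term α ; _≈_ = _≡_ ; _∙_ = _⊞_ ; ε = 𝟘 }

  infix 7 _•_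
  _•_ : ℤ → Term α → Term α
  (+ n)    • t = RawMonoidOps._×_ term-rawMonoid n t
  -[1+ n ] • t = ⊟ ((+ suc n) • t)

  ∑ : (X : FiniteSet) → (Carrier X → Term α) → Term α
  ∑ X f = RawMonoidOps.sum term-rawMonoid (f ∘ FiniteSet.element X)

-- S = S° ∪ {s} is rendered as Maybe S°, with s = nothing.
record Pairing {a} (α : Set a) : Set (a ⊔ lsuc 0ℓ) where
  field
    S°  : FiniteSet
    ∣_∣ : Carrier S° → α

  S : Set
  S = Maybe (Carrier S°)

  field
    e   : S → S → Term α

pattern s = nothing

module _ {a} {α : Set a} where

  opposite : Pairing α → Pairing α
  opposite p = record { S° = S° ; ∣_∣ = ∣_∣ ; e = λ A B → ⊟ e A B }
    where open Pairing p

  infixl 6 _⊕_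
  _⊕_ : Pairing α → Pairing α → Pairing α
  p₁ ⊕ p₂ = record { S° = p₁.S° ⊎ᶠ p₂.S° ; ∣_∣ = [ p₁.∣_∣ , p₂.∣_∣ ]′ ; e = e }
    where
    module p₁ = Pairing p₁
    module p₂ = Pairing p₂

    S : Set
    S = Maybe (Carrier p₁.S° ⊎ Carrier p₂.S°)

    e : S → S → Term α
    e (just (inj₁ A)) (just (inj₁ B)) = p₁.e (just A) (just B)
    e (just (inj₂ A)) (just (inj₂ B)) = p₂.e (just A) (just B)
    e (just (inj₁ A)) (just (inj₂ B)) = 𝟘
    e (just (inj₂ A)) (just (inj₁ B)) = 𝟘
    e (just (inj₁ A)) s               = p₁.e (just A) s
    e (just (inj₂ A)) s               = p₂.e (just A) s
    e s               (just (inj₁ A)) = p₁.e s (just A)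
    e s               (just (inj₂ A)) = p₂.e s (just A)
    e s               s               = p₁.e s s ⊞ p₂.e s s

module _ {a} {α : Set a} (τ : α → α) (p : Pairing α) where
  open Pairing p

  ℤS : Set
  ℤS = S → ℤ

  basis : S → ℤS
  basis A B = if does (Maybe.≡-dec (FiniteSet._≟_ S°) A B) then 1ℤ else 0ℤ

  ∑S : (S → Term α) → Term α
  ∑S f = f s ⊞ ∑ S° (f ∘ just)

  ẽ : ℤS → ℤS → Term α
  ẽ x y = ∑S λ A → ∑S λ B → (x A ℤ.* y B) • e A B

  data Short (x : ℤS) : Set a where
    single     : ∀ A → x ≗ basis (just A) → Short x
    sum        : ∀ A B → A ≢ B → ∣ A ∣ ≡ ∣ B ∣ →
                 x ≗ (λ C → basis (just A) C ℤ.+ basis (just B) C) → Short x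
    difference : ∀ A B → A ≢ B → ∣ A ∣ ≡ τ ∣ B ∣ →
                 x ≗ (λ C → basis (just A) C ℤ.- basis (just B) C) → Short x

  record Filling : Set a where
    field
      n           : ℕ
      vec         : Fin n → ℤS
      base        : Fin n
      base-is-s   : vec base ≗ basis s
      others      : ∀ i → i ≢ base → Short (vec i)
      exactly-one : ∀ A → ∃! _≡_ (λ i → vec i (just A) ≢ 0ℤ)

  gram : (Term α → ℤ) → (λ′ : Filling) → let open Filling λ′ in Fin n → Fin n → ℚ
  gram φ λ′ i j = φ (ẽ (vec i) (vec j)) / 1
    where open Filling λ′

  halfRank : (φ : Term α → ℤ) → (Σ Filling λ λ′ → Σ ℕ λ r → IsRank (gram φ λ′) r) → ℚ
  halfRank φ (_ , r , _) = ½ ℚ.* (+ r / 1)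

  IsGenus : (Term α → ℤ) → ℚ → Set a
  IsGenus φ σ = IsMinimum ℚ._≤_ (halfRank φ) σ

module _ {a} {α : Set a} (w : Nanoword α) where
  open Nanoword w hiding (Letter; word)

  private
    i j : Letter w → Fin (length (word w))
    i A = Twice.first (twice A)
    j A = Twice.last (twice A)

  n⟨_,_⟩ : Letter w → Letter w → ℤ
  n⟨ A , B ⟩ =
    if does (i A Fin.<? i B ×-dec i B Fin.<? j A ×-dec j A Fin.<? j B) then 1ℤ else
    if does (i B Fin.<? i A ×-dec i A Fin.<? j B ×-dec j B Fin.<? j A) then -1ℤ else
    0ℤ

  infix 7 _∘w_
  _∘w_ : Letter w → Letter w → Term α
  A ∘w B = ∑ alphabet λ D →
    if does ((i A Fin.<? i D ×-dec i D Fin.<? j A) ×-dec (i B Fin.<? j D ×-dec j D Fin.<? j B))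
    then gen ∣ D ∣ else 𝟘

  pairing : Pairing α
  pairing = record { S° = alphabet ; ∣_∣ = ∣_∣ ; e = e }
    where
    toBase : Letter w → Term α
    toBase A = ∑ alphabet λ D → n⟨ A , D ⟩ • gen ∣ D ∣

    e : Maybe (Letter w) → Maybe (Letter w) → Term α
    e (just A) (just B) = (+ 2) • (A ∘w B ⊞ ⊟ (B ∘w A)) ⊞ n⟨ A , B ⟩ • (gen ∣ A ∣ ⊞ gen ∣ B ∣)
    e (just A) s        = toBase A
    e s        (just A) = ⊟ toBase A
    e s        s        = 𝟘

module Submission where

-- Rescale the coordinates of ℤS by φ ∣ A ∣ = ±1.  Then a filling of p(w) amounts to a
-- partial matching of letters with labels in the same orbit of τ, and it spans the
-- vectors invariant under the matching.  Let ψ(o) = ±φ ∣ A ∣, with sign + if o is the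
-- first occurrence of A and − if it is the last one, let ō be the other occurrence of A,
-- and let
--   U_x(o) = x(s) + Σ_p ψ(p) x(p) sgn(o − p),   E_w(x, y) = Σ_o ψ(o) U_x(o) U_y(ō).
-- Then E_w is twice the pairing of w, and E_{wv⁻} = E_w − E_v is twice p_w ⊕ p_v⁻.
--
-- In a bridge move w → v with g arches, the reflection of the words of the bridge
-- reverses ψ and, within a word, sgn.  Hence, for x invariant under ι, the function that
-- is U_x on the occurrences in w as well as in v is invariant under the reflection
-- (extended by the exchange of common occurrences) up to a combination of 2g fixed
-- functions.  As the reflection reverses the sign of the form E_w − E_v, this difference
-- has rank at most 4g on such x.  The first two homotopy moves are bridge moves without
-- arches, and the third one does not change E.
--
-- Along a metamorphosis from ∅ to wv⁻ with ρ arches, matchings are extended by ι when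
-- letters are inserted, and glued along ι when letters are deleted.  This gives a
-- matching of the letters of wv⁻ on which E has rank at most 4ρ.  So σ_φ ≤ ½ · 4ρ.

open import Defs
open import Algebra.Bundles using (module AbelianGroup)
open import Algebra.Definitions using (Involutive)
open import Algebra.Morphism.Structures using (module GroupMorphisms)
open import Data.Bool.Base using (true; false; if_then_else_; Bool; _∧_; T)
open import Data.Empty using (⊥-elim; ⊥)
open import Data.Fin.Base as Fin using (Fin; zero; suc; _↑ˡ_; _↑ʳ_; punchIn; toℕ)
import Data.Fin.Properties as Fin
open import Data.Integer.Base as ℤ using (ℤ; 0ℤ; 1ℤ; _+_; _*_; -_; _-_; -1ℤ; +-0-rawGroup)
import Data.Integer.Properties as ℤ
open import Data.Integer.Tactic.RingSolver using (solve-∀)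
open import Data.List.Base as List using (List; []; _∷_; _++_; length; filter; allFin; tabulate; lookup; reverse; map; concat)
open import Data.List.Membership.Propositional using (_∈_)
open import Data.List.Membership.Propositional.Properties using (∈-filter⁺; ∈-filter⁻; ∈-tabulate⁺; ∈-lookup)
import Data.List.Properties as List
open import Data.List.Relation.Binary.Sublist.Heterogeneous.Core using (Sublist; []; _∷_; _∷ʳ_)
open import Data.List.Relation.Binary.Sublist.Propositional using (_⊆_; ⊆-refl)
open import Data.List.Relation.Binary.Sublist.Propositional.Properties using (++⁺; ++⁺ˡ)
open import Data.List.Relation.Unary.All as All using (All; []; _∷_)
import Data.List.Relation.Unary.All.Properties as All
open import Data.List.Relation.Unary.AllPairs using (_∷_)
open import Data.List.Relation.Unary.Any as Any using (here; there)
open import Data.List.Relation.Unary.Any.Properties using (lookup-index)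
open import Data.List.Relation.Unary.Unique.Propositional using (Unique)
import Data.List.Relation.Unary.Unique.Propositional.Properties as Unique
open import Data.Maybe.Base as Maybe using (Maybe; just; nothing)
import Data.Maybe.Properties as Maybe
open import Data.Nat.Base as ℕ using (ℕ; zero; suc; _<ᵇ_; _<_; _≤_; _∸_; z≤n; s≤s)
import Data.Nat.Properties as ℕ
open import Data.Product.Base using (Σ; ∃; ∃-syntax; _×_; _,_; proj₁; proj₂)
open import Data.Rational.Base as ℚ using (ℚ; 0ℚ; _/_; ½)
import Data.Rational.Properties as ℚ
open import Data.Rational.Unnormalised.Base as ℚᵘ using (mkℚᵘ; *≡*; *≤*)
import Data.Rational.Unnormalised.Properties as ℚᵘ
open import Data.Sum.Base as Sum using (_⊎_; inj₁; inj₂; [_,_]′; swap)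
import Data.Sum.Properties as Sum
open import Data.Vec.Functional using (insertAt)
open import Data.Vec.Functional.Properties using (insertAt-lookup; insertAt-punchIn)
open import Function.Base using (_∘_; id; const)
open import Function.Bundles using (_↔_; module Inverse; mk↔ₛ′; module Equivalence)
open import Function.Construct.Composition using (_↔-∘_)
open import Function.Construct.Identity using (↔-id)
open import Function.Construct.Symmetry using (↔-sym)
open import Function.Definitions using (Injective)
open import Level using () renaming (zero to 0ℓ)
open import Relation.Binary.Construct.Closure.ReflexiveTransitive using (_◅_) renaming (ε to [])
open import Relation.Binary.Construct.Closure.Symmetric using (fwd; bwd)
open import Relation.Binary.Definitions using (tri<; tri≈; tri>)
open import Relation.Binary.PropositionalEquality hiding (J)
open import Relation.Nullary using (does; ¬_; yes; no; contradiction; Dec; _⊎-dec_; ¬?)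
open import Relation.Nullary.Decidable using (dec-true; dec-false; decidable-stable)
open import Relation.Unary using (Pred; Decidable)
open import Algebra.Properties.CommutativeMonoid.Sum ℤ.+-0-commutativeMonoid using (sum-permute; sum-remove)
open import Algebra.Properties.Semiring.Sum ℤ.+-*-semiring as Sumᶠ using () renaming (sum to sumᶠ)
open FiniteSet using (Carrier; enum; element)
open Nanoword using (Letter; word)

-- Finite sums

-- Why 4g: if the functions `U` were invariant under the reflection, the terms of the form at an
-- occurrence and at its image would cancel. Two defects prevent this. A deleted interval adds a
-- multiple of its total weight to `U` at each kept occurrence, and an interval and its mirror image
-- receive different amounts from outside. Both defects change sign under `κ`, so they vanish on the
-- words fixed by `κ` and give one function each per arch: 2g in all. The form has two arguments,
-- either of which may be defective: 4g. The two factors ½, one from the genus and one from the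
-- inequality, cancel the 4.
--
-- The delicate direction is the deletion of letters. A vector on the remaining letters has to be
-- extended to the deleted ones so as to be invariant under the old matching and under the
-- involution of the bridge at once.
--
-- Ranks are bounded by writing a multiple of the form as a sum of products, which is compatible
-- with sums, restrictions and division. The rank itself is only available up to double negation;
-- that suffices, since the inequality to be proved is decidable.

Finᶠ : ℕ → FiniteSet
Finᶠ k = record { Carrier = Fin k ; size = k ; enum = ↔-id (Fin k) }

index : (X : FiniteSet) → Carrier X → Fin (FiniteSet.size X)
index X = Inverse.from (enum X)

element-index : ∀ X A → element X (index X A) ≡ A
element-index X A = Inverse.inverseˡ (enum X) refl

index-element : ∀ X i → index X (element X i) ≡ i
index-element X i = Inverse.inverseʳ (enum X) refl

sum-cong : ∀ {n} {f g : Fin n → ℤ} → (∀ i → f i ≡ g i) → sumᶠ f ≡ sumᶠ g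
sum-cong = Sumᶠ.sum-cong-≗

sum-zero : ∀ {n} {f : Fin n → ℤ} → (∀ i → f i ≡ 0ℤ) → sumᶠ f ≡ 0ℤ
sum-zero {n} f≡0 = trans (sum-cong f≡0) (Sumᶠ.sum-replicate-zero n)

sum-single : ∀ {n} {f : Fin n → ℤ} i → (∀ j → j ≢ i → f j ≡ 0ℤ) → sumᶠ f ≡ f i
sum-single {suc n} {f} zero h =
  trans (cong (f zero +_) (sum-zero λ j → h (suc j) λ ())) (ℤ.+-identityʳ _)
sum-single {suc n} {f} (suc i) h =
  trans (cong₂ _+_ (h zero λ ()) (sum-single i λ j j≢i → h (suc j) (j≢i ∘ Fin.suc-injective)))
        (ℤ.+-identityˡ _)

sum-split : ∀ m {n} (f : Fin (m ℕ.+ n) → ℤ) →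
            sumᶠ f ≡ sumᶠ (λ i → f (i ↑ˡ n)) + sumᶠ (λ j → f (m ↑ʳ j))
sum-split zero    f = sym (ℤ.+-identityˡ _)
sum-split (suc m) f =
  trans (cong (f zero +_) (sum-split m (f ∘ suc))) (sym (ℤ.+-assoc (f zero) _ _))

opaque

  -- Opaque, so that sums are handled through the laws below and the enumeration of `X` stays
  -- hidden.
  Σℤ : (X : FiniteSet) → (Carrier X → ℤ) → ℤ
  Σℤ X f = sumᶠ (f ∘ element X)

module _ (X : FiniteSet) where

  onlyAt : Carrier X → (Carrier X → ℤ) → Carrier X → ℤ
  onlyAt B f A = if does (FiniteSet._≟_ X A B) then f A else 0ℤ

  onlyAt-self : ∀ B f → onlyAt B f B ≡ f B
  onlyAt-self B f = cong (λ b → if b then f B else 0ℤ) (dec-true (FiniteSet._≟_ X B B) refl)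

  onlyAt-other : ∀ {B} f {A} → A ≢ B → onlyAt B f A ≡ 0ℤ
  onlyAt-other {B} f {A} A≢B = cong (λ b → if b then f A else 0ℤ) (dec-false (FiniteSet._≟_ X A B) A≢B)

  onlyAt-zero : ∀ B f {A} → f A ≡ 0ℤ → onlyAt B f A ≡ 0ℤ
  onlyAt-zero B f {A} fA≡0 with does (FiniteSet._≟_ X A B)
  ... | true  = fA≡0
  ... | false = refl

  opaque
    unfolding Σℤ

    Σ-cong : ∀ {f g} → (∀ A → f A ≡ g A) → Σℤ X f ≡ Σℤ X g
    Σ-cong f≡g = sum-cong {FiniteSet.size X} (f≡g ∘ element X)

    Σ-zero : ∀ {f} → (∀ A → f A ≡ 0ℤ) → Σℤ X f ≡ 0ℤ
    Σ-zero f≡0 = sum-zero {FiniteSet.size X} (f≡0 ∘ element X)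

    Σ-+ : ∀ f g → Σℤ X (λ A → f A + g A) ≡ Σℤ X f + Σℤ X g
    Σ-+ f g = Sumᶠ.∑-distrib-+ {FiniteSet.size X} (f ∘ element X) (g ∘ element X)

    Σ-*ˡ : ∀ c f → c * Σℤ X f ≡ Σℤ X (λ A → c * f A)
    Σ-*ˡ c f = Sumᶠ.*-distribˡ-sum {FiniteSet.size X} c (f ∘ element X)

    Σ-*ʳ : ∀ c f → Σℤ X f * c ≡ Σℤ X (λ A → f A * c)
    Σ-*ʳ c f = Sumᶠ.*-distribʳ-sum {FiniteSet.size X} c (f ∘ element X)

    Σ-neg : ∀ f → - Σℤ X f ≡ Σℤ X (λ A → - f A)
    Σ-neg f = trans (sym (ℤ.-1*i≡-i _))
      (trans (Σ-*ˡ (- 1ℤ) f) (Σ-cong λ A → ℤ.-1*i≡-i (f A)))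

    Σ-single : ∀ {f} B → (∀ A → A ≢ B → f A ≡ 0ℤ) → Σℤ X f ≡ f B
    Σ-single {f} B h = trans
      (sum-single {FiniteSet.size X} (index X B) λ j j≢B → h (element X j)
        λ eq → j≢B (trans (sym (index-element X j)) (cong (index X) eq)))
      (cong f (element-index X B))

    Σ-onlyAt : ∀ B f → Σℤ X (onlyAt B f) ≡ f B
    Σ-onlyAt B f = trans (Σ-single B λ A A≢B → onlyAt-other f A≢B) (onlyAt-self B f)

    Σ-swap : ∀ Y (f : Carrier X → Carrier Y → ℤ) → Σℤ X (λ A → Σℤ Y (f A)) ≡ Σℤ Y (λ B → Σℤ X (λ A → f A B))
    Σ-swap Y f = Sumᶠ.∑-comm {FiniteSet.size X} {FiniteSet.size Y} (λ i j → f (element X i) (element Y j))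

    Σ-⊎ : ∀ Y f → Σℤ (X ⊎ᶠ Y) f ≡ Σℤ X (f ∘ inj₁) + Σℤ Y (f ∘ inj₂)
    Σ-⊎ Y f = trans (sum-split (FiniteSet.size X) _) (cong₂ _+_
      (sum-cong {FiniteSet.size X} λ i → cong (f ∘ Sum.map (element X) (element Y)) (Fin.splitAt-↑ˡ (FiniteSet.size X) i (FiniteSet.size Y)))
      (sum-cong {FiniteSet.size Y} λ j → cong (f ∘ Sum.map (element X) (element Y)) (Fin.splitAt-↑ʳ (FiniteSet.size X) (FiniteSet.size Y) j)))

    Σ-bijection : ∀ Y (h : Carrier X ↔ Carrier Y) f → Σℤ Y f ≡ Σℤ X (f ∘ Inverse.to h)
    Σ-bijection Y h f = trans
      (sum-permute (f ∘ element Y) (↔-sym (enum Y) ↔-∘ (h ↔-∘ enum X)))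
      (sum-cong {FiniteSet.size X} λ i → cong f (element-index Y (Inverse.to h (element X i))))

    Σ-involution : (J : Carrier X → Carrier X) → (∀ A → J (J A) ≡ A) →
                   ∀ f → Σℤ X f ≡ Σℤ X (f ∘ J)
    Σ-involution J JJ = Σ-bijection X (mk↔ₛ′ J J JJ JJ)

    -- Double counting: `δ A B` is `f A` if `incl B` is `A` and zero otherwise. Its rows sum to
    -- `f A`, by the assumption on the support and injectivity, and its columns to `f (incl B)`.
    Σ-image : ∀ Y {incl : Carrier Y → Carrier X} → Injective _≡_ _≡_ incl → ∀ {f} →
              (∀ A → f A ≡ 0ℤ ⊎ ∃[ B ] incl B ≡ A) → Σℤ X f ≡ Σℤ Y (f ∘ incl)
    Σ-image Y {incl} inj {f} supp = trans (Σ-cong row) (trans (Σ-swap Y δ)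
      (sum-cong {FiniteSet.size Y} λ i → Σ-onlyAt (incl (element Y i)) f))
      where
      δ : Carrier X → Carrier Y → ℤ
      δ A B = onlyAt (incl B) f A

      row : ∀ A → f A ≡ Σℤ Y (δ A)
      row A with supp A
      ... | inj₁ fA≡0 = trans fA≡0 (sym (sum-zero {FiniteSet.size Y} λ i → onlyAt-zero (incl (element Y i)) f fA≡0))
      ... | inj₂ (B , refl) = sym (trans
        (trans (sum-single {FiniteSet.size Y} (index Y B) λ j j≢B → onlyAt-other f λ eq → j≢B
          (trans (sym (index-element Y j)) (cong (index Y) (inj (sym eq)))))
          (cong (δ (incl B)) (element-index Y B)))
        (onlyAt-self (incl B) f))

-- Ranks over ℚ of integer matrices

module _ {k} (p : Fin (suc k) → ℤ) (i₀ : Fin (suc k)) where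

  -- One step of fraction-free Gaussian elimination: the unknown `i₀` is removed from the equation
  -- `q` by means of `p`, after multiplication by the pivot `p i₀`.
  eliminate : (Fin (suc k) → ℤ) → Fin k → ℤ
  eliminate q i = p i₀ * q (punchIn i₀ i) - p (punchIn i₀ i) * q i₀

  -- The solution is multiplied by the pivot, so that the missing coordinate, determined by the
  -- equation `p`, is an integer.
  back-substitute : (Fin k → ℤ) → Fin (suc k) → ℤ
  back-substitute c = insertAt (λ i → p i₀ * c i) i₀ (- sumᶠ (λ i → p (punchIn i₀ i) * c i))

  back-substitute-sum : ∀ q c → sumᶠ (λ i → q i * back-substitute c i) ≡ sumᶠ (λ i → eliminate q i * c i)
  back-substitute-sum q c = begin
    sumᶠ (λ i → q i * back-substitute c i)
      ≡⟨ sum-remove {k} {i₀} (λ i → q i * back-substitute c i) ⟩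
    q i₀ * back-substitute c i₀ + sumᶠ (λ i → q (punchIn i₀ i) * back-substitute c (punchIn i₀ i))
      ≡⟨ cong₂ _+_ (cong (q i₀ *_) (insertAt-lookup _ i₀ _))
           (sum-cong λ i → cong (q (punchIn i₀ i) *_) (insertAt-punchIn _ i₀ _ i)) ⟩
    q i₀ * - S + sumᶠ (λ i → q (punchIn i₀ i) * (p i₀ * c i))
      ≡⟨ cong (_+ sumᶠ (λ i → q (punchIn i₀ i) * (p i₀ * c i))) (shuffle (q i₀) S) ⟩
    (- q i₀) * S + sumᶠ (λ i → q (punchIn i₀ i) * (p i₀ * c i))
      ≡⟨ cong (_+ sumᶠ (λ i → q (punchIn i₀ i) * (p i₀ * c i))) (Sumᶠ.*-distribˡ-sum {k} (- q i₀) _) ⟩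
    sumᶠ (λ i → (- q i₀) * (p (punchIn i₀ i) * c i)) + sumᶠ (λ i → q (punchIn i₀ i) * (p i₀ * c i))
      ≡⟨ Sumᶠ.∑-distrib-+ {k} _ _ ⟨
    sumᶠ (λ i → (- q i₀) * (p (punchIn i₀ i) * c i) + q (punchIn i₀ i) * (p i₀ * c i))
      ≡⟨ (sum-cong λ i → collect (q i₀) (p (punchIn i₀ i)) (c i) (q (punchIn i₀ i)) (p i₀)) ⟩
    sumᶠ (λ i → eliminate q i * c i) ∎
    where
    open ≡-Reasoning
    S = sumᶠ (λ i → p (punchIn i₀ i) * c i)
    shuffle : ∀ a b → a * - b ≡ (- a) * b
    shuffle = solve-∀
    collect : ∀ q₀ a c b p₀ → (- q₀) * (a * c) + b * (p₀ * c) ≡ (p₀ * b - a * q₀) * c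
    collect = solve-∀

-- Induction on the number of equations. It is a separate argument `n` because the recursive call is
-- on a mapped list. A vanishing equation is dropped; any other one supplies a pivot and eliminates
-- one unknown.
underdetermined : ∀ {k} n (ps : List (Fin k → ℤ)) → length ps ≡ n → n ℕ.< k →
                  ∃[ c ] (∃[ i ] c i ≢ 0ℤ) × All (λ p → sumᶠ (λ i → p i * c i) ≡ 0ℤ) ps
underdetermined {suc k} n [] _ _ = (λ _ → 1ℤ) , (zero , λ ()) , []
underdetermined {suc k} (suc n) (p ∷ ps) |ps| (ℕ.s≤s n<k) with Fin.all? (λ i → p i ℤ.≟ 0ℤ)
... | yes p≡0 =
  let c , c≢0 , hs = underdetermined n ps (ℕ.suc-injective |ps|) (ℕ.m<n⇒m<1+n n<k)
  in c , c≢0 , sum-zero (λ i → cong (_* c i) (p≡0 i)) ∷ hs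
... | no p≢0 with Fin.¬∀⟶∃¬ (suc k) _ (λ i → p i ℤ.≟ 0ℤ) p≢0
... | i₀ , pi₀≢0 =
  let c , (i , ci≢0) , hs = underdetermined n (List.map (eliminate p i₀) ps)
                              (trans (List.length-map (eliminate p i₀) ps) (ℕ.suc-injective |ps|)) n<k
  in back-substitute p i₀ c
   , (punchIn i₀ i , λ eq → [ pi₀≢0 , ci≢0 ]′
       (ℤ.i*j≡0⇒i≡0∨j≡0 (p i₀) (trans (sym (insertAt-punchIn _ i₀ _ i)) eq)))
   , trans (back-substitute-sum p i₀ p c)
       (sum-zero λ j → cong (_* c j) (self (p i₀) (p (punchIn i₀ j))))
   ∷ All.map (λ {q} h → trans (back-substitute-sum p i₀ q c) h) (All.map⁻ hs)
  where
  self : ∀ a b → a * b - b * a ≡ 0ℤ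
  self = solve-∀

toℚᵘ-/1 : ∀ n → ℚ.toℚᵘ (n / 1) ℚᵘ.≃ mkℚᵘ n 0
toℚᵘ-/1 n = ℚ.toℚᵘ-fromℚᵘ (mkℚᵘ n 0)

/1-+ : ∀ m n → (m / 1) ℚ.+ (n / 1) ≡ (m + n) / 1
/1-+ m n = ℚ.toℚᵘ-injective (begin
  ℚ.toℚᵘ ((m / 1) ℚ.+ (n / 1))              ≈⟨ ℚ.toℚᵘ-homo-+ (m / 1) (n / 1) ⟩
  ℚ.toℚᵘ (m / 1) ℚᵘ.+ ℚ.toℚᵘ (n / 1)    ≈⟨ ℚᵘ.+-cong (toℚᵘ-/1 m) (toℚᵘ-/1 n) ⟩
  mkℚᵘ m 0 ℚᵘ.+ mkℚᵘ n 0                ≈⟨ *≡* (cong (_* 1ℤ) (cong₂ _+_ (ℤ.*-identityʳ m) (ℤ.*-identityʳ n))) ⟩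
  mkℚᵘ (m + n) 0                        ≈⟨ toℚᵘ-/1 (m + n) ⟨
  ℚ.toℚᵘ ((m + n) / 1)                  ∎)
  where open ℚᵘ.≃-Reasoning

/1-* : ∀ m n → (m / 1) ℚ.* (n / 1) ≡ (m * n) / 1
/1-* m n = ℚ.toℚᵘ-injective (begin
  ℚ.toℚᵘ ((m / 1) ℚ.* (n / 1))              ≈⟨ ℚ.toℚᵘ-homo-* (m / 1) (n / 1) ⟩
  ℚ.toℚᵘ (m / 1) ℚᵘ.* ℚ.toℚᵘ (n / 1)    ≈⟨ ℚᵘ.*-cong (toℚᵘ-/1 m) (toℚᵘ-/1 n) ⟩
  mkℚᵘ m 0 ℚᵘ.* mkℚᵘ n 0                ≈⟨ *≡* refl ⟩
  mkℚᵘ (m * n) 0                        ≈⟨ toℚᵘ-/1 (m * n) ⟨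
  ℚ.toℚᵘ ((m * n) / 1)                  ∎)
  where open ℚᵘ.≃-Reasoning

/1-zero : ∀ n → n / 1 ≡ 0ℚ → n ≡ 0ℤ
/1-zero n eq with ℚᵘ.≃-trans (ℚᵘ.≃-sym (toℚᵘ-/1 n)) (ℚᵘ.≃-reflexive (cong ℚ.toℚᵘ eq))
... | *≡* eq′ = trans (sym (ℤ.*-identityʳ n)) eq′

ℚ-sum-/1 : ∀ {n} (f : Fin n → ℤ) → ℚ-sum (λ i → f i / 1) ≡ sumᶠ f / 1
ℚ-sum-/1 {zero}  f = refl
ℚ-sum-/1 {suc n} f = trans (cong ((f zero / 1) ℚ.+_) (ℚ-sum-/1 (f ∘ suc))) (/1-+ (f zero) _)

ℚ-sum-cong : ∀ {n} {f g : Fin n → ℚ} → (∀ i → f i ≡ g i) → ℚ-sum f ≡ ℚ-sum g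
ℚ-sum-cong {zero}  f≡g = refl
ℚ-sum-cong {suc n} f≡g = cong₂ ℚ._+_ (f≡g zero) (ℚ-sum-cong (f≡g ∘ suc))

-- Forms that are sums of few products

listSum : ∀ {ℓ} {A : Set ℓ} → (A → ℤ) → List A → ℤ
listSum f []       = 0ℤ
listSum f (x ∷ xs) = f x + listSum f xs

module _ {ℓ} {A : Set ℓ} where

  listSum-++ : ∀ (f : A → ℤ) xs ys → listSum f (xs ++ ys) ≡ listSum f xs + listSum f ys
  listSum-++ f []       ys = sym (ℤ.+-identityˡ _)
  listSum-++ f (x ∷ xs) ys = trans (cong (f x +_) (listSum-++ f xs ys)) (sym (ℤ.+-assoc (f x) _ _))

  listSum-map : ∀ {ℓ′} {B : Set ℓ′} (f : B → ℤ) (h : A → B) xs →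
                listSum f (List.map h xs) ≡ listSum (f ∘ h) xs
  listSum-map f h []       = refl
  listSum-map f h (x ∷ xs) = cong (f (h x) +_) (listSum-map f h xs)

  listSum-cong : ∀ {f g : A → ℤ} xs → (∀ x → f x ≡ g x) → listSum f xs ≡ listSum g xs
  listSum-cong []       f≡g = refl
  listSum-cong (x ∷ xs) f≡g = cong₂ _+_ (f≡g x) (listSum-cong xs f≡g)

  listSum-*ˡ : ∀ c (f : A → ℤ) xs → c * listSum f xs ≡ listSum (λ x → c * f x) xs
  listSum-*ˡ c f []       = ℤ.*-zeroʳ c
  listSum-*ˡ c f (x ∷ xs) = trans (ℤ.*-distribˡ-+ c (f x) _) (cong (c * f x +_) (listSum-*ˡ c f xs))

  sum-listSum : ∀ {n} (f : A → Fin n → ℤ) xs →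
                sumᶠ (λ i → listSum (λ x → f x i) xs) ≡ listSum (λ x → sumᶠ (f x)) xs
  sum-listSum {n} f []   = sum-zero {n} λ _ → refl
  sum-listSum f (x ∷ xs) = trans (Sumᶠ.∑-distrib-+ (f x) _) (cong (sumᶠ (f x) +_) (sum-listSum f xs))

-- A multiple of F is a sum of N products of functions of one variable, so that
-- every Gram matrix of F has rank at most N.
record HasRank {V : Set} (N : ℕ) (F : V → V → ℤ) : Set where
  field
    factors   : List ((V → ℤ) × (V → ℤ))
    size      : length factors ℕ.≤ N
    scale     : ℤ
    scale≢0   : scale ≢ 0ℤ
    expansion : ∀ x y → scale * F x y ≡ listSum (λ (P , Q) → P x * Q y) factors

-- With more rows than products, some nonzero combination `c` of the rows annihilates all the left
-- factors. Then the coefficients `c i * scale` give a linear relation between the rows of the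
-- matrix, and `scale` is not zero.
rank-bound : ∀ {V : Set} {N} {F : V → V → ℤ} → HasRank N F → ∀ {m n} (x : Fin m → V) (y : Fin n → V) →
             ∀ {k} (f : Fin k → Fin m) → LinearlyIndependent (λ i j → F (x (f i)) (y j) / 1) → k ℕ.≤ N
rank-bound {F = F} hr x y {k} f indep with k ℕ.≤? length (HasRank.factors hr)
... | yes k≤ = ℕ.≤-trans k≤ (HasRank.size hr)
... | no  k≰ = contradiction (c≡0 i) ci≢0
  where
  open HasRank hr
  open ≡-Reasoning
  left : List (Fin k → ℤ)
  left = List.map (λ (P , Q) i → P (x (f i))) factors
  solution = underdetermined (length factors) left (List.length-map _ factors) (ℕ.≰⇒> k≰)
  c = proj₁ solution
  i = proj₁ (proj₁ (proj₂ solution))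
  ci≢0 = proj₂ (proj₁ (proj₂ solution))

  vanish : ∀ v (l : List ((_ → ℤ) × (_ → ℤ))) →
           All (λ p → sumᶠ (λ i → p i * c i) ≡ 0ℤ) (List.map (λ (P , Q) i → P (x (f i))) l) →
           listSum (λ (P , Q) → sumᶠ (λ i → c i * (P (x (f i)) * Q v))) l ≡ 0ℤ
  vanish v [] [] = refl
  vanish v ((P , Q) ∷ l) (h ∷ hs) = cong₂ _+_ (begin
    sumᶠ (λ i → c i * (P (x (f i)) * Q v))   ≡⟨ (sum-cong λ i → shuffle (c i) (P (x (f i))) (Q v)) ⟩
    sumᶠ (λ i → (P (x (f i)) * c i) * Q v)   ≡⟨ Sumᶠ.*-distribʳ-sum {k} (Q v) _ ⟨
    sumᶠ (λ i → P (x (f i)) * c i) * Q v     ≡⟨ cong (_* Q v) h ⟩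
    0ℤ * Q v                                 ≡⟨⟩
    0ℤ                                       ∎) (vanish v l hs)
    where
    shuffle : ∀ a b c → a * (b * c) ≡ (b * a) * c
    shuffle = solve-∀

  combination : ∀ j → sumᶠ (λ i → (c i * scale) * F (x (f i)) (y j)) ≡ 0ℤ
  combination j = begin
    sumᶠ (λ i → (c i * scale) * F (x (f i)) (y j))
      ≡⟨ (sum-cong λ i → trans (ℤ.*-assoc (c i) scale _) (cong (c i *_) (expansion _ _))) ⟩
    sumᶠ (λ i → c i * listSum (λ (P , Q) → P (x (f i)) * Q (y j)) factors)
      ≡⟨ (sum-cong λ i → listSum-*ˡ (c i) _ factors) ⟩
    sumᶠ (λ i → listSum (λ (P , Q) → c i * (P (x (f i)) * Q (y j))) factors)
      ≡⟨ sum-listSum (λ (P , Q) i → c i * (P (x (f i)) * Q (y j))) factors ⟩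
    listSum (λ (P , Q) → sumᶠ (λ i → c i * (P (x (f i)) * Q (y j)))) factors
      ≡⟨ vanish (y j) factors (proj₂ (proj₂ solution)) ⟩
    0ℤ ∎

  c≡0 : ∀ i → c i ≡ 0ℤ
  c≡0 i = [ id , (λ eq → ⊥-elim (scale≢0 eq)) ]′ (ℤ.i*j≡0⇒i≡0∨j≡0 (c i) (/1-zero _
    (indep (λ i → (c i * scale) / 1)
      (λ j → trans (ℚ-sum-cong λ i → /1-* (c i * scale) _) (trans (ℚ-sum-/1 {k} _) (cong (_/ 1) (combination j)))) i)))

-- `P` need not be decidable, whence the double negation. If `r` is not maximal, there is no way to
-- avoid a larger `k` with `P k`, and the bound `N` permits only `n` such improvements when
-- `N ≤ n + r`.
¬¬-maximum : ∀ {P : ℕ → Set} {N} → P 0 → (∀ k → P k → k ℕ.≤ N) →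
             ¬ ¬ (∃[ r ] P r × ∀ k → P k → k ℕ.≤ r)
¬¬-maximum {P} {N} p₀ bounded ¬max = none N 0 p₀ (ℕ.≤-reflexive (sym (ℕ.+-identityʳ N)))
  where
  none : ∀ n r → P r → ¬ N ℕ.≤ n ℕ.+ r
  none zero    r pr N≤ = ¬max (r , pr , λ k pk → ℕ.≤-trans (bounded k pk) N≤)
  none (suc n) r pr N≤ = ¬max (r , pr , λ k pk → ℕ.≮⇒≥ λ r<k → none n k pk
    (ℕ.≤-trans N≤ (subst (ℕ._≤ n ℕ.+ k) (ℕ.+-suc n r) (ℕ.+-monoʳ-≤ n r<k))))

module _ {V : Set} where

  hasRank-zero : {F : V → V → ℤ} → (∀ x y → F x y ≡ 0ℤ) → HasRank 0 F
  hasRank-zero F≡0 = record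
    { factors = [] ; size = ℕ.z≤n ; scale = 1ℤ ; scale≢0 = λ ()
    ; expansion = λ x y → trans (ℤ.*-identityˡ _) (F≡0 x y) }

  hasRank-≤ : ∀ {N M} {F : V → V → ℤ} → N ℕ.≤ M → HasRank N F → HasRank M F
  hasRank-≤ N≤M hr = record
    { factors = factors ; size = ℕ.≤-trans size N≤M ; scale = scale
    ; scale≢0 = scale≢0 ; expansion = expansion }
    where open HasRank hr

  -- This is what `scale` is for: the factor `c` is absorbed into it, and forms are divided without
  -- leaving ℤ.
  hasRank-divide : ∀ {N} {F G : V → V → ℤ} c → c ≢ 0ℤ → (∀ x y → c * F x y ≡ G x y) →
                   HasRank N G → HasRank N F
  hasRank-divide {F = F} c c≢0 cF≡G hr = record
    { factors = factors ; size = size ; scale = scale * c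
    ; scale≢0 = λ eq → [ scale≢0 , c≢0 ]′ (ℤ.i*j≡0⇒i≡0∨j≡0 scale eq)
    ; expansion = λ x y → trans (ℤ.*-assoc scale c (F x y))
        (trans (cong (scale *_) (cF≡G x y)) (expansion x y)) }
    where open HasRank hr

  hasRank-resp : ∀ {N} {F G : V → V → ℤ} → (∀ x y → F x y ≡ G x y) → HasRank N G → HasRank N F
  hasRank-resp F≡G = hasRank-divide 1ℤ (λ ()) (λ x y → trans (ℤ.*-identityˡ _) (F≡G x y))

  hasRank-neg : ∀ {N} {F : V → V → ℤ} → HasRank N F → HasRank N (λ x y → - F x y)
  hasRank-neg {F = F} = hasRank-divide (- 1ℤ) (λ ()) (λ x y → negate (F x y))
    where
    negate : ∀ a → - 1ℤ * - a ≡ a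
    negate = solve-∀

  -- Both expansions are brought to the common scale `f.scale * g.scale`: each list of products is
  -- multiplied by the scale of the other form.
  hasRank-+ : ∀ {N M} {F G : V → V → ℤ} → HasRank N F → HasRank M G →
              HasRank (N ℕ.+ M) (λ x y → F x y + G x y)
  hasRank-+ {F = F} {G} hf hg = record
    { factors   = List.map (scaled g.scale) f.factors ++ List.map (scaled f.scale) g.factors
    ; size      = ℕ.≤-trans (ℕ.≤-reflexive (trans (List.length-++ (List.map (scaled g.scale) f.factors))
                    (cong₂ ℕ._+_ (List.length-map _ f.factors) (List.length-map _ g.factors))))
                    (ℕ.+-mono-≤ f.size g.size)
    ; scale     = f.scale * g.scale
    ; scale≢0   = λ eq → [ f.scale≢0 , g.scale≢0 ]′ (ℤ.i*j≡0⇒i≡0∨j≡0 f.scale eq)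
    ; expansion = λ x y → begin
        f.scale * g.scale * (F x y + G x y)
          ≡⟨ distribute f.scale g.scale (F x y) (G x y) ⟩
        g.scale * (f.scale * F x y) + f.scale * (g.scale * G x y)
          ≡⟨ cong₂ _+_ (scaling x y g.scale f.factors (f.expansion x y))
               (scaling x y f.scale g.factors (g.expansion x y)) ⟩
        listSum (λ (P , Q) → P x * Q y) (List.map (scaled g.scale) f.factors)
          + listSum (λ (P , Q) → P x * Q y) (List.map (scaled f.scale) g.factors)
          ≡⟨ listSum-++ _ (List.map (scaled g.scale) f.factors) _ ⟨
        listSum (λ (P , Q) → P x * Q y)
          (List.map (scaled g.scale) f.factors ++ List.map (scaled f.scale) g.factors) ∎
    }
    where
    module f = HasRank hf
    module g = HasRank hg
    open ≡-Reasoning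
    scaled : ℤ → (V → ℤ) × (V → ℤ) → (V → ℤ) × (V → ℤ)
    scaled c (P , Q) = (λ x → c * P x) , Q
    distribute : ∀ a b c d → a * b * (c + d) ≡ b * (a * c) + a * (b * d)
    distribute = solve-∀
    scaling : ∀ x y c l {z} → z ≡ listSum (λ (P , Q) → P x * Q y) l →
              c * z ≡ listSum (λ (P , Q) → P x * Q y) (List.map (scaled c) l)
    scaling x y c l {z} eq = begin
      c * z                                             ≡⟨ cong (c *_) eq ⟩
      c * listSum (λ (P , Q) → P x * Q y) l             ≡⟨ listSum-*ˡ c _ l ⟩
      listSum (λ (P , Q) → c * (P x * Q y)) l           ≡⟨ listSum-cong l (λ (P , Q) → ℤ.*-assoc c (P x) (Q y)) ⟨
      listSum (λ (P , Q) → (c * P x) * Q y) l           ≡⟨ listSum-map _ (scaled c) l ⟨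
      listSum (λ (P , Q) → P x * Q y) (List.map (scaled c) l) ∎

  hasRank-flip : ∀ {N} {F : V → V → ℤ} → HasRank N F → HasRank N (λ x y → F y x)
  hasRank-flip hr = record
    { factors = List.map (λ (P , Q) → Q , P) factors
    ; size = ℕ.≤-trans (ℕ.≤-reflexive (List.length-map _ factors)) size
    ; scale = scale ; scale≢0 = scale≢0
    ; expansion = λ x y → trans (expansion y x)
        (trans (listSum-cong factors λ (P , Q) → ℤ.*-comm (P y) (Q x)) (sym (listSum-map _ _ factors))) }
    where open HasRank hr

hasRank-pullback : ∀ {V W : Set} {N} {F : V → V → ℤ} (h : W → V) → HasRank N F →
                   HasRank N (λ x y → F (h x) (h y))
hasRank-pullback h hr = record
  { factors = List.map (λ (P , Q) → P ∘ h , Q ∘ h) factors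
  ; size = ℕ.≤-trans (ℕ.≤-reflexive (List.length-map _ factors)) size
  ; scale = scale ; scale≢0 = scale≢0
  ; expansion = λ x y → trans (expansion (h x) (h y)) (sym (listSum-map _ _ factors)) }
  where open HasRank hr

listSum-filter : ∀ {A : Set} {P : Pred A 0ℓ} (P? : Decidable P) (f : A → ℤ) xs →
                 listSum f (filter P? xs) ≡ listSum (λ x → if does (P? x) then f x else 0ℤ) xs
listSum-filter P? f []       = refl
listSum-filter P? f (x ∷ xs) with does (P? x)
... | true  = cong (f x +_) (listSum-filter P? f xs)
... | false = trans (listSum-filter P? f xs) (sym (ℤ.+-identityˡ _))

module _ {k} (κ : Fin k → Fin k) (κκ : ∀ r → κ (κ r) ≡ r) where

  orbits : List (Fin k)
  orbits = filter (λ r → r Fin.<? κ r) (allFin k)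

  private
    below : (Fin k → ℤ) → Fin k → ℤ
    below f r = if does (r Fin.<? κ r) then f r else 0ℤ

    below-+ : ∀ f g r → below (λ r → f r + g r) r ≡ below f r + below g r
    below-+ f g r with does (r Fin.<? κ r)
    ... | true  = refl
    ... | false = refl

    below-yes : ∀ f {r} → r Fin.< κ r → below f r ≡ f r
    below-yes f {r} r< = cong (λ b → if b then f r else 0ℤ) (dec-true (r Fin.<? κ r) r<)

    below-no : ∀ f {r} → ¬ r Fin.< κ r → below f r ≡ 0ℤ
    below-no f {r} r≮ = cong (λ b → if b then f r else 0ℤ) (dec-false (r Fin.<? κ r) r≮)

    listSum-tabulate : ∀ {n} (f : Fin k → ℤ) (h : Fin n → Fin k) →
                       listSum f (tabulate h) ≡ Σℤ (Finᶠ n) (f ∘ h)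
    listSum-tabulate {n} f h = trans (go n h) (sym (unfold n (f ∘ h)))
      where
      go : ∀ n (h : Fin n → Fin k) → listSum f (tabulate h) ≡ sumᶠ {n} (f ∘ h)
      go zero h    = refl
      go (suc n) h = cong (f (h zero) +_) (go n (h ∘ suc))
      opaque
        unfolding Σℤ
        unfold : ∀ n (f : Fin n → ℤ) → Σℤ (Finᶠ n) f ≡ sumᶠ {n} f
        unfold n f = refl

  -- The value at the larger member of a two-element orbit is moved to the smaller one by the
  -- involution.
  orbit-sum : ∀ {f : Fin k → ℤ} → (∀ r → κ r ≡ r → f r ≡ 0ℤ) →
              Σℤ (Finᶠ k) f ≡ listSum (λ r → f r + f (κ r)) orbits
  orbit-sum {f} f-fixed = begin
    S f                                            ≡⟨ Σ-cong (Finᶠ k) split ⟩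
    S (λ r → below f r + below (f ∘ κ) (κ r))      ≡⟨ Σ-+ (Finᶠ k) _ _ ⟩
    S (below f) + S (below (f ∘ κ) ∘ κ)            ≡⟨ cong (S (below f) +_) (Σ-involution (Finᶠ k) κ κκ _) ⟨
    S (below f) + S (below (f ∘ κ))                ≡⟨ Σ-+ (Finᶠ k) _ _ ⟨
    S (λ r → below f r + below (f ∘ κ) r)          ≡⟨ Σ-cong (Finᶠ k) (below-+ f (f ∘ κ)) ⟨
    S (below (λ r → f r + f (κ r)))                ≡⟨ listSum-tabulate _ id ⟨
    listSum (below (λ r → f r + f (κ r))) (allFin k) ≡⟨ listSum-filter (λ r → r Fin.<? κ r) _ (allFin k) ⟨
    listSum (λ r → f r + f (κ r)) orbits           ∎
    where
    open ≡-Reasoning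
    S = Σℤ (Finᶠ k)
    split : ∀ r → f r ≡ below f r + below (f ∘ κ) (κ r)
    split r with Fin.<-cmp r (κ r)
    ... | tri< r< _ r≯ = sym (trans
      (cong₂ _+_ (below-yes f r<) (below-no (f ∘ κ) (r≯ ∘ subst (κ r Fin.<_) (κκ r)))) (ℤ.+-identityʳ (f r)))
    ... | tri≈ r≮ eq r≯ = trans (f-fixed r (sym eq)) (sym
      (cong₂ _+_ (below-no f r≮) (below-no (f ∘ κ) (r≯ ∘ subst (κ r Fin.<_) (κκ r)))))
    ... | tri> r≮ _ >r = sym (trans
      (cong₂ _+_ (below-no f r≮) (trans (below-yes (f ∘ κ) (subst (κ r Fin.<_) (sym (κκ r)) >r)) (cong f (κκ r))))
      (ℤ.+-identityˡ (f r)))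

  -- An antisymmetric `Φ` vanishes at the fixed points of `κ`, and on a two-element orbit it is one
  -- function up to sign. So words reflected onto themselves cost nothing, and each arch costs one
  -- product.
  hasRank-antisymmetric : ∀ {V : Set} (Φ Q : Fin k → V → ℤ) → (∀ r x → Φ (κ r) x ≡ - Φ r x) →
                          HasRank (length orbits) (λ x y → Σℤ (Finᶠ k) (λ r → Φ r x * Q r y))
  hasRank-antisymmetric Φ Q anti = record
    { factors = List.map (λ r → Φ r , λ y → Q r y - Q (κ r) y) orbits
    ; size = ℕ.≤-reflexive (List.length-map _ orbits)
    ; scale = 1ℤ ; scale≢0 = λ ()
    ; expansion = λ x y → begin
        1ℤ * Σℤ (Finᶠ k) (λ r → Φ r x * Q r y)
          ≡⟨ ℤ.*-identityˡ _ ⟩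
        Σℤ (Finᶠ k) (λ r → Φ r x * Q r y)
          ≡⟨ orbit-sum (λ r κr≡r → cong (_* Q r y) (self-opposite (trans (sym (anti r x)) (cong (λ r → Φ r x) κr≡r)))) ⟩
        listSum (λ r → Φ r x * Q r y + Φ (κ r) x * Q (κ r) y) orbits
          ≡⟨ listSum-cong orbits (λ r → trans (cong (λ z → Φ r x * Q r y + z * Q (κ r) y) (anti r x))
               (factor (Φ r x) (Q r y) (Q (κ r) y))) ⟩
        listSum (λ r → Φ r x * (Q r y - Q (κ r) y)) orbits
          ≡⟨ listSum-map _ _ orbits ⟨
        listSum (λ (P , Q) → P x * Q y) (List.map (λ r → Φ r , λ y → Q r y - Q (κ r) y) orbits) ∎
    }
    where
    open ≡-Reasoning
    factor : ∀ a b c → a * b + (- a) * c ≡ a * (b - c)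
    factor = solve-∀
    self-opposite : ∀ {a} → - a ≡ a → a ≡ 0ℤ
    self-opposite {a} eq = [ (λ ()) , id ]′ (ℤ.i*j≡0⇒i≡0∨j≡0 (ℤ.+ 2) (trans (double a) (trans (cong (_+ a) (sym eq)) (ℤ.+-inverseˡ a))))
      where
      double : ∀ a → ℤ.+ 2 * a ≡ a + a
      double = solve-∀

-- The form of a word

-- The first and last occurrences of the letter A are inj₁ A and inj₂ A.
Occurrence : FiniteSet → Set
Occurrence X = Carrier X ⊎ Carrier X

letterOf : ∀ {X : Set} → X ⊎ X → X
letterOf = [ id , id ]′

-- Only the signs of relative positions are retained from a word. The argument on reversals uses
-- nothing else.
record Diagram : Set₁ where
  field
    letters : FiniteSet
    ε       : Carrier letters → ℤ
    sgn     : Occurrence letters → Occurrence letters → ℤ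

  occurrences : FiniteSet
  occurrences = letters ⊎ᶠ letters

  Vector : Set
  Vector = ℤ × (Carrier letters → ℤ)

  ψ : Occurrence letters → ℤ
  ψ = [ ε , -_ ∘ ε ]′

  m : Vector → Occurrence letters → ℤ
  m (_ , x) o = ψ o * x (letterOf o)

  -- A vector in ℤS with coordinates x s and ε A · x A gives the vector (x s , x); in
  -- these coordinates the short vectors become A and A + B, and E is twice the pairing.
  U : Vector → Occurrence letters → ℤ
  U v o = proj₁ v + Σℤ occurrences (λ p → m v p * sgn o p)

  E : Vector → Vector → ℤ
  E v v′ = Σℤ occurrences (λ o → ψ o * (U v o * U v′ (swap o)))

  ψ-swap : ∀ o → ψ (swap o) ≡ - ψ o
  ψ-swap (inj₁ A) = refl
  ψ-swap (inj₂ A) = sym (ℤ.neg-involutive (ε A))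

  U-cong : ∀ c {x y} → (∀ A → x A ≡ y A) → ∀ o → U (c , x) o ≡ U (c , y) o
  U-cong c x≡y o = cong (c +_) (Σ-cong occurrences λ p → cong (λ z → ψ p * z * sgn o p) (x≡y (letterOf p)))

  E-cong : ∀ c c′ {x y x′ y′} → (∀ A → x A ≡ y A) → (∀ A → x′ A ≡ y′ A) →
           E (c , x) (c′ , x′) ≡ E (c , y) (c′ , y′)
  E-cong c c′ x≡y x′≡y′ = Σ-cong occurrences λ o →
    cong (ψ o *_) (cong₂ _*_ (U-cong c x≡y o) (U-cong c′ x′≡y′ (swap o)))

-- Reversals of diagrams, and the rank of the difference of their forms

SymmetricVector : (X : FiniteSet) → (Carrier X → Carrier X) → Set
SymmetricVector X μ = ℤ × Σ (Carrier X → ℤ) λ x → ∀ A → x (μ A) ≡ x A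

vector : ∀ {A : Set} {P : A → Set} → ℤ × Σ A P → ℤ × A
vector (c , x , _) = c , x

-- D′ arises from D by deleting k intervals, and J reflects the interval t onto the
-- interval κ t.  The relative position of an occurrence outside of the interval t and
-- those in it is sep t.
record Reversal (D D′ : Diagram) : Set where
  private
    module D = Diagram D
    module D′ = Diagram D′
  field
    incl      : Carrier D′.letters → Carrier D.letters
    injective : Injective _≡_ _≡_ incl
    ε-incl    : ∀ A → D.ε (incl A) ≡ D′.ε A

  inc : Occurrence D′.letters → Occurrence D.letters
  inc = Sum.map incl incl

  field
    s-inc     : ∀ o p → D.sgn (inc o) (inc p) ≡ D′.sgn o p
    s-antisym : ∀ o p → D.sgn o p ≡ - D.sgn p o
    k         : ℕ
    κ         : Fin k → Fin k
    κκ        : ∀ t → κ (κ t) ≡ t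
    loc       : Occurrence D.letters → Occurrence D′.letters ⊎ Fin k
    loc-inc   : ∀ o → loc (inc o) ≡ inj₁ o
    inc-loc   : ∀ {o o′} → loc o ≡ inj₁ o′ → inc o′ ≡ o
    ι         : Carrier D.letters → Carrier D.letters
    J         : Occurrence D.letters → Occurrence D.letters
    JJ        : ∀ o → J (J o) ≡ o
    loc-J₁    : ∀ {o o′} → loc o ≡ inj₁ o′ → loc (J o) ≡ inj₁ o′
    loc-J₂    : ∀ {o t} → loc o ≡ inj₂ t → loc (J o) ≡ inj₂ (κ t)
    J-swap    : ∀ {o t} → loc o ≡ inj₂ t → J (swap o) ≡ swap (J o)
    J-ψ       : ∀ {o t} → loc o ≡ inj₂ t → D.ψ (J o) ≡ - D.ψ o
    J-letter  : ∀ {o t} → loc o ≡ inj₂ t → letterOf (J o) ≡ ι (letterOf o)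
    J-s       : ∀ {o p t} → loc o ≡ inj₂ t → loc p ≡ inj₂ t → D.sgn (J o) (J p) ≡ - D.sgn o p
    sep       : Fin k → Occurrence D.letters → ℤ
    s-sep     : ∀ {o p t} → loc o ≡ inj₂ t → loc p ≢ inj₂ t → D.sgn o p ≡ sep t p

  restrict : SymmetricVector D.letters ι → D′.Vector
  restrict (c , x , _) = c , x ∘ incl

  arches : ℕ
  arches = length (orbits κ κκ)

swap-inc : ∀ {X Y : Set} (f : Y → X) o → swap (Sum.map f f o) ≡ Sum.map f f (swap o)
swap-inc f (inj₁ _) = refl
swap-inc f (inj₂ _) = refl

letter-swap : ∀ {X : Set} (o : X ⊎ X) → letterOf (swap o) ≡ letterOf o
letter-swap (inj₁ _) = refl
letter-swap (inj₂ _) = refl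

module _ {D D′} (R : Reversal D D′) where
  open Reversal R
  private
    module D = Diagram D
    module D′ = Diagram D′
    O O′ : Set
    O = Occurrence D.letters
    O′ = Occurrence D′.letters
    Oᶠ O′ᶠ : FiniteSet
    Oᶠ = D.occurrences
    O′ᶠ = D′.occurrences
    K : FiniteSet
    K = Finᶠ k
    V = SymmetricVector D.letters ι

  private
    inc-injective : Injective _≡_ _≡_ inc
    inc-injective {o} {o′} eq = Sum.inj₁-injective (trans (sym (loc-inc o)) (trans (cong loc eq) (loc-inc o′)))

    located : ∀ o → (∃[ o′ ] loc o ≡ inj₁ o′) ⊎ (∃[ t ] loc o ≡ inj₂ t)
    located o with loc o
    ... | inj₁ o′ = inj₁ (o′ , refl)
    ... | inj₂ t  = inj₂ (t , refl)

    loc-swap : ∀ {o t} → loc o ≡ inj₂ t → ∃[ t′ ] loc (swap o) ≡ inj₂ t′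
    loc-swap {o} eq with located (swap o)
    ... | inj₂ found = found
    ... | inj₁ (o′ , eq′) = contradiction
      (trans (sym eq) (trans (cong loc (trans (sym (Sum.swap-involutive o))
        (trans (cong swap (sym (inc-loc eq′))) (swap-inc incl o′)))) (loc-inc (swap o′))))
      λ ()

    δ : Fin k → Fin k → ℤ
    δ r = onlyAt K r (const 1ℤ)

    δ-self : ∀ t → δ t t ≡ 1ℤ
    δ-self t = onlyAt-self K t (const 1ℤ)

    δ-other : ∀ {r t} → r ≢ t → δ r t ≡ 0ℤ
    δ-other r≢t = onlyAt-other K (const 1ℤ) (r≢t ∘ sym)

    δ-κ : ∀ r t → δ (κ r) (κ t) ≡ δ r t
    δ-κ r t with r Fin.≟ t
    ... | yes refl = trans (δ-self (κ r)) (sym (δ-self r))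
    ... | no r≢t = trans (δ-other λ eq → r≢t (trans (sym (κκ r)) (trans (cong κ eq) (κκ t)))) (sym (δ-other r≢t))

    δ-sum : ∀ (f : Fin k → ℤ) t → Σℤ K (λ r → f r * δ r t) ≡ f t
    δ-sum f t = trans (Σ-single K t λ r r≢t → trans (cong (f r *_) (δ-other r≢t)) (ℤ.*-zeroʳ (f r)))
                      (trans (cong (f t *_) (δ-self t)) (ℤ.*-identityʳ (f t)))

    -- The indicator function of the interval `r`.
    χ : Fin k → O → ℤ
    χ r o = [ const 0ℤ , δ r ]′ (loc o)

    χ-1 : ∀ {o o′} → loc o ≡ inj₁ o′ → ∀ r → χ r o ≡ 0ℤ
    χ-1 eq r = cong [ const 0ℤ , δ r ]′ eq

    χ-2 : ∀ {o t} → loc o ≡ inj₂ t → ∀ r → χ r o ≡ δ r t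
    χ-2 eq r = cong [ const 0ℤ , δ r ]′ eq

    χ-J : ∀ r o → χ (κ r) (J o) ≡ χ r o
    χ-J r o with located o
    ... | inj₁ (o′ , eq) = trans (χ-1 (loc-J₁ eq) (κ r)) (sym (χ-1 eq r))
    ... | inj₂ (t , eq) = trans (χ-2 (loc-J₂ eq) (κ r)) (trans (δ-κ r t) (sym (χ-2 eq r)))

    χ-support : ∀ r {f g : O → ℤ} → (∀ o → loc o ≡ inj₂ r → f o ≡ g o) → ∀ o → χ r o * f o ≡ χ r o * g o
    χ-support r {f} {g} h o with located o
    ... | inj₁ (o′ , eq) = trans (cong (_* f o) (χ-1 eq r)) (sym (cong (_* g o) (χ-1 eq r)))
    ... | inj₂ (t , eq) = trans (cong (_* f o) (χ-2 eq r))
                            (trans (on eq) (sym (cong (_* g o) (χ-2 eq r))))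
      where
      on : loc o ≡ inj₂ t → δ r t * f o ≡ δ r t * g o
      on eq with r Fin.≟ t
      ... | yes refl = cong (δ r r *_) (h o eq)
      ... | no r≢t = trans (cong (_* f o) (δ-other r≢t)) (sym (cong (_* g o) (δ-other r≢t)))

    split : ∀ f → Σℤ Oᶠ f ≡ Σℤ O′ᶠ (f ∘ inc) + Σℤ K (λ r → Σℤ Oᶠ (λ o → χ r o * f o))
    split f = begin
      Σℤ Oᶠ f                                                            ≡⟨ Σ-cong Oᶠ pointwise ⟩
      Σℤ Oᶠ (λ o → kept o + Σℤ K (λ r → χ r o * f o))                    ≡⟨ Σ-+ Oᶠ _ _ ⟩
      Σℤ Oᶠ kept + Σℤ Oᶠ (λ o → Σℤ K (λ r → χ r o * f o))                ≡⟨ cong₂ _+_ kept-sum (Σ-swap Oᶠ K _) ⟩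
      Σℤ O′ᶠ (f ∘ inc) + Σℤ K (λ r → Σℤ Oᶠ (λ o → χ r o * f o))          ∎
      where
      open ≡-Reasoning
      kept : O → ℤ
      kept o = [ const (f o) , const 0ℤ ]′ (loc o)
      kept-sum : Σℤ Oᶠ kept ≡ Σℤ O′ᶠ (f ∘ inc)
      kept-sum = trans (Σ-image Oᶠ O′ᶠ inc-injective supp)
        (Σ-cong O′ᶠ λ o → cong [ const (f (inc o)) , const 0ℤ ]′ (loc-inc o))
        where
        supp : ∀ o → kept o ≡ 0ℤ ⊎ ∃[ o′ ] inc o′ ≡ o
        supp o with located o
        ... | inj₁ (o′ , eq) = inj₂ (o′ , inc-loc eq)
        ... | inj₂ (t , eq) = inj₁ (cong [ const (f o) , const 0ℤ ]′ eq)
      pointwise : ∀ o → f o ≡ kept o + Σℤ K (λ r → χ r o * f o)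
      pointwise o with located o
      ... | inj₁ (o′ , eq) = sym (trans (cong₂ _+_ (cong [ const (f o) , const 0ℤ ]′ eq)
              (Σ-zero K λ r → cong (_* f o) (χ-1 eq r))) (ℤ.+-identityʳ (f o)))
      ... | inj₂ (t , eq) = sym (trans (cong₂ _+_ (cong [ const (f o) , const 0ℤ ]′ eq)
              (trans (Σ-cong K λ r → trans (cong (_* f o) (χ-2 eq r)) (ℤ.*-comm (δ r t) (f o))) (δ-sum (λ _ → f o) t)))
              (ℤ.+-identityˡ (f o)))

    -- The total weight of the interval `r`. The kept occurrences see nothing else of it, because
    -- all of it lies on the same side of them. As `J` reverses the weights of an invariant vector,
    -- `M` is antisymmetric under `κ`.
    M : Fin k → V → ℤ
    M r v = Σℤ Oᶠ (λ o → χ r o * D.m (vector v) o)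

    m-J : ∀ (v : V) {o t} → loc o ≡ inj₂ t → D.m (vector v) (J o) ≡ - D.m (vector v) o
    m-J v@(_ , x , sym-x) {o} eq = trans
      (cong₂ _*_ (J-ψ eq) (trans (cong x (J-letter eq)) (sym-x (letterOf o))))
      (sym (ℤ.neg-distribˡ-* (D.ψ o) (x (letterOf o))))

    M-κ : ∀ r v → M (κ r) v ≡ - M r v
    M-κ r v = begin
      Σℤ Oᶠ (λ o → χ (κ r) o * D.m (vector v) o)          ≡⟨ Σ-involution Oᶠ J JJ _ ⟩
      Σℤ Oᶠ (λ o → χ (κ r) (J o) * D.m (vector v) (J o))  ≡⟨ (Σ-cong Oᶠ λ o → cong (_* D.m (vector v) (J o)) (χ-J r o)) ⟩
      Σℤ Oᶠ (λ o → χ r o * D.m (vector v) (J o))          ≡⟨ Σ-cong Oᶠ (χ-support r λ o eq → m-J v eq) ⟩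
      Σℤ Oᶠ (λ o → χ r o * - D.m (vector v) o)            ≡⟨ (Σ-cong Oᶠ λ o → sym (ℤ.neg-distribʳ-* (χ r o) (D.m (vector v) o))) ⟩
      Σℤ Oᶠ (λ o → - (χ r o * D.m (vector v) o))          ≡⟨ Σ-neg Oᶠ _ ⟨
      - M r v                                             ∎
      where open ≡-Reasoning

    U-inc : ∀ v o → D.U (vector v) (inc o) ≡ D′.U (restrict v) o + Σℤ K (λ r → M r v * - sep r (inc o))
    U-inc v@(c , x , _) o = begin
      c + Σℤ Oᶠ (λ p → D.m (c , x) p * D.sgn (inc o) p)
        ≡⟨ cong (c +_) (split _) ⟩
      c + (Σℤ O′ᶠ (λ p → D.m (c , x) (inc p) * D.sgn (inc o) (inc p)) + Σℤ K (λ r → Σℤ Oᶠ (λ p → χ r p * (D.m (c , x) p * D.sgn (inc o) p))))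
        ≡⟨ cong (c +_) (cong₂ _+_ (Σ-cong O′ᶠ λ p → cong₂ _*_ (m-inc p) (s-inc o p)) (Σ-cong K row)) ⟩
      c + (Σℤ O′ᶠ (λ p → D′.m (c , x ∘ incl) p * D′.sgn o p) + Σℤ K (λ r → M r v * - sep r (inc o)))
        ≡⟨ ℤ.+-assoc c _ _ ⟨
      D′.U (restrict v) o + Σℤ K (λ r → M r v * - sep r (inc o)) ∎
      where
      open ≡-Reasoning
      m-inc : ∀ p → D.m (c , x) (inc p) ≡ D′.m (c , x ∘ incl) p
      m-inc (inj₁ A) = cong (_* x (incl A)) (ε-incl A)
      m-inc (inj₂ A) = cong (λ z → - z * x (incl A)) (ε-incl A)
      row : ∀ r → Σℤ Oᶠ (λ p → χ r p * (D.m (c , x) p * D.sgn (inc o) p)) ≡ M r v * - sep r (inc o)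
      row r = begin
        Σℤ Oᶠ (λ p → χ r p * (D.m (c , x) p * D.sgn (inc o) p))
          ≡⟨ Σ-cong Oᶠ (χ-support r λ p eq → cong (λ z → D.m (c , x) p * z)
               (trans (s-antisym (inc o) p) (cong -_ (s-sep eq λ eq′ → contradiction (trans (sym eq′) (loc-inc o)) λ ())))) ⟩
        Σℤ Oᶠ (λ p → χ r p * (D.m (c , x) p * - sep r (inc o)))
          ≡⟨ (Σ-cong Oᶠ λ p → sym (ℤ.*-assoc (χ r p) (D.m (c , x) p) _)) ⟩
        Σℤ Oᶠ (λ p → χ r p * D.m (c , x) p * - sep r (inc o))
          ≡⟨ Σ-*ʳ Oᶠ _ _ ⟨
        M r v * - sep r (inc o) ∎

    -- On the interval t the function U is F t + L t, where F t collects the contributions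
    -- from outside of the interval, and L is invariant under J.
    F : Fin k → V → ℤ
    F t v = proj₁ v + Σℤ Oᶠ (λ p → (1ℤ - χ t p) * (D.m (vector v) p * sep t p))

    -- The change of `U` under `J` on the interval `t`, since `L` does not change.
    G : Fin k → V → ℤ
    G t v = F t v - F (κ t) v

    G-κ : ∀ t v → G (κ t) v ≡ - G t v
    G-κ t v = trans (cong (λ r → F (κ t) v - F r v) (κκ t)) (flip (F (κ t) v) (F t v))
      where
      flip : ∀ a b → a - b ≡ - (b - a)
      flip = solve-∀

    L : Fin k → V → O → ℤ
    L t v o = Σℤ Oᶠ (λ p → χ t p * (D.m (vector v) p * D.sgn o p))

    U-seg : ∀ v {o t} → loc o ≡ inj₂ t → D.U (vector v) o ≡ F t v + L t v o
    U-seg v@(c , x , _) {o} {t} eq = begin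
      c + Σℤ Oᶠ (λ p → D.m (c , x) p * D.sgn o p)
        ≡⟨ cong (c +_) (Σ-cong Oᶠ pointwise) ⟩
      c + Σℤ Oᶠ (λ p → (1ℤ - χ t p) * (D.m (c , x) p * sep t p) + χ t p * (D.m (c , x) p * D.sgn o p))
        ≡⟨ cong (c +_) (Σ-+ Oᶠ _ _) ⟩
      c + (Σℤ Oᶠ (λ p → (1ℤ - χ t p) * (D.m (c , x) p * sep t p)) + L t v o)
        ≡⟨ ℤ.+-assoc c _ _ ⟨
      F t v + L t v o ∎
      where
      open ≡-Reasoning
      inside : ∀ a b → a ≡ (1ℤ - 1ℤ) * b + 1ℤ * a
      inside = solve-∀
      outside : ∀ a b → a ≡ (1ℤ - 0ℤ) * a + 0ℤ * b
      outside = solve-∀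
      s-out : ∀ p → loc p ≢ inj₂ t → D.m (c , x) p * D.sgn o p ≡ D.m (c , x) p * sep t p
      s-out p ≢t = cong (λ z → D.m (c , x) p * z) (s-sep eq ≢t)
      out : ∀ p → loc p ≢ inj₂ t → χ t p ≡ 0ℤ →
            D.m (c , x) p * D.sgn o p ≡ (1ℤ - χ t p) * (D.m (c , x) p * sep t p) + χ t p * (D.m (c , x) p * D.sgn o p)
      out p ≢t χ≡0 = trans (s-out p ≢t) (trans (outside (D.m (c , x) p * sep t p) (D.m (c , x) p * D.sgn o p))
        (sym (cong (λ z → (1ℤ - z) * (D.m (c , x) p * sep t p) + z * (D.m (c , x) p * D.sgn o p)) χ≡0)))
      pointwise : ∀ p → D.m (c , x) p * D.sgn o p ≡ (1ℤ - χ t p) * (D.m (c , x) p * sep t p) + χ t p * (D.m (c , x) p * D.sgn o p)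
      pointwise p with located p
      ... | inj₁ (p′ , eqp) = out p (λ eq′ → contradiction (trans (sym eqp) eq′) λ ()) (χ-1 eqp t)
      ... | inj₂ (r , eqp) with t Fin.≟ r
      ...   | no t≢r = out p (λ eq′ → t≢r (Sum.inj₂-injective (trans (sym eq′) eqp)))
                (trans (χ-2 eqp t) (δ-other t≢r))
      ...   | yes refl = trans (inside (D.m (c , x) p * D.sgn o p) (D.m (c , x) p * sep t p))
                (sym (cong (λ z → (1ℤ - z) * (D.m (c , x) p * sep t p) + z * (D.m (c , x) p * D.sgn o p))
                  (trans (χ-2 eqp t) (δ-self t))))

    -- Within an interval, `J` reverses both the weights and the relative order, and the two signs
    -- cancel.
    L-J : ∀ v {o t} → loc o ≡ inj₂ t → L (κ t) v (J o) ≡ L t v o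
    L-J v {o} {t} eq = begin
      Σℤ Oᶠ (λ p → χ (κ t) p * (D.m (vector v) p * D.sgn (J o) p))
        ≡⟨ Σ-involution Oᶠ J JJ _ ⟩
      Σℤ Oᶠ (λ p → χ (κ t) (J p) * (D.m (vector v) (J p) * D.sgn (J o) (J p)))
        ≡⟨ (Σ-cong Oᶠ λ p → cong (_* (D.m (vector v) (J p) * D.sgn (J o) (J p))) (χ-J t p)) ⟩
      Σℤ Oᶠ (λ p → χ t p * (D.m (vector v) (J p) * D.sgn (J o) (J p)))
        ≡⟨ Σ-cong Oᶠ (χ-support t λ p eqp → trans (cong₂ _*_ (m-J v eqp) (J-s eq eqp))
             (signs (D.m (vector v) p) (D.sgn o p))) ⟩
      Σℤ Oᶠ (λ p → χ t p * (D.m (vector v) p * D.sgn o p)) ∎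
      where
      open ≡-Reasoning
      signs : ∀ a b → (- a) * (- b) ≡ a * b
      signs = solve-∀

    -- The difference of the two forms is a single form on the disjoint union of the
    -- occurrences, where Ĵ exchanges the two copies of the occurrences that are kept.
    Ô : FiniteSet
    Ô = Oᶠ ⊎ᶠ O′ᶠ

    ψ̂ : O ⊎ O′ → ℤ
    ψ̂ = [ D.ψ , -_ ∘ D′.ψ ]′

    Û : V → O ⊎ O′ → ℤ
    Û v = [ D.U (vector v) , D′.U (restrict v) ]′

    bar : O ⊎ O′ → O ⊎ O′
    bar = Sum.map swap swap

    Ĵ : O ⊎ O′ → O ⊎ O′
    Ĵ (inj₁ o)  = [ inj₂ , const (inj₁ (J o)) ]′ (loc o)
    Ĵ (inj₂ o′) = inj₁ (inc o′)

    Ĵ-1 : ∀ {o o′} → loc o ≡ inj₁ o′ → Ĵ (inj₁ o) ≡ inj₂ o′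
    Ĵ-1 {o} eq = cong [ inj₂ , const (inj₁ (J o)) ]′ eq

    Ĵ-2 : ∀ {o t} → loc o ≡ inj₂ t → Ĵ (inj₁ o) ≡ inj₁ (J o)
    Ĵ-2 {o} eq = cong [ inj₂ , const (inj₁ (J o)) ]′ eq

    ĴĴ : ∀ p → Ĵ (Ĵ p) ≡ p
    ĴĴ (inj₂ o′) = Ĵ-1 (loc-inc o′)
    ĴĴ (inj₁ o) with located o
    ... | inj₁ (o′ , eq) = trans (cong Ĵ (Ĵ-1 eq)) (cong inj₁ (inc-loc eq))
    ... | inj₂ (t , eq)  = trans (cong Ĵ (Ĵ-2 eq)) (trans (Ĵ-2 (loc-J₂ eq)) (cong inj₁ (JJ o)))

    ψ-inc : ∀ o′ → D.ψ (inc o′) ≡ D′.ψ o′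
    ψ-inc (inj₁ A) = ε-incl A
    ψ-inc (inj₂ A) = cong -_ (ε-incl A)

    -- On the kept occurrences the sign comes from the negative weight of the copy in `D′`, on the
    -- intervals from `J-ψ`.
    ψ̂-Ĵ : ∀ p → ψ̂ (Ĵ p) ≡ - ψ̂ p
    ψ̂-Ĵ (inj₂ o′) = trans (ψ-inc o′) (sym (ℤ.neg-involutive (D′.ψ o′)))
    ψ̂-Ĵ (inj₁ o) with located o
    ... | inj₁ (o′ , eq) = trans (cong ψ̂ (Ĵ-1 eq)) (cong -_ (trans (sym (ψ-inc o′)) (cong D.ψ (inc-loc eq))))
    ... | inj₂ (t , eq)  = trans (cong ψ̂ (Ĵ-2 eq)) (J-ψ eq)

    Ĵ-bar : ∀ p → Ĵ (bar p) ≡ bar (Ĵ p)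
    Ĵ-bar (inj₂ o′) = cong inj₁ (sym (swap-inc incl o′))
    Ĵ-bar (inj₁ o) with located o
    ... | inj₁ (o′ , eq) = trans (Ĵ-1 (trans (cong loc (trans (cong swap (sym (inc-loc eq))) (swap-inc incl o′))) (loc-inc (swap o′))))
                                 (cong bar (sym (Ĵ-1 eq)))
    ... | inj₂ (t , eq)  = trans (Ĵ-2 (proj₂ (loc-swap eq))) (trans (cong inj₁ (J-swap eq)) (cong bar (sym (Ĵ-2 eq))))

    -- The fixed functions by which `Û` fails to be invariant, with the coefficients `M`; the
    -- functions `g′` go with the coefficients `G`. The former live on the two copies of the kept
    -- occurrences, with opposite signs as `Ĵ` exchanges the copies, and the latter on the
    -- intervals.
    c : Fin k → O ⊎ O′ → ℤ
    c r (inj₁ o)  = [ const (- sep r o) , const 0ℤ ]′ (loc o)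
    c r (inj₂ o′) = sep r (inc o′)

    g′ : Fin k → O ⊎ O′ → ℤ
    g′ r (inj₁ o)  = χ r o
    g′ r (inj₂ o′) = 0ℤ

    Δ : V → O ⊎ O′ → ℤ
    Δ v p = Σℤ K (λ r → M r v * c r p) + Σℤ K (λ r → G r v * g′ r p)

    -- At a kept occurrence the two values of `U` differ by the contributions of the deleted
    -- intervals, which `U-inc` expresses by `M`. On an interval they differ by `G`.
    Û-Ĵ : ∀ v p → Û v p - Û v (Ĵ p) ≡ Δ v p
    Û-Ĵ v (inj₂ o′) = begin
      D′.U (restrict v) o′ - D.U (vector v) (inc o′)
        ≡⟨ cong (λ z → D′.U (restrict v) o′ - z) (U-inc v o′) ⟩
      D′.U (restrict v) o′ - (D′.U (restrict v) o′ + Σℤ K (λ r → M r v * - sep r (inc o′)))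
        ≡⟨ cancel (D′.U (restrict v) o′) _ ⟩
      - Σℤ K (λ r → M r v * - sep r (inc o′))
        ≡⟨ trans (Σ-neg K _) (Σ-cong K λ r → negate (M r v) (sep r (inc o′))) ⟩
      Σℤ K (λ r → M r v * sep r (inc o′))
        ≡⟨ ℤ.+-identityʳ _ ⟨
      Σℤ K (λ r → M r v * sep r (inc o′)) + 0ℤ
        ≡⟨ cong (λ z → Σℤ K (λ r → M r v * sep r (inc o′)) + z) (Σ-zero K λ r → ℤ.*-zeroʳ (G r v)) ⟨
      Δ v (inj₂ o′) ∎
      where
      open ≡-Reasoning
      cancel : ∀ a b → a - (a + b) ≡ - b
      cancel = solve-∀
      negate : ∀ a b → - (a * - b) ≡ a * b
      negate = solve-∀
    Û-Ĵ v (inj₁ o) with located o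
    ... | inj₁ (o′ , eq) = begin
      D.U (vector v) o - Û v (Ĵ (inj₁ o))
        ≡⟨ cong₂ _-_ (trans (cong (D.U (vector v)) (sym (inc-loc eq))) (U-inc v o′)) (cong (Û v) (Ĵ-1 eq)) ⟩
      D′.U (restrict v) o′ + Σℤ K (λ r → M r v * - sep r (inc o′)) - D′.U (restrict v) o′
        ≡⟨ cancel (D′.U (restrict v) o′) _ ⟩
      Σℤ K (λ r → M r v * - sep r (inc o′)) + 0ℤ
        ≡⟨ cong₂ _+_ (Σ-cong K λ r → cong (M r v *_)
              (trans (cong (λ o → - sep r o) (inc-loc eq)) (sym (cong [ const (- sep r o) , const 0ℤ ]′ eq))))
            (sym (Σ-zero K λ r → trans (cong (G r v *_) (χ-1 eq r)) (ℤ.*-zeroʳ (G r v)))) ⟩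
      Δ v (inj₁ o) ∎
      where
      open ≡-Reasoning
      cancel : ∀ a b → a + b - a ≡ b + 0ℤ
      cancel = solve-∀
    ... | inj₂ (t , eq) = begin
      D.U (vector v) o - Û v (Ĵ (inj₁ o))
        ≡⟨ cong₂ _-_ (U-seg v eq) (trans (cong (Û v) (Ĵ-2 eq)) (U-seg v (loc-J₂ eq))) ⟩
      F t v + L t v o - (F (κ t) v + L (κ t) v (J o))
        ≡⟨ cong (λ z → F t v + L t v o - (F (κ t) v + z)) (L-J v eq) ⟩
      F t v + L t v o - (F (κ t) v + L t v o)
        ≡⟨ cancel (F t v) (F (κ t) v) (L t v o) ⟩
      0ℤ + G t v
        ≡⟨ cong₂ _+_ (sym (Σ-zero K λ r → trans (cong (M r v *_)
             (cong [ const (- sep r o) , const 0ℤ ]′ eq)) (ℤ.*-zeroʳ (M r v))))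
             (sym (trans (Σ-cong K λ r → cong (G r v *_) (χ-2 eq r)) (δ-sum (λ r → G r v) t))) ⟩
      Δ v (inj₁ o) ∎
      where
      open ≡-Reasoning
      cancel : ∀ a b l → a + l - (b + l) ≡ 0ℤ + (a - b)
      cancel = solve-∀

    difference-sum : ∀ v v′ → D.E (vector v) (vector v′) - D′.E (restrict v) (restrict v′) ≡
                       Σℤ Ô (λ p → ψ̂ p * (Û v p * Û v′ (bar p)))
    difference-sum v v′ = sym (trans (Σ-⊎ Oᶠ O′ᶠ _) (cong (D.E (vector v) (vector v′) +_)
      (trans (Σ-cong O′ᶠ λ o → sym (ℤ.neg-distribˡ-* (D′.ψ o) _)) (sym (Σ-neg O′ᶠ _)))))

    -- The sum is added to its image under `Ĵ`, whence the factor 2. As `ψ̂` changes sign, only the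
    -- deviations of `Û` in the first or in the second argument survive, by `a * b - a′ * b′ ≡ (a -
    -- a′) * b + (b - b′) * a′`.
    doubled : ∀ v v′ → ℤ.+ 2 * (D.E (vector v) (vector v′) - D′.E (restrict v) (restrict v′)) ≡
                Σℤ Ô (λ p → Δ v p * (ψ̂ p * Û v′ (bar p))) + Σℤ Ô (λ p → Δ v′ p * (- ψ̂ p * Û v (Ĵ (bar p))))
    doubled v v′ = begin
      ℤ.+ 2 * (D.E (vector v) (vector v′) - D′.E (restrict v) (restrict v′))
        ≡⟨ trans (cong (ℤ.+ 2 *_) (difference-sum v v′)) (double (Σℤ Ô A)) ⟩
      Σℤ Ô A + Σℤ Ô A
        ≡⟨ cong (Σℤ Ô A +_) (Σ-involution Ô Ĵ ĴĴ A) ⟩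
      Σℤ Ô A + Σℤ Ô (A ∘ Ĵ)
        ≡⟨ Σ-+ Ô _ _ ⟨
      Σℤ Ô (λ p → A p + A (Ĵ p))
        ≡⟨ Σ-cong Ô pointwise ⟩
      Σℤ Ô (λ p → Δ v p * (ψ̂ p * Û v′ (bar p)) + Δ v′ (bar p) * (ψ̂ p * Û v (Ĵ p)))
        ≡⟨ Σ-+ Ô _ _ ⟩
      Σℤ Ô (λ p → Δ v p * (ψ̂ p * Û v′ (bar p))) + Σℤ Ô (λ p → Δ v′ (bar p) * (ψ̂ p * Û v (Ĵ p)))
        ≡⟨ cong (λ z → Σℤ Ô (λ p → Δ v p * (ψ̂ p * Û v′ (bar p))) + z)
             -- The substitution of `bar p` for `p` puts `Δ v′` at `p`, so that both sums have the
             -- shape required by `Δ-rank`; `ψ̂` changes sign under `bar`.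
             (trans (Σ-involution Ô bar bar-bar _) (Σ-cong Ô λ p →
               cong₂ _*_ (cong (Δ v′) (bar-bar p)) (cong (_* Û v (Ĵ (bar p))) (ψ̂-bar p)))) ⟩
      Σℤ Ô (λ p → Δ v p * (ψ̂ p * Û v′ (bar p))) + Σℤ Ô (λ p → Δ v′ p * (- ψ̂ p * Û v (Ĵ (bar p)))) ∎
      where
      open ≡-Reasoning
      A : O ⊎ O′ → ℤ
      A p = ψ̂ p * (Û v p * Û v′ (bar p))
      double : ∀ a → ℤ.+ 2 * a ≡ a + a
      double = solve-∀
      bar-bar : ∀ p → bar (bar p) ≡ p
      bar-bar (inj₁ o) = cong inj₁ (Sum.swap-involutive o)
      bar-bar (inj₂ o) = cong inj₂ (Sum.swap-involutive o)
      ψ̂-bar : ∀ p → ψ̂ (bar p) ≡ - ψ̂ p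
      ψ̂-bar (inj₁ o) = D.ψ-swap o
      ψ̂-bar (inj₂ o) = cong -_ (D′.ψ-swap o)
      expand : ∀ e a a′ b b′ → e * (a * b) + - e * (a′ * b′) ≡ (a - a′) * (e * b) + (b - b′) * (e * a′)
      expand = solve-∀
      pointwise : ∀ p → A p + A (Ĵ p) ≡ Δ v p * (ψ̂ p * Û v′ (bar p)) + Δ v′ (bar p) * (ψ̂ p * Û v (Ĵ p))
      pointwise p = begin
        ψ̂ p * (Û v p * Û v′ (bar p)) + ψ̂ (Ĵ p) * (Û v (Ĵ p) * Û v′ (bar (Ĵ p)))
          ≡⟨ cong (ψ̂ p * (Û v p * Û v′ (bar p)) +_)
               (cong₂ _*_ (ψ̂-Ĵ p) (cong (λ q → Û v (Ĵ p) * Û v′ q) (sym (Ĵ-bar p)))) ⟩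
        ψ̂ p * (Û v p * Û v′ (bar p)) + - ψ̂ p * (Û v (Ĵ p) * Û v′ (Ĵ (bar p)))
          ≡⟨ expand (ψ̂ p) (Û v p) (Û v (Ĵ p)) (Û v′ (bar p)) (Û v′ (Ĵ (bar p))) ⟩
        (Û v p - Û v (Ĵ p)) * (ψ̂ p * Û v′ (bar p)) + (Û v′ (bar p) - Û v′ (Ĵ (bar p))) * (ψ̂ p * Û v (Ĵ p))
          ≡⟨ cong₂ (λ a b → a * (ψ̂ p * Û v′ (bar p)) + b * (ψ̂ p * Û v (Ĵ p))) (Û-Ĵ v p) (Û-Ĵ v′ (bar p)) ⟩
        Δ v p * (ψ̂ p * Û v′ (bar p)) + Δ v′ (bar p) * (ψ̂ p * Û v (Ĵ p)) ∎

    -- The coefficients `M` and `G` of `Δ` are both antisymmetric under `κ`; each family contributes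
    -- one product per arch, whatever `W` is.
    Δ-rank : (W : O ⊎ O′ → V → ℤ) → HasRank (arches ℕ.+ arches) (λ v v′ → Σℤ Ô (λ p → Δ v p * W p v′))
    Δ-rank W = hasRank-resp expand (hasRank-+
      (hasRank-antisymmetric κ κκ M (λ r v′ → Σℤ Ô (λ p → c r p * W p v′)) M-κ)
      (hasRank-antisymmetric κ κκ G (λ r v′ → Σℤ Ô (λ p → g′ r p * W p v′)) G-κ))
      where
      open ≡-Reasoning
      part : ∀ (Φ : Fin k → V → ℤ) (h : Fin k → O ⊎ O′ → ℤ) v v′ →
             Σℤ Ô (λ p → Σℤ K (λ r → Φ r v * h r p) * W p v′) ≡ Σℤ K (λ r → Φ r v * Σℤ Ô (λ p → h r p * W p v′))
      part Φ h v v′ = begin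
        Σℤ Ô (λ p → Σℤ K (λ r → Φ r v * h r p) * W p v′)
          ≡⟨ (Σ-cong Ô λ p → trans (Σ-*ʳ K (W p v′) _) (Σ-cong K λ r → ℤ.*-assoc (Φ r v) (h r p) (W p v′))) ⟩
        Σℤ Ô (λ p → Σℤ K (λ r → Φ r v * (h r p * W p v′)))
          ≡⟨ Σ-swap Ô K _ ⟩
        Σℤ K (λ r → Σℤ Ô (λ p → Φ r v * (h r p * W p v′)))
          ≡⟨ (Σ-cong K λ r → sym (Σ-*ˡ Ô (Φ r v) _)) ⟩
        Σℤ K (λ r → Φ r v * Σℤ Ô (λ p → h r p * W p v′)) ∎
      expand : ∀ v v′ → Σℤ Ô (λ p → Δ v p * W p v′) ≡
               Σℤ K (λ r → M r v * Σℤ Ô (λ p → c r p * W p v′)) + Σℤ K (λ r → G r v * Σℤ Ô (λ p → g′ r p * W p v′))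
      expand v v′ = begin
        Σℤ Ô (λ p → Δ v p * W p v′)
          ≡⟨ (Σ-cong Ô λ p → ℤ.*-distribʳ-+ (W p v′) (Σℤ K (λ r → M r v * c r p)) _) ⟩
        Σℤ Ô (λ p → Σℤ K (λ r → M r v * c r p) * W p v′ + Σℤ K (λ r → G r v * g′ r p) * W p v′)
          ≡⟨ Σ-+ Ô _ _ ⟩
        Σℤ Ô (λ p → Σℤ K (λ r → M r v * c r p) * W p v′) + Σℤ Ô (λ p → Σℤ K (λ r → G r v * g′ r p) * W p v′)
          ≡⟨ cong₂ _+_ (part M c v v′) (part G g′ v v′) ⟩
        Σℤ K (λ r → M r v * Σℤ Ô (λ p → c r p * W p v′)) + Σℤ K (λ r → G r v * Σℤ Ô (λ p → g′ r p * W p v′)) ∎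

  -- The first summand of `doubled` has the deviation in the first argument, the second one, after a
  -- flip, likewise. Each has rank at most twice the number of arches.
  reversal-rank : HasRank (4 ℕ.* arches)
                    (λ v v′ → D.E (vector v) (vector v′) - D′.E (restrict v) (restrict v′))
  reversal-rank = hasRank-≤ (ℕ.≤-reflexive (four arches))
    (hasRank-divide (ℤ.+ 2) (λ ()) doubled
      (hasRank-+ (Δ-rank λ p v → ψ̂ p * Û v (bar p))
                 (hasRank-flip (Δ-rank λ p v → - ψ̂ p * Û v (Ĵ (bar p))))))
    where
    four : ∀ a → a ℕ.+ a ℕ.+ (a ℕ.+ a) ≡ 4 ℕ.* a
    four a = trans (ℕ.+-assoc a a (a ℕ.+ a)) (cong (λ z → a ℕ.+ (a ℕ.+ (a ℕ.+ z))) (sym (ℕ.+-identityʳ a)))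

-- Positions of letters

order : ℕ → ℕ → ℤ
order m n = if m <ᵇ n then -1ℤ else if n <ᵇ m then 1ℤ else 0ℤ

order-refl : ∀ n → order n n ≡ 0ℤ
order-refl zero    = refl
order-refl (suc n) = order-refl n

order-antisym : ∀ m n → order m n ≡ - order n m
order-antisym zero    zero    = refl
order-antisym zero    (suc n) = refl
order-antisym (suc m) zero    = refl
order-antisym (suc m) (suc n) = order-antisym m n

order-+ : ∀ k m n → order (k ℕ.+ m) (k ℕ.+ n) ≡ order m n
order-+ zero    m n = refl
order-+ (suc k) m n = order-+ k m n

<⇒<ᵇ : ∀ {m n} → m < n → (m <ᵇ n) ≡ true
<⇒<ᵇ {zero}  (s≤s _) = refl
<⇒<ᵇ {suc m} {suc n} (s≤s m<n) = <⇒<ᵇ m<n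

≤⇒≯ᵇ : ∀ {m n} → m ≤ n → (n <ᵇ m) ≡ false
≤⇒≯ᵇ {n = zero} z≤n = refl
≤⇒≯ᵇ {n = suc n} z≤n = refl
≤⇒≯ᵇ (s≤s m≤n) = ≤⇒≯ᵇ m≤n

<⇒≯ᵇ : ∀ {m n} → m < n → (n <ᵇ m) ≡ false
<⇒≯ᵇ m<n = ≤⇒≯ᵇ (ℕ.<⇒≤ m<n)

order-< : ∀ {m n} → m < n → order m n ≡ -1ℤ
order-< m<n rewrite <⇒<ᵇ m<n = refl

order-> : ∀ {m n} → n < m → order m n ≡ 1ℤ
order-> {m} {n} n<m = trans (order-antisym m n) (cong -_ (order-< n<m))

order-monotone : ∀ (f : ℕ → ℕ) → (∀ {m n} → m < n → f m < f n) → ∀ m n → order (f m) (f n) ≡ order m n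
order-monotone f mono m n with ℕ.<-cmp m n
... | tri< m<n _ _ = trans (order-< (mono m<n)) (sym (order-< m<n))
... | tri≈ _ refl _ = trans (order-refl (f m)) (sym (order-refl m))
... | tri> _ _ n<m = trans (order-> (mono n<m)) (sym (order-> n<m))

order-reverse : ∀ {n i j} → i < n → j < n → order (n ∸ suc i) (n ∸ suc j) ≡ - order i j
order-reverse {n} {i} {j} i<n j<n with ℕ.<-cmp i j
... | tri< i<j _ _ = trans (order-> (ℕ.∸-monoʳ-< (s≤s i<j) j<n)) (cong -_ (sym (order-< i<j)))
... | tri≈ _ refl _ = trans (order-refl (n ∸ suc i)) (cong -_ (sym (order-refl i)))
... | tri> _ _ j<i = trans (order-< (ℕ.∸-monoʳ-< (s≤s j<i) i<n)) (cong -_ (sym (order-> j<i)))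

module _ {X : Set} where

  -- Natural numbers instead of `Fin` as positions, since positions are shifted, reflected and
  -- compared between different words.
  nth : List X → ℕ → Maybe X
  nth []       n       = nothing
  nth (x ∷ xs) zero    = just x
  nth (x ∷ xs) (suc n) = nth xs n

  nth-lookup : ∀ xs (i : Fin (length xs)) → nth xs (toℕ i) ≡ just (lookup xs i)
  nth-lookup (x ∷ xs) zero    = refl
  nth-lookup (x ∷ xs) (suc i) = nth-lookup xs i

  nth-bound : ∀ xs {n A} → nth xs n ≡ just A → n < length xs
  nth-bound (x ∷ xs) {zero}  eq = s≤s z≤n
  nth-bound (x ∷ xs) {suc n} eq = s≤s (nth-bound xs eq)

  nth-Fin : ∀ xs {n A} → nth xs n ≡ just A → ∃[ i ] toℕ i ≡ n × lookup xs i ≡ A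
  nth-Fin (x ∷ xs) {zero}  eq = zero , refl , Maybe.just-injective eq
  nth-Fin (x ∷ xs) {suc n} eq = let i , eq₁ , eq₂ = nth-Fin xs eq in suc i , cong suc eq₁ , eq₂

  nth-++ʳ : ∀ xs ys n → nth (xs ++ ys) (length xs ℕ.+ n) ≡ nth ys n
  nth-++ʳ []       ys n = refl
  nth-++ʳ (x ∷ xs) ys n = nth-++ʳ xs ys n

  nth-++ˡ : ∀ xs ys {n} → n < length xs → nth (xs ++ ys) n ≡ nth xs n
  nth-++ˡ (x ∷ xs) ys {zero}  _         = refl
  nth-++ˡ (x ∷ xs) ys {suc n} (s≤s n<) = nth-++ˡ xs ys n<

  nth-reverse : ∀ xs {n} → n < length xs → nth (reverse xs) (length xs ∸ suc n) ≡ nth xs n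
  nth-reverse (x ∷ xs) {zero} _ = trans (cong (λ l → nth l (length xs)) (List.unfold-reverse x xs))
    (trans (cong (nth (reverse xs ++ x ∷ [])) (trans (sym (List.length-reverse xs)) (sym (ℕ.+-identityʳ _))))
           (nth-++ʳ (reverse xs) (x ∷ []) 0))
  nth-reverse (x ∷ xs) {suc n} (s≤s n<) = trans (cong (λ l → nth l (length xs ∸ suc n)) (List.unfold-reverse x xs))
    (trans (nth-++ˡ (reverse xs) (x ∷ []) (subst (length xs ∸ suc n <_) (sym (List.length-reverse xs)) (ℕ.∸-monoʳ-< (s≤s z≤n) n<)))
           (nth-reverse xs n<))

nth-map : ∀ {X Y : Set} (f : X → Y) xs n → nth (List.map f xs) n ≡ Maybe.map f (nth xs n)
nth-map f []       n       = refl
nth-map f (x ∷ xs) zero    = refl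
nth-map f (x ∷ xs) (suc n) = nth-map f xs n

module _ {a} {α : Set a} (w : Nanoword α) where
  open Nanoword w using (alphabet; twice)

  pos : Occurrence alphabet → ℕ
  pos (inj₁ A) = toℕ (Twice.first (twice A))
  pos (inj₂ A) = toℕ (Twice.last (twice A))

  nth-pos : ∀ o → nth (word w) (pos o) ≡ just (letterOf o)
  nth-pos (inj₁ A) = trans (nth-lookup (word w) _) (cong just (Twice.at-first (twice A)))
  nth-pos (inj₂ A) = trans (nth-lookup (word w) _) (cong just (Twice.at-last (twice A)))

  pos-< : ∀ A → pos (inj₁ A) < pos (inj₂ A)
  pos-< A = Twice.first<last (twice A)

  pos-cover : ∀ {n A} → nth (word w) n ≡ just A → n ≡ pos (inj₁ A) ⊎ n ≡ pos (inj₂ A)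
  pos-cover {n} {A} eq with nth-Fin (word w) eq
  ... | i , refl , at = Sum.map (cong toℕ) (cong toℕ) (Twice.only (twice A) i at)

  pos-surjective : ∀ {n A} → nth (word w) n ≡ just A → ∃[ o ] pos o ≡ n × letterOf o ≡ A
  pos-surjective {A = A} eq = [ (λ n≡ → inj₁ A , sym n≡ , refl) , (λ n≡ → inj₂ A , sym n≡ , refl) ]′ (pos-cover eq)

  pos-injective : ∀ {o p} → pos o ≡ pos p → o ≡ p
  pos-injective {o} {p} eq = same o p eq
    (Maybe.just-injective (trans (sym (nth-pos o)) (trans (cong (nth (word w)) eq) (nth-pos p))))
    where
    same : ∀ o p → pos o ≡ pos p → letterOf o ≡ letterOf p → o ≡ p
    same (inj₁ A) (inj₁ _) eq refl = refl
    same (inj₂ A) (inj₂ _) eq refl = refl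
    same (inj₁ A) (inj₂ _) eq refl = contradiction eq (ℕ.<⇒≢ (pos-< A))
    same (inj₂ A) (inj₁ _) eq refl = contradiction (sym eq) (ℕ.<⇒≢ (pos-< A))

  -- The means of computing `pos` in every word below: two places at which a letter is found are all
  -- its places.
  pinned : ∀ {p q A} → p < q → nth (word w) p ≡ just A → nth (word w) q ≡ just A →
           pos (inj₁ A) ≡ p × pos (inj₂ A) ≡ q
  pinned {A = A} p<q at-p at-q with pos-cover at-p | pos-cover at-q
  ... | inj₁ refl | inj₁ refl = contradiction p<q (ℕ.<-irrefl refl)
  ... | inj₁ refl | inj₂ refl = refl , refl
  ... | inj₂ refl | inj₁ refl = contradiction p<q (ℕ.<-asym (pos-< A))
  ... | inj₂ refl | inj₂ refl = contradiction p<q (ℕ.<-irrefl refl)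

  diagram : (α → ℤ) → Diagram
  diagram sign = record
    { letters = alphabet
    ; ε       = sign ∘ Nanoword.∣_∣ w
    ; sgn     = λ o p → order (pos o) (pos p)
    }

-- Written with Boolean tests so as to agree by computation with the number n(A, B) in the pairing
-- of a nanoword.
linking : ℕ → ℕ → ℕ → ℕ → ℤ
linking a b c d =
  if (a <ᵇ c) ∧ (c <ᵇ b) ∧ (b <ᵇ d) then 1ℤ else
  if (c <ᵇ a) ∧ (a <ᵇ d) ∧ (d <ᵇ b) then -1ℤ else 0ℤ

between : ℕ → ℕ → ℕ → Bool
between a b o = (a <ᵇ o) ∧ (o <ᵇ b)

indicator : Bool → ℤ
indicator b = if b then 1ℤ else 0ℤ

linking-self : ∀ a b → linking a b a b ≡ 0ℤ
linking-self a b rewrite ≤⇒≯ᵇ (ℕ.≤-refl {a}) = refl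

-- For `a < b` this is 2 strictly between `a` and `b`, 1 at the two ends, and 0 outside.
chord : ℕ → ℕ → ℕ → ℤ
chord a b o = order o a - order o b

chord-between : ∀ {a b o} → a < b → o ≢ a → o ≢ b → chord a b o ≡ ℤ.+ 2 * indicator (between a b o)
chord-between {a} {b} {o} a<b o≢a o≢b with ℕ.<-cmp o a | ℕ.<-cmp o b
... | tri≈ _ o≡a _ | _ = contradiction o≡a o≢a
... | _ | tri≈ _ o≡b _ = contradiction o≡b o≢b
... | tri< o<a _ _ | tri> _ _ b<o = contradiction (ℕ.<-trans a<b b<o) (ℕ.<-asym o<a)
... | tri< o<a _ _ | tri< o<b _ _
  rewrite <⇒<ᵇ o<a | <⇒<ᵇ o<b | ≤⇒≯ᵇ (ℕ.<⇒≤ o<a) = refl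
... | tri> _ _ a<o | tri< o<b _ _
  rewrite <⇒<ᵇ a<o | <⇒<ᵇ o<b | ≤⇒≯ᵇ (ℕ.<⇒≤ a<o) = refl
... | tri> _ _ a<o | tri> _ _ b<o
  rewrite <⇒<ᵇ a<o | <⇒<ᵇ b<o | ≤⇒≯ᵇ (ℕ.<⇒≤ a<o) | ≤⇒≯ᵇ (ℕ.<⇒≤ b<o) = refl

chord-end₁ : ∀ {a b} → a < b → chord a b a ≡ 1ℤ
chord-end₁ {a} {b} a<b = cong₂ _-_ (order-refl a) (order-< a<b)

chord-end₂ : ∀ {a b} → a < b → chord a b b ≡ 1ℤ
chord-end₂ {a} {b} a<b = cong₂ _-_ (order-> a<b) (order-refl b)

-- Immediate from the antisymmetry of `order`. It trades the chord of one letter at the ends of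
-- another for the chord of the latter at the ends of the former.
chord-flip : ∀ a b c d → chord a b c - chord a b d ≡ chord c d b - chord c d a
chord-flip a b c d = trans (cong₂ _-_
    (cong₂ _-_ (order-antisym c a) (order-antisym c b))
    (cong₂ _-_ (order-antisym d a) (order-antisym d b)))
  (rearrange (order a c) (order b c) (order a d) (order b d))
  where
  rearrange : ∀ ac bc ad bd → (- ac - - bc) - (- ad - - bd) ≡ (bc - bd) - (ac - ad)
  rearrange = solve-∀

-- Of the outcomes of the four comparisons between the two chords, six are compatible with `a < b`
-- and `c < d`; in each of them both sides compute.
chord-linking : ∀ {a b c d} → a < b → c < d → a ≢ c → a ≢ d → b ≢ c → b ≢ d →
                chord a b c - chord a b d ≡ ℤ.+ 2 * linking a b c d
chord-linking {a} {b} {c} {d} a<b c<d a≢c a≢d b≢c b≢d with ℕ.<-cmp a c | ℕ.<-cmp a d | ℕ.<-cmp b c | ℕ.<-cmp b d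
... | tri≈ _ eq _ | _ | _ | _ = contradiction eq a≢c
... | _ | tri≈ _ eq _ | _ | _ = contradiction eq a≢d
... | _ | _ | tri≈ _ eq _ | _ = contradiction eq b≢c
... | _ | _ | _ | tri≈ _ eq _ = contradiction eq b≢d
... | tri< a<c _ _ | tri> _ _ d<a | _ | _ = contradiction (ℕ.<-trans a<c c<d) (ℕ.<-asym d<a)
... | tri> _ _ c<a | _ | tri< b<c _ _ | _ = contradiction (ℕ.<-trans a<b b<c) (ℕ.<-asym c<a)
... | _ | _ | tri< b<c _ _ | tri> _ _ d<b = contradiction (ℕ.<-trans b<c c<d) (ℕ.<-asym d<b)
... | _ | tri> _ _ d<a | _ | tri< b<d _ _ = contradiction (ℕ.<-trans a<b b<d) (ℕ.<-asym d<a)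
... | tri< ac _ _ | tri< ad _ _ | tri< bc _ _ | tri< bd _ _
  rewrite <⇒<ᵇ ac | <⇒≯ᵇ ac | <⇒<ᵇ ad | <⇒≯ᵇ ad
        | <⇒<ᵇ bc | <⇒≯ᵇ bc | <⇒<ᵇ bd | <⇒≯ᵇ bd = refl
... | tri< ac _ _ | tri< ad _ _ | tri> _ _ cb | tri< bd _ _
  rewrite <⇒<ᵇ ac | <⇒≯ᵇ ac | <⇒<ᵇ ad | <⇒≯ᵇ ad
        | <⇒<ᵇ cb | <⇒<ᵇ bd | <⇒≯ᵇ bd = refl
... | tri< ac _ _ | tri< ad _ _ | tri> _ _ cb | tri> _ _ db
  rewrite <⇒<ᵇ ac | <⇒≯ᵇ ac | <⇒<ᵇ ad | <⇒≯ᵇ ad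
        | <⇒<ᵇ cb | <⇒<ᵇ db | <⇒≯ᵇ db = refl
... | tri> _ _ ca | tri< ad _ _ | tri> _ _ cb | tri< bd _ _
  rewrite <⇒<ᵇ ca | <⇒≯ᵇ ca | <⇒<ᵇ ad | <⇒≯ᵇ ad
        | <⇒<ᵇ cb | <⇒<ᵇ bd | <⇒≯ᵇ bd = refl
... | tri> _ _ ca | tri< ad _ _ | tri> _ _ cb | tri> _ _ db
  rewrite <⇒<ᵇ ca | <⇒≯ᵇ ca | <⇒<ᵇ ad | <⇒≯ᵇ ad
        | <⇒<ᵇ cb | <⇒<ᵇ db = refl
... | tri> _ _ ca | tri> _ _ da | tri> _ _ cb | tri> _ _ db
  rewrite <⇒<ᵇ ca | <⇒≯ᵇ ca | <⇒<ᵇ da | <⇒≯ᵇ da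
        | <⇒<ᵇ cb | <⇒<ᵇ db = refl

-- The pairing of a nanoword

module _ (X : FiniteSet) where

  ΣS : (Maybe (Carrier X) → ℤ) → ℤ
  ΣS f = f nothing + Σℤ X (f ∘ just)

  ΣS-cong : ∀ {f g} → (∀ A → f A ≡ g A) → ΣS f ≡ ΣS g
  ΣS-cong f≡g = cong₂ _+_ (f≡g nothing) (Σ-cong X (f≡g ∘ just))

  ΣS-*ˡ : ∀ c f → c * ΣS f ≡ ΣS (λ A → c * f A)
  ΣS-*ˡ c f = trans (ℤ.*-distribˡ-+ c _ _) (cong (c * f nothing +_) (Σ-*ˡ X c _))

module _ (D : Diagram) where
  open Diagram D

  -- An alternating form, of which `E` is the value on the functions `U`. Grouped by letters it is a
  -- sum of 2 × 2 determinants weighted by `ε`.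
  Ω : (Occurrence letters → ℤ) → (Occurrence letters → ℤ) → ℤ
  Ω f g = Σℤ occurrences (λ o → ψ o * (f o * g (swap o)))

  Ω-letters : ∀ f g → Ω f g ≡ Σℤ letters (λ A → ε A * (f (inj₁ A) * g (inj₂ A) - f (inj₂ A) * g (inj₁ A)))
  Ω-letters f g = trans (Σ-⊎ letters letters _) (trans (sym (Σ-+ letters _ _))
    (Σ-cong letters λ A → collect (ε A) (f (inj₁ A) * g (inj₂ A)) (f (inj₂ A) * g (inj₁ A))))
    where
    collect : ∀ e a b → e * a + (- e) * b ≡ e * (a - b)
    collect = solve-∀

  Ω-cong : ∀ {f f′ g g′} → (∀ o → f o ≡ f′ o) → (∀ o → g o ≡ g′ o) → Ω f g ≡ Ω f′ g′
  Ω-cong f≡ g≡ = Σ-cong occurrences λ o → cong (ψ o *_) (cong₂ _*_ (f≡ o) (g≡ (swap o)))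

  Ω-antisym : ∀ f g → Ω f g ≡ - Ω g f
  Ω-antisym f g = begin
    Ω f g             ≡⟨ Ω-letters f g ⟩
    _                 ≡⟨ (Σ-cong letters λ A → flip (ε A) (f (inj₁ A)) (f (inj₂ A)) (g (inj₁ A)) (g (inj₂ A))) ⟩
    _                 ≡⟨ Σ-neg letters _ ⟨
    - _               ≡⟨ cong -_ (Ω-letters g f) ⟨
    - Ω g f           ∎
    where
    open ≡-Reasoning
    flip : ∀ e f₁ f₂ g₁ g₂ → e * (f₁ * g₂ - f₂ * g₁) ≡ - (e * (g₁ * f₂ - g₂ * f₁))
    flip = solve-∀

  Ω-ΣS : ∀ (x : Maybe (Carrier letters) → ℤ) (u : Maybe (Carrier letters) → Occurrence letters → ℤ) g →
         Ω (λ o → ΣS letters (λ A → x A * u A o)) g ≡ ΣS letters (λ A → x A * Ω (u A) g)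
  Ω-ΣS x u g = begin
    Ω (λ o → ΣS letters (λ A → x A * u A o)) g
      ≡⟨ (Σ-cong occurrences λ o → trans
           (distribute (ψ o) (x nothing) (u nothing o) (Σℤ letters (λ A → x (just A) * u (just A) o)) (g (swap o)))
           (cong (λ z → x nothing * (ψ o * (u nothing o * g (swap o))) + z)
             (trans (Σ-*ʳ letters (ψ o * g (swap o)) _)
               (Σ-cong letters λ A → shuffle (ψ o) (x (just A)) (u (just A) o) (g (swap o)))))) ⟩
    Σℤ occurrences (λ o → x nothing * (ψ o * (u nothing o * g (swap o)))
      + Σℤ letters (λ A → x (just A) * (ψ o * (u (just A) o * g (swap o)))))
      ≡⟨ Σ-+ occurrences _ _ ⟩
    _ ≡⟨ cong₂ _+_ (sym (Σ-*ˡ occurrences (x nothing) _))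
           (trans (Σ-swap occurrences letters _) (Σ-cong letters λ A → sym (Σ-*ˡ occurrences (x (just A)) _))) ⟩
    ΣS letters (λ A → x A * Ω (u A) g) ∎
    where
    open ≡-Reasoning
    distribute : ∀ p x u t g → p * ((x * u + t) * g) ≡ x * (p * (u * g)) + t * (p * g)
    distribute = solve-∀
    shuffle : ∀ p x u g → x * u * (p * g) ≡ x * (p * (u * g))
    shuffle = solve-∀

  Ω-bilinear : ∀ (x y : Maybe (Carrier letters) → ℤ) (u : Maybe (Carrier letters) → Occurrence letters → ℤ) →
               Ω (λ o → ΣS letters (λ A → x A * u A o)) (λ o → ΣS letters (λ B → y B * u B o)) ≡
               ΣS letters (λ A → ΣS letters (λ B → (x A * y B) * Ω (u A) (u B)))
  Ω-bilinear x y u = begin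
    Ω (λ o → ΣS letters (λ A → x A * u A o)) uy        ≡⟨ Ω-ΣS x u uy ⟩
    ΣS letters (λ A → x A * Ω (u A) uy)                ≡⟨ ΣS-cong letters row ⟩
    ΣS letters (λ A → ΣS letters (λ B → (x A * y B) * Ω (u A) (u B))) ∎
    where
    open ≡-Reasoning
    uy : Occurrence letters → ℤ
    uy o = ΣS letters (λ B → y B * u B o)
    -- Linearity in the second argument follows from that in the first by antisymmetry.
    right : ∀ A → Ω (u A) uy ≡ ΣS letters (λ B → y B * Ω (u A) (u B))
    right A = begin
      Ω (u A) uy                             ≡⟨ Ω-antisym (u A) uy ⟩
      - Ω uy (u A)                           ≡⟨ cong -_ (Ω-ΣS y u (u A)) ⟩
      - ΣS letters (λ B → y B * Ω (u B) (u A))       ≡⟨ ℤ.-1*i≡-i _ ⟨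
      -1ℤ * ΣS letters (λ B → y B * Ω (u B) (u A))   ≡⟨ ΣS-*ˡ letters -1ℤ (λ B → y B * Ω (u B) (u A)) ⟩
      ΣS letters (λ B → -1ℤ * (y B * Ω (u B) (u A))) ≡⟨ (ΣS-cong letters λ B → trans (negate (y B) (Ω (u B) (u A)))
                                                   (cong (y B *_) (sym (Ω-antisym (u A) (u B))))) ⟩
      ΣS letters (λ B → y B * Ω (u A) (u B))         ∎
      where
      negate : ∀ y w → -1ℤ * (y * w) ≡ y * - w
      negate = solve-∀
    row : ∀ A → x A * Ω (u A) uy ≡ ΣS letters (λ B → (x A * y B) * Ω (u A) (u B))
    row A = trans (cong (x A *_) (right A)) (trans (ΣS-*ˡ letters (x A) (λ B → y B * Ω (u A) (u B)))
      (ΣS-cong letters λ B → sym (ℤ.*-assoc (x A) (y B) (Ω (u A) (u B)))))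

  Ω-zeroˡ : ∀ {f} g → (∀ o → f o ≡ 0ℤ) → Ω f g ≡ 0ℤ
  Ω-zeroˡ g f≡0 = Σ-zero occurrences λ o → trans (cong (λ z → ψ o * (z * g (swap o))) (f≡0 o)) (ℤ.*-zeroʳ (ψ o))

  Ω-zeroʳ : ∀ f {g} → (∀ o → g o ≡ 0ℤ) → Ω f g ≡ 0ℤ
  Ω-zeroʳ f {g} g≡0 = trans (Ω-antisym f g) (cong -_ (Ω-zeroˡ f g≡0))

-- The functions U of the basis vectors: by pairing-form below, twice the pairing is the
-- form Ω of these functions.
chordVector : ∀ {a} {α : Set a} (w : Nanoword α) → Maybe (Letter w) → Letter w ⊎ Letter w → ℤ
chordVector w nothing  o = 1ℤ
chordVector w (just A) o = chord (pos w (inj₁ A)) (pos w (inj₂ A)) (pos w o)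

indicator-∧ : ∀ a b → indicator (a ∧ b) ≡ indicator a * indicator b
indicator-∧ true  true  = refl
indicator-∧ true  false = refl
indicator-∧ false b     = refl

between-start : ∀ a b → between a b a ≡ false
between-start a b rewrite ≤⇒≯ᵇ (ℕ.≤-refl {a}) = refl

between-end : ∀ a b → between a b b ≡ false
between-end a b rewrite ≤⇒≯ᵇ (ℕ.≤-refl {b}) with a <ᵇ b
... | true  = refl
... | false = refl

module _ {a} {α : Set a} (τ : α → α) (φ : Term α → ℤ)
         (hom : GroupMorphisms.IsGroupHomomorphism (AbelianGroup.rawGroup (π τ)) +-0-rawGroup φ) where
  open GroupMorphisms.IsGroupHomomorphism hom

  φ-• : ∀ n t → φ (n • t) ≡ n * φ t
  φ-• (ℤ.+ n) t = φ-ℕ n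
    where
    φ-ℕ : ∀ n → φ (ℤ.+ n • t) ≡ ℤ.+ n * φ t
    φ-ℕ zero    = ε-homo
    φ-ℕ (suc n) = trans (homo t _) (trans (cong (φ t +_) (φ-ℕ n)) (sym (ℤ.suc-* (ℤ.+ n) (φ t))))
  φ-• (ℤ.-[1+ n ]) t = trans (⁻¹-homo _) (trans (cong -_ (φ-• (ℤ.+ suc n) t)) (ℤ.neg-distribˡ-* (ℤ.+ suc n) (φ t)))

  opaque
    unfolding Σℤ
    φ-∑ : ∀ X f → φ (∑ X f) ≡ Σℤ X (φ ∘ f)
    φ-∑ X f = go (FiniteSet.size X) (f ∘ element X)
      where
      open import Algebra.Definitions.RawMonoid (term-rawMonoid {α = α}) using () renaming (sum to sumT)
      go : ∀ n (h : Fin n → Term α) → φ (sumT h) ≡ sumᶠ (φ ∘ h)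
      go zero    h = ε-homo
      go (suc n) h = trans (homo (h zero) _) (cong (φ (h zero) +_) (go n (h ∘ suc)))

  φ-ẽ : ∀ (p : Pairing α) x y → φ (ẽ τ p x y) ≡
        ΣS (Pairing.S° p) (λ A → ΣS (Pairing.S° p) (λ B → (x A * y B) * φ (Pairing.e p A B)))
  φ-ẽ p x y = trans (φ-∑S λ A → ∑S τ p λ B → (x A * y B) • e A B) (ΣS-cong S° λ A → trans (φ-∑S λ B → (x A * y B) • e A B) (ΣS-cong S° λ B → φ-• (x A * y B) (e A B)))
    where
    open Pairing p
    φ-∑S : ∀ f → φ (f nothing ⊞ ∑ S° (f ∘ just)) ≡ ΣS S° (φ ∘ f)
    φ-∑S f = trans (homo _ _) (cong (φ (f nothing) +_) (φ-∑ S° (f ∘ just)))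

  module _ (w : Nanoword α) where
    open Nanoword w using (alphabet; ∣_∣)
    private
      D : Diagram
      D = diagram w (φ ∘ gen)
    open Diagram D

    private
      u = chordVector w
      i j : Letter w → ℕ
      i A = pos w (inj₁ A)
      j A = pos w (inj₂ A)

      n : Letter w → Letter w → ℤ
      n A B = linking (i A) (j A) (i B) (j B)

      u-apart : ∀ {A B} → A ≢ B → ∀ {o} → letterOf o ≡ B → pos w o ≢ i A × pos w o ≢ j A
      u-apart {A} A≢B {o} at = (λ eq → A≢B (trans (sym (cong letterOf (pos-injective w {o} {inj₁ A} eq))) at))
                           , (λ eq → A≢B (trans (sym (cong letterOf (pos-injective w {o} {inj₂ A} eq))) at))

      u-linking : ∀ {A B} → A ≢ B → u (just A) (inj₁ B) - u (just A) (inj₂ B) ≡ ℤ.+ 2 * n A B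
      u-linking {A} {B} A≢B =
        let a , b = u-apart A≢B {inj₁ B} refl ; c , d = u-apart A≢B {inj₂ B} refl
        in chord-linking (pos-< w A) (pos-< w B) (a ∘ sym) (c ∘ sym) (b ∘ sym) (d ∘ sym)

    -- The function of `s` is constantly 1, so the determinant at `B` is the difference of the chord
    -- of `A` at the two ends of `B`, that is `2 * n A B`. For `B` equal to `A` both values are 1
    -- and the difference vanishes, as does `n A A`.
    form-toBase : ∀ A → ℤ.+ 2 * φ (Pairing.e (pairing w) (just A) nothing) ≡ Ω D (u (just A)) (u nothing)
    form-toBase A = begin
      ℤ.+ 2 * φ (∑ alphabet (λ B → n A B • gen ∣ B ∣))
        ≡⟨ cong (ℤ.+ 2 *_) (trans (φ-∑ alphabet _) (Σ-cong alphabet λ B → φ-• (n A B) (gen ∣ B ∣))) ⟩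
      ℤ.+ 2 * Σℤ alphabet (λ B → n A B * ε B)
        ≡⟨ Σ-*ˡ alphabet (ℤ.+ 2) _ ⟩
      Σℤ alphabet (λ B → ℤ.+ 2 * (n A B * ε B))
        ≡⟨ Σ-cong alphabet pointwise ⟩
      Σℤ alphabet (λ B → ε B * (u (just A) (inj₁ B) * 1ℤ - u (just A) (inj₂ B) * 1ℤ))
        ≡⟨ Ω-letters D (u (just A)) (u nothing) ⟨
      Ω D (u (just A)) (u nothing) ∎
      where
      open ≡-Reasoning
      shuffle : ∀ n e → ℤ.+ 2 * (n * e) ≡ e * (ℤ.+ 2 * n)
      shuffle = solve-∀
      unit : ∀ e a b → e * (a - b) ≡ e * (a * 1ℤ - b * 1ℤ)
      unit = solve-∀
      pointwise : ∀ B → ℤ.+ 2 * (n A B * ε B) ≡ ε B * (u (just A) (inj₁ B) * 1ℤ - u (just A) (inj₂ B) * 1ℤ)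
      pointwise B with FiniteSet._≟_ alphabet A B
      ... | yes refl = trans (cong (λ z → ℤ.+ 2 * (z * ε A)) (linking-self (i A) (j A)))
              (trans (sym (ℤ.*-zeroʳ (ε A))) (cong (ε A *_) (sym
                (cong₂ (λ y z → y * 1ℤ - z * 1ℤ) (chord-end₁ (pos-< w A)) (chord-end₂ (pos-< w A))))))
      ... | no A≢B = trans (shuffle (n A B) (ε B)) (trans (cong (ε B *_) (sym (u-linking A≢B)))
              (unit (ε B) (u (just A) (inj₁ B)) (u (just A) (inj₂ B))))

    -- Letter by letter. If `C` is neither `A` nor `B`, the chords at `C` are twice indicators, and
    -- the determinant is four times the contribution of `C` to the difference of the two products.
    -- If `C` is one of two distinct letters `A` and `B`, its own chord is 1 at both ends and the
    -- determinant is `2 * n A B`: this is the origin of the correction n(A, B)(|A| + |B|).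
    form-letters : ∀ A B → ℤ.+ 2 * φ (Pairing.e (pairing w) (just A) (just B)) ≡ Ω D (u (just A)) (u (just B))
    form-letters A B = begin
      ℤ.+ 2 * φ (Pairing.e (pairing w) (just A) (just B))
        ≡⟨ cong (ℤ.+ 2 *_) (trans (homo _ _) (cong₂ _+_
             (trans (φ-• (ℤ.+ 2) _) (cong (ℤ.+ 2 *_) (trans (homo _ _) (cong₂ _+_ (φ-∘w A B) (trans (⁻¹-homo _) (cong -_ (φ-∘w B A)))))))
             (trans (φ-• (n A B) _) (cong (n A B *_) (homo _ _))))) ⟩
      ℤ.+ 2 * (ℤ.+ 2 * (Σℤ alphabet (inner A B) - Σℤ alphabet (inner B A)) + n A B * (ε A + ε B))
        ≡⟨ expand (Σℤ alphabet (inner A B)) (Σℤ alphabet (inner B A)) (n A B) (ε A) (ε B) ⟩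
      ℤ.+ 4 * (Σℤ alphabet (inner A B) + - Σℤ alphabet (inner B A)) + (ℤ.+ 2 * n A B * ε A + ℤ.+ 2 * n A B * ε B)
        ≡⟨ cong₂ _+_
             (trans (cong (λ z → ℤ.+ 4 * (Σℤ alphabet (inner A B) + z)) (Σ-neg alphabet _))
               (trans (cong (ℤ.+ 4 *_) (sym (Σ-+ alphabet _ _))) (Σ-*ˡ alphabet (ℤ.+ 4) _)))
             (trans (cong₂ _+_ (δ-sum A) (δ-sum B)) (sym (Σ-+ alphabet _ _))) ⟩
      Σℤ alphabet (λ C → ℤ.+ 4 * (inner A B C + - inner B A C)) + Σℤ alphabet (λ C → ℤ.+ 2 * n A B * (ε C * δ A C) + ℤ.+ 2 * n A B * (ε C * δ B C))
        ≡⟨ Σ-+ alphabet _ _ ⟨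
      Σℤ alphabet (λ C → ℤ.+ 4 * (inner A B C + - inner B A C) + (ℤ.+ 2 * n A B * (ε C * δ A C) + ℤ.+ 2 * n A B * (ε C * δ B C)))
        ≡⟨ Σ-cong alphabet pointwise ⟩
      Σℤ alphabet (λ C → ε C * (u (just A) (inj₁ C) * u (just B) (inj₂ C) - u (just A) (inj₂ C) * u (just B) (inj₁ C)))
        ≡⟨ Ω-letters D (u (just A)) (u (just B)) ⟨
      Ω D (u (just A)) (u (just B)) ∎
      where
      open ≡-Reasoning
      I : Letter w → Occurrence alphabet → ℤ
      I A o = indicator (between (i A) (j A) (pos w o))
      inner : Letter w → Letter w → Letter w → ℤ
      inner A B C = ε C * (I A (inj₁ C) * I B (inj₂ C))

      φ-∘w : ∀ A B → φ (_∘w_ w A B) ≡ Σℤ alphabet (inner A B)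
      φ-∘w A B = trans (φ-∑ alphabet _) (Σ-cong alphabet λ C → trans
        (φ-if (between (i A) (j A) (i C) ∧ between (i B) (j B) (j C)) (gen ∣ C ∣))
        (cong (ε C *_) (indicator-∧ (between (i A) (j A) (i C)) (between (i B) (j B) (j C)))))
        where
        φ-if : ∀ b t → φ (if b then t else 𝟘) ≡ φ t * indicator b
        φ-if true  t = sym (ℤ.*-identityʳ (φ t))
        φ-if false t = trans ε-homo (sym (ℤ.*-zeroʳ (φ t)))

      δ : Letter w → Letter w → ℤ
      δ A = onlyAt alphabet A (const 1ℤ)

      δ-yes : ∀ A → δ A A ≡ 1ℤ
      δ-yes A = onlyAt-self alphabet A (const 1ℤ)

      δ-no : ∀ {A C} → A ≢ C → δ A C ≡ 0ℤ
      δ-no A≢C = onlyAt-other alphabet (const 1ℤ) (A≢C ∘ sym)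

      -- The correction is written as a sum over all letters, concentrated at `C`, to allow a
      -- comparison term by term.
      δ-sum : ∀ C → ℤ.+ 2 * n A B * ε C ≡ Σℤ alphabet (λ D → ℤ.+ 2 * n A B * (ε D * δ C D))
      δ-sum C = sym (trans (Σ-single alphabet C λ D D≢C → trans
          (cong (λ z → ℤ.+ 2 * n A B * (ε D * z)) (δ-no (D≢C ∘ sym))) (zero-term (ℤ.+ 2 * n A B) (ε D)))
        (trans (cong (λ z → ℤ.+ 2 * n A B * (ε C * z)) (δ-yes C)) (cong (ℤ.+ 2 * n A B *_) (ℤ.*-identityʳ (ε C)))))
        where
        zero-term : ∀ a e → a * (e * 0ℤ) ≡ 0ℤ
        zero-term = solve-∀

      expand : ∀ a b n e f → ℤ.+ 2 * (ℤ.+ 2 * (a - b) + n * (e + f)) ≡ ℤ.+ 4 * (a + - b) + (ℤ.+ 2 * n * e + ℤ.+ 2 * n * f)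
      expand = solve-∀

      Goal : Letter w → Set
      Goal C = ℤ.+ 4 * (inner A B C + - inner B A C) + (ℤ.+ 2 * n A B * (ε C * δ A C) + ℤ.+ 2 * n A B * (ε C * δ B C)) ≡
               ε C * (u (just A) (inj₁ C) * u (just B) (inj₂ C) - u (just A) (inj₂ C) * u (just B) (inj₁ C))

      I-start : ∀ A → I A (inj₁ A) ≡ 0ℤ
      I-start A = cong indicator (between-start (i A) (j A))
      I-end : ∀ A → I A (inj₂ A) ≡ 0ℤ
      I-end A = cong indicator (between-end (i A) (j A))

      u-I : ∀ {A C} → A ≢ C → ∀ o → letterOf o ≡ C → u (just A) o ≡ ℤ.+ 2 * I A o
      u-I {A} A≢C o at = let a , b = u-apart A≢C {o} at in chord-between (pos-< w A) a b

      pointwise : ∀ C → Goal C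
      pointwise C with FiniteSet._≟_ alphabet A C | FiniteSet._≟_ alphabet B C
      ... | yes refl | yes refl = trans
              (calc (ε A) (n A A) (I A (inj₁ A)) (I A (inj₂ A)) (δ A A) (linking-self (i A) (j A)))
              (self (ε A) (u (just A) (inj₁ A)) (u (just A) (inj₂ A)))
        where
        self : ∀ e p q → e * 0ℤ ≡ e * (p * q - q * p)
        self = solve-∀
        calc′ : ∀ e a b d → ℤ.+ 4 * (e * (a * b) + - (e * (a * b))) + (ℤ.+ 2 * 0ℤ * (e * d) + ℤ.+ 2 * 0ℤ * (e * d)) ≡ e * 0ℤ
        calc′ = solve-∀
        calc : ∀ e n a b d → n ≡ 0ℤ → ℤ.+ 4 * (e * (a * b) + - (e * (a * b))) + (ℤ.+ 2 * n * (e * d) + ℤ.+ 2 * n * (e * d)) ≡ e * 0ℤ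
        calc e _ a b d refl = calc′ e a b d
      ... | yes refl | no B≢A = calc (ε A) (n A B) {b₁ = I B (inj₁ A)} {b₂ = I B (inj₂ A)} {ub₁ = u (just B) (inj₁ A)} {ub₂ = u (just B) (inj₂ A)} (I-start A) (I-end A) (δ-yes A) (δ-no B≢A)
              (chord-end₁ (pos-< w A)) (chord-end₂ (pos-< w A))
              (trans (sym (chord-flip (i A) (j A) (i B) (j B))) (u-linking (B≢A ∘ sym)))
        where
        calc″ : ∀ e n b₁ b₂ → ℤ.+ 4 * (e * (0ℤ * b₂) + - (e * (b₁ * 0ℤ))) + (ℤ.+ 2 * n * (e * 1ℤ) + ℤ.+ 2 * n * (e * 0ℤ)) ≡ e * (ℤ.+ 2 * n)
        calc″ = solve-∀
        calc‴ : ∀ e p q → e * (p - q) ≡ e * (1ℤ * p - 1ℤ * q)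
        calc‴ = solve-∀
        calc : ∀ e n {a₁ a₂ b₁ b₂ d d′ ua₁ ua₂ ub₁ ub₂} → a₁ ≡ 0ℤ → a₂ ≡ 0ℤ → d ≡ 1ℤ → d′ ≡ 0ℤ → ua₁ ≡ 1ℤ → ua₂ ≡ 1ℤ →
               ub₂ - ub₁ ≡ ℤ.+ 2 * n →
               ℤ.+ 4 * (e * (a₁ * b₂) + - (e * (b₁ * a₂))) + (ℤ.+ 2 * n * (e * d) + ℤ.+ 2 * n * (e * d′)) ≡ e * (ua₁ * ub₂ - ua₂ * ub₁)
        calc e n {b₁ = b₁} {b₂} {ub₁ = p} {q} refl refl refl refl refl refl h = trans (calc″ e n b₁ b₂) (trans (cong (e *_) (sym h)) (calc‴ e q p))
      ... | no A≢B | yes refl = calc (ε B) (n A B) {a₁ = I A (inj₁ B)} {a₂ = I A (inj₂ B)} {ua₁ = u (just A) (inj₁ B)} {ua₂ = u (just A) (inj₂ B)} (I-start B) (I-end B) (δ-no A≢B) (δ-yes B)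
              (chord-end₁ (pos-< w B)) (chord-end₂ (pos-< w B)) (u-linking A≢B)
        where
        calc″ : ∀ e n a₁ a₂ → ℤ.+ 4 * (e * (a₁ * 0ℤ) + - (e * (0ℤ * a₂))) + (ℤ.+ 2 * n * (e * 0ℤ) + ℤ.+ 2 * n * (e * 1ℤ)) ≡ e * (ℤ.+ 2 * n)
        calc″ = solve-∀
        calc‴ : ∀ e p q → e * (p - q) ≡ e * (p * 1ℤ - q * 1ℤ)
        calc‴ = solve-∀
        calc : ∀ e n {a₁ a₂ b₁ b₂ d d′ ua₁ ua₂ ub₁ ub₂} → b₁ ≡ 0ℤ → b₂ ≡ 0ℤ → d ≡ 0ℤ → d′ ≡ 1ℤ → ub₁ ≡ 1ℤ → ub₂ ≡ 1ℤ →
               ua₁ - ua₂ ≡ ℤ.+ 2 * n →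
               ℤ.+ 4 * (e * (a₁ * b₂) + - (e * (b₁ * a₂))) + (ℤ.+ 2 * n * (e * d) + ℤ.+ 2 * n * (e * d′)) ≡ e * (ua₁ * ub₂ - ua₂ * ub₁)
        calc e n {a₁} {a₂} {ua₁ = p} {q} refl refl refl refl refl refl h = trans (calc″ e n a₁ a₂) (trans (cong (e *_) (sym h)) (calc‴ e p q))
      ... | no A≢C | no B≢C = calc (ε C) (n A B) (I A (inj₁ C)) (I A (inj₂ C)) (I B (inj₁ C)) (I B (inj₂ C)) (δ-no A≢C) (δ-no B≢C)
              (u-I A≢C (inj₁ C) refl) (u-I A≢C (inj₂ C) refl) (u-I B≢C (inj₁ C) refl) (u-I B≢C (inj₂ C) refl)
        where
        calc′ : ∀ e n a₁ a₂ b₁ b₂ → ℤ.+ 4 * (e * (a₁ * b₂) + - (e * (b₁ * a₂))) + (ℤ.+ 2 * n * (e * 0ℤ) + ℤ.+ 2 * n * (e * 0ℤ)) ≡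
                e * ((ℤ.+ 2 * a₁) * (ℤ.+ 2 * b₂) - (ℤ.+ 2 * a₂) * (ℤ.+ 2 * b₁))
        calc′ = solve-∀
        calc : ∀ e n a₁ a₂ b₁ b₂ {d d′ ua₁ ua₂ ub₁ ub₂} → d ≡ 0ℤ → d′ ≡ 0ℤ →
               ua₁ ≡ ℤ.+ 2 * a₁ → ua₂ ≡ ℤ.+ 2 * a₂ → ub₁ ≡ ℤ.+ 2 * b₁ → ub₂ ≡ ℤ.+ 2 * b₂ →
               ℤ.+ 4 * (e * (a₁ * b₂) + - (e * (b₁ * a₂))) + (ℤ.+ 2 * n * (e * d) + ℤ.+ 2 * n * (e * d′)) ≡ e * (ua₁ * ub₂ - ua₂ * ub₁)
        calc e n a₁ a₂ b₁ b₂ refl refl refl refl refl refl = calc′ e n a₁ a₂ b₁ b₂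

    pairing-form : ∀ A B → ℤ.+ 2 * φ (Pairing.e (pairing w) A B) ≡ Ω D (u A) (u B)
    pairing-form (just A) (just B) = form-letters A B
    pairing-form (just A) nothing  = form-toBase A
    pairing-form nothing  (just A) = trans (cong (ℤ.+ 2 *_) (⁻¹-homo _))
      (trans (negate (φ (Pairing.e (pairing w) (just A) nothing)))
        (trans (cong -_ (form-toBase A)) (sym (Ω-antisym D (u nothing) (u (just A))))))
      where
      negate : ∀ a → ℤ.+ 2 * - a ≡ - (ℤ.+ 2 * a)
      negate = solve-∀
    pairing-form nothing  nothing  = trans (cong (ℤ.+ 2 *_) ε-homo)
      (sym (trans (Ω-letters D (u nothing) (u nothing)) (Σ-zero alphabet λ A → ℤ.*-zeroʳ (ε A))))

-- Products and opposites

unit-square : ∀ {e} → e ≡ 1ℤ ⊎ e ≡ -1ℤ → e * e ≡ 1ℤ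
unit-square (inj₁ refl) = refl
unit-square (inj₂ refl) = refl

module _ {a} {α : Set a} (w v : Nanoword α) where
  private
    wv = w · v ⁻
    W = word w
    V = word v

  leftOccurrence : Letter w ⊎ Letter w → Letter wv ⊎ Letter wv
  leftOccurrence = Sum.map inj₁ inj₁

  -- Passing to v⁻ exchanges the two occurrences of a letter.
  rightOccurrence : Letter v ⊎ Letter v → Letter wv ⊎ Letter wv
  rightOccurrence = swap ∘ Sum.map inj₂ inj₂

  private
    nth-left : ∀ o → nth (word wv) (pos w o) ≡ just (inj₁ (letterOf o))
    nth-left o = trans (nth-++ˡ (map inj₁ W) _ (subst (pos w o <_) (sym (List.length-map inj₁ W)) (nth-bound W (nth-pos w o))))
      (trans (nth-map inj₁ W (pos w o)) (cong (Maybe.map inj₁) (nth-pos w o)))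

    shift : ℕ → ℕ
    shift n = length (map {B = Letter wv} inj₁ W) ℕ.+ (length V ∸ suc n)

    bound : ∀ o → pos v o < length V
    bound o = nth-bound V (nth-pos v o)

    nth-right : ∀ o → nth (word wv) (shift (pos v o)) ≡ just (inj₂ (letterOf o))
    nth-right o = trans (nth-++ʳ (map inj₁ W) _ _) (trans (nth-map inj₂ (reverse V) _)
      (cong (Maybe.map inj₂) (trans (nth-reverse V (bound o)) (nth-pos v o))))

  pos-left : ∀ o → pos wv (leftOccurrence o) ≡ pos w o
  pos-left (inj₁ A) = proj₁ (pinned wv (pos-< w A) (nth-left (inj₁ A)) (nth-left (inj₂ A)))
  pos-left (inj₂ A) = proj₂ (pinned wv (pos-< w A) (nth-left (inj₁ A)) (nth-left (inj₂ A)))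

  private
    shift-< : ∀ B → shift (pos v (inj₂ B)) < shift (pos v (inj₁ B))
    shift-< B = ℕ.+-monoʳ-< (length (map {B = Letter wv} inj₁ W)) (ℕ.∸-monoʳ-< (s≤s (pos-< v B)) (bound (inj₂ B)))

  pos-right : ∀ o → pos wv (rightOccurrence o) ≡ shift (pos v o)
  pos-right (inj₁ B) = proj₂ (pinned wv (shift-< B) (nth-right (inj₂ B)) (nth-right (inj₁ B)))
  pos-right (inj₂ B) = proj₁ (pinned wv (shift-< B) (nth-right (inj₂ B)) (nth-right (inj₁ B)))

  private
    order-left : ∀ o p → order (pos wv (leftOccurrence o)) (pos wv (leftOccurrence p)) ≡ order (pos w o) (pos w p)
    order-left o p = cong₂ order (pos-left o) (pos-left p)

    order-right : ∀ o p → order (pos wv (rightOccurrence o)) (pos wv (rightOccurrence p)) ≡ - order (pos v o) (pos v p)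
    order-right o p = trans (cong₂ order (pos-right o) (pos-right p))
      (trans (order-+ (length (map {B = Letter wv} inj₁ W)) _ _) (order-reverse (bound o) (bound p)))

    left<right : ∀ o p → pos wv (leftOccurrence o) < pos wv (rightOccurrence p)
    left<right o p = subst₂ _<_ (sym (pos-left o)) (sym (pos-right p))
      (ℕ.<-≤-trans (subst (pos w o <_) (sym (List.length-map inj₁ W)) (nth-bound W (nth-pos w o))) (ℕ.m≤m+n _ _))

  leftVector : Maybe (Letter wv) → Letter w ⊎ Letter w → ℤ
  leftVector nothing         = chordVector w nothing
  leftVector (just (inj₁ A)) = chordVector w (just A)
  leftVector (just (inj₂ B)) = const 0ℤ

  rightVector : Maybe (Letter wv) → Letter v ⊎ Letter v → ℤ
  rightVector nothing         = chordVector v nothing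
  rightVector (just (inj₁ A)) = const 0ℤ
  rightVector (just (inj₂ B)) = chordVector v (just B)

  -- The chord of a letter of `v` lies entirely to the right of the occurrences in `w`, where it is
  -- zero.
  chordVector-left : ∀ A o → chordVector wv A (leftOccurrence o) ≡ leftVector A o
  chordVector-left nothing         o = refl
  chordVector-left (just (inj₁ A)) o = cong₂ _-_ (order-left o (inj₁ A)) (order-left o (inj₂ A))
  chordVector-left (just (inj₂ B)) o = cong₂ _-_ (order-< (left<right o (inj₂ B))) (order-< (left<right o (inj₁ B)))

  -- Passing to the opposite word reverses the order and exchanges the two ends of a chord. The two
  -- changes of sign cancel.
  chordVector-right : ∀ A o → chordVector wv A (rightOccurrence o) ≡ rightVector A o
  chordVector-right nothing         o = refl
  chordVector-right (just (inj₁ A)) o = cong₂ _-_ (order-> (left<right (inj₁ A) o)) (order-> (left<right (inj₂ A) o))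
  chordVector-right (just (inj₂ B)) o = trans (cong₂ _-_ (order-right o (inj₂ B)) (order-right o (inj₁ B)))
    (flip (order (pos v o) (pos v (inj₂ B))) (order (pos v o) (pos v (inj₁ B))))
    where
    flip : ∀ p q → - p - - q ≡ q - p
    flip = solve-∀

  module _ (sign : α → ℤ) where

    -- The minus sign, hence the opposite pairing of `v`, comes from the exchange of first and last
    -- occurrences in the opposite word, which reverses every determinant.
    Ω-split : ∀ f g → Ω (diagram wv sign) f g ≡
              Ω (diagram w sign) (f ∘ leftOccurrence) (g ∘ leftOccurrence)
              - Ω (diagram v sign) (f ∘ rightOccurrence) (g ∘ rightOccurrence)
    Ω-split f g = begin
      Ω (diagram wv sign) f g
        ≡⟨ trans (Ω-letters (diagram wv sign) f g) (Σ-⊎ (Nanoword.alphabet w) (Nanoword.alphabet v) _) ⟩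
      _ ≡⟨ cong₂ _+_ (sym (Ω-letters (diagram w sign) (f ∘ leftOccurrence) (g ∘ leftOccurrence)))
             (trans (Σ-cong (Nanoword.alphabet v) λ B → flip (sign (Nanoword.∣_∣ v B))
                (f (inj₁ (inj₂ B))) (f (inj₂ (inj₂ B))) (g (inj₁ (inj₂ B))) (g (inj₂ (inj₂ B))))
             (trans (sym (Σ-neg (Nanoword.alphabet v) _))
               (cong -_ (sym (Ω-letters (diagram v sign) (f ∘ rightOccurrence) (g ∘ rightOccurrence)))))) ⟩
      Ω (diagram w sign) (f ∘ leftOccurrence) (g ∘ leftOccurrence)
        - Ω (diagram v sign) (f ∘ rightOccurrence) (g ∘ rightOccurrence) ∎
      where
      open ≡-Reasoning
      flip : ∀ e f₁ f₂ g₁ g₂ → e * (f₁ * g₂ - f₂ * g₁) ≡ - (e * (f₂ * g₁ - f₁ * g₂))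
      flip = solve-∀

module _ {a} {α : Set a} (τ : α → α) (φ : Term α → ℤ)
         (hom : GroupMorphisms.IsGroupHomomorphism (AbelianGroup.rawGroup (π τ)) +-0-rawGroup φ)
         (unit : ∀ b → φ (gen b) ≡ 1ℤ ⊎ φ (gen b) ≡ -1ℤ) where
  open GroupMorphisms.IsGroupHomomorphism hom

  private
    sign : α → ℤ
    sign = φ ∘ gen

  rescale : (w : Nanoword α) → (Maybe (Letter w) → ℤ) → ℤ × (Letter w → ℤ)
  rescale w x = x nothing , λ A → sign (Nanoword.∣_∣ w A) * x (just A)

  -- The sign in `ψ` meets the sign of `rescale`, and their product is 1 because φ takes the values
  -- ±1 on the generators.
  U-rescale : ∀ w x o → Diagram.U (diagram w sign) (rescale w x) o ≡
              ΣS (Nanoword.alphabet w) (λ A → x A * chordVector w A o)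
  U-rescale w x o = cong₂ _+_ (sym (ℤ.*-identityʳ (x nothing)))
    (trans (Σ-⊎ alphabet alphabet _) (trans (sym (Σ-+ alphabet _ _))
      (Σ-cong alphabet λ A → collect (sign ∣ A ∣) (x (just A)) (order (pos w o) (pos w (inj₁ A))) (order (pos w o) (pos w (inj₂ A)))
        (unit-square (unit ∣ A ∣)))))
    where
    open Nanoword w using (alphabet; ∣_∣)
    collect′ : ∀ e x p q → e * (e * x) * p + (- e) * (e * x) * q ≡ (e * e) * (x * (p - q))
    collect′ = solve-∀
    collect : ∀ e x p q → e * e ≡ 1ℤ → e * (e * x) * p + (- e) * (e * x) * q ≡ x * (p - q)
    collect e x p q e²≡1 = trans (collect′ e x p q) (trans (cong (_* (x * (p - q))) e²≡1) (ℤ.*-identityˡ _))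

  module _ (w v : Nanoword α) where
    private
      wv = w · v ⁻
      P = pairing w ⊕ opposite (pairing v)
      Dw = diagram w sign
      Dv = diagram v sign
      Dwv = diagram wv sign

    sum-form : ∀ A B → ℤ.+ 2 * φ (Pairing.e P A B) ≡ Ω Dwv (chordVector wv A) (chordVector wv B)
    sum-form A B = trans (split A B) (sym (trans (Ω-split w v sign (chordVector wv A) (chordVector wv B))
      (cong₂ _-_ (Ω-cong Dw (chordVector-left w v A) (chordVector-left w v B))
                 (Ω-cong Dv (chordVector-right w v A) (chordVector-right w v B)))))
      where
      Split : Maybe (Letter wv) → Maybe (Letter wv) → Set
      Split A B = ℤ.+ 2 * φ (Pairing.e P A B) ≡
        Ω Dw (leftVector w v A) (leftVector w v B) - Ω Dv (rightVector w v A) (rightVector w v B)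

      zeroˡ : ∀ D g → Ω D (const 0ℤ) g ≡ 0ℤ
      zeroˡ D g = Ω-zeroˡ D g λ _ → refl
      zeroʳ : ∀ D f → Ω D f (const 0ℤ) ≡ 0ℤ
      zeroʳ D f = Ω-zeroʳ D f λ _ → refl

      left : ∀ {t a b} → ℤ.+ 2 * φ t ≡ a → b ≡ 0ℤ → ℤ.+ 2 * φ t ≡ a - b
      left {a = a} eq refl = trans eq (sym (ℤ.+-identityʳ a))

      negate : ∀ p → ℤ.+ 2 * - p ≡ 0ℤ - ℤ.+ 2 * p
      negate = solve-∀

      right : ∀ {t a b} → ℤ.+ 2 * φ t ≡ b → a ≡ 0ℤ → ℤ.+ 2 * φ (⊟ t) ≡ a - b
      right {t} eq refl = trans (cong (ℤ.+ 2 *_) (⁻¹-homo t)) (trans (negate (φ t)) (cong (λ z → 0ℤ - z) eq))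

      both : ∀ {t u a b} → ℤ.+ 2 * φ t ≡ a → ℤ.+ 2 * φ u ≡ b → ℤ.+ 2 * φ (t ⊞ ⊟ u) ≡ a - b
      both {t} {u} eq eq′ = trans (cong (ℤ.+ 2 *_) (trans (homo t (⊟ u)) (cong (φ t +_) (⁻¹-homo u))))
        (trans (distribute (φ t) (φ u)) (cong₂ _-_ eq eq′))
        where
        distribute : ∀ p q → ℤ.+ 2 * (p + - q) ≡ ℤ.+ 2 * p - ℤ.+ 2 * q
        distribute = solve-∀

      none : ∀ {a b} → a ≡ 0ℤ → b ≡ 0ℤ → ℤ.+ 2 * φ 𝟘 ≡ a - b
      none refl refl = cong (ℤ.+ 2 *_) ε-homo

      split : ∀ A B → Split A B
      split (just (inj₁ A)) (just (inj₁ B)) = left (pairing-form τ φ hom w (just A) (just B)) (zeroˡ Dv (const 0ℤ))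
      split (just (inj₂ A)) (just (inj₂ B)) = right (pairing-form τ φ hom v (just A) (just B)) (zeroˡ Dw (const 0ℤ))
      split (just (inj₁ A)) (just (inj₂ B)) = none (zeroʳ Dw (chordVector w (just A))) (zeroˡ Dv (chordVector v (just B)))
      split (just (inj₂ A)) (just (inj₁ B)) = none (zeroˡ Dw (chordVector w (just B))) (zeroʳ Dv (chordVector v (just A)))
      split (just (inj₁ A)) nothing         = left (pairing-form τ φ hom w (just A) nothing) (zeroˡ Dv (chordVector v nothing))
      split (just (inj₂ A)) nothing         = right (pairing-form τ φ hom v (just A) nothing) (zeroˡ Dw (chordVector w nothing))
      split nothing         (just (inj₁ B)) = left (pairing-form τ φ hom w nothing (just B)) (zeroʳ Dv (chordVector v nothing))
      split nothing         (just (inj₂ B)) = right (pairing-form τ φ hom v nothing (just B)) (zeroʳ Dw (chordVector w nothing))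
      split nothing         nothing         = both (pairing-form τ φ hom w nothing nothing) (pairing-form τ φ hom v nothing nothing)

    ẽ-form : ∀ x y → ℤ.+ 2 * φ (ẽ τ P x y) ≡ Diagram.E Dwv (rescale wv x) (rescale wv y)
    ẽ-form x y = begin
      ℤ.+ 2 * φ (ẽ τ P x y)
        ≡⟨ cong (ℤ.+ 2 *_) (φ-ẽ τ φ hom P x y) ⟩
      ℤ.+ 2 * ΣS X (λ A → ΣS X (λ B → (x A * y B) * φ (Pairing.e P A B)))
        ≡⟨ trans (ΣS-*ˡ X (ℤ.+ 2) (λ A → ΣS X (λ B → (x A * y B) * φ (Pairing.e P A B))))
             (ΣS-cong X λ A → trans (ΣS-*ˡ X (ℤ.+ 2) (λ B → (x A * y B) * φ (Pairing.e P A B)))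
               (ΣS-cong X λ B → trans (shuffle (x A * y B) (φ (Pairing.e P A B))) (cong ((x A * y B) *_) (sum-form A B)))) ⟩
      ΣS X (λ A → ΣS X (λ B → (x A * y B) * Ω Dwv (chordVector wv A) (chordVector wv B)))
        ≡⟨ Ω-bilinear Dwv x y (chordVector wv) ⟨
      Ω Dwv (λ o → ΣS X (λ A → x A * chordVector wv A o)) (λ o → ΣS X (λ A → y A * chordVector wv A o))
        ≡⟨ Ω-cong Dwv (U-rescale wv x) (U-rescale wv y) ⟨
      Diagram.E Dwv (rescale wv x) (rescale wv y) ∎
      where
      open ≡-Reasoning
      X = Nanoword.alphabet wv
      shuffle : ∀ c e → ℤ.+ 2 * (c * e) ≡ c * (ℤ.+ 2 * e)
      shuffle = solve-∀

-- Matchings of letters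

opaque
  image? : (X Y : FiniteSet) (f : Carrier Y → Carrier X) → ∀ A → Dec (∃[ B ] f B ≡ A)
  image? X Y f A with Fin.any? (λ i → FiniteSet._≟_ X (f (element Y i)) A)
  ... | yes (i , eq) = yes (element Y i , eq)
  ... | no none = no λ (B , eq) → none (index Y B , trans (cong f (element-index Y B)) eq)

module _ {ℓ} (X : FiniteSet) (_~_ : Carrier X → Carrier X → Set ℓ)
         (~-refl : ∀ {A} → A ~ A) (~-trans : ∀ {A B C} → A ~ B → B ~ C → A ~ C) where

  record Matching : Set ℓ where
    field
      μ   : Carrier X → Carrier X
      μμ  : ∀ A → μ (μ A) ≡ A
      μ-~ : ∀ A → μ A ~ A

  open Matching

  module _ (ι : Carrier X → Carrier X) (ιι : ∀ A → ι (ι A) ≡ A) (ι-~ : ∀ A → ι A ~ A) where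

    private
      _∈⟨_⟩ : Carrier X → Carrier X → Set
      A ∈⟨ B ⟩ = A ≡ B ⊎ A ≡ ι B

      opaque
        _∈⟨_⟩? : ∀ A B → Dec (A ∈⟨ B ⟩)
        A ∈⟨ B ⟩? = FiniteSet._≟_ X A B ⊎-dec FiniteSet._≟_ X A (ι B)

      ι-∈ : ∀ {A B} → A ∈⟨ B ⟩ → ι A ∈⟨ B ⟩
      ι-∈ (inj₁ refl) = inj₂ refl
      ι-∈ {B = B} (inj₂ refl) = inj₁ (ιι B)

    -- Joins the partners of B and of ι B, and leaves B and ι B without partners.  A vector
    -- invariant under the result extends to B and ι B so as to be invariant under μ and ι.
    module Splice (M : Matching) (B : Carrier X) where

      -- The cases for `A`: it is `B` or `ι B`; or its partner is not; or its partner is, and the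
      -- path along `μ`, `ι`, `μ` leads out to a new partner; or this path ends at `B` or `ι B`
      -- again, and `A` is left alone.
      data View (A : Carrier X) : Set where
        removed : A ∈⟨ B ⟩ → View A
        kept    : ¬ A ∈⟨ B ⟩ → ¬ μ M A ∈⟨ B ⟩ → View A
        joined  : ¬ A ∈⟨ B ⟩ → μ M A ∈⟨ B ⟩ → ¬ μ M (ι (μ M A)) ∈⟨ B ⟩ → View A
        freed   : ¬ A ∈⟨ B ⟩ → μ M A ∈⟨ B ⟩ → μ M (ι (μ M A)) ∈⟨ B ⟩ → View A

      view : ∀ A → View A
      view A with A ∈⟨ B ⟩? | μ M A ∈⟨ B ⟩? | μ M (ι (μ M A)) ∈⟨ B ⟩?
      ... | yes in₀ | _     | _     = removed in₀
      ... | no out₀  | no out′ | _     = kept out₀ out′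
      ... | no out₀  | yes in₀ | no out′ = joined out₀ in₀ out′
      ... | no out₀  | yes in₀ | yes in′ = freed out₀ in₀ in′

      target : ∀ {A} → View A → Carrier X
      target {A} (removed _)    = A
      target {A} (kept _ _)     = μ M A
      target {A} (joined _ _ _) = μ M (ι (μ M A))
      target {A} (freed _ _ _)  = A

      -- The cases exclude one another except where they agree. So the view found by decision may be
      -- replaced by any view constructed by hand.
      target-unique : ∀ {A} (p q : View A) → target p ≡ target q
      target-unique (removed _) (removed _) = refl
      target-unique (removed in₀) (kept out₀ _) = contradiction in₀ out₀
      target-unique (removed in₀) (joined out₀ _ _) = contradiction in₀ out₀
      target-unique (removed _) (freed _ _ _) = refl
      target-unique (kept out₀ _) (removed in₀) = contradiction in₀ out₀
      target-unique (kept _ _) (kept _ _) = refl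
      target-unique (kept _ out₀) (joined _ in₀ _) = contradiction in₀ out₀
      target-unique (kept _ out₀) (freed _ in₀ _) = contradiction in₀ out₀
      target-unique (joined out₀ _ _) (removed in₀) = contradiction in₀ out₀
      target-unique (joined _ in₀ _) (kept _ out₀) = contradiction in₀ out₀
      target-unique (joined _ _ _) (joined _ _ _) = refl
      target-unique (joined _ _ out₀) (freed _ _ in₀) = contradiction in₀ out₀
      target-unique (freed _ _ _) (removed _) = refl
      target-unique (freed _ in₀ _) (kept _ out₀) = contradiction in₀ out₀
      target-unique (freed _ _ in₀) (joined _ _ out₀) = contradiction in₀ out₀
      target-unique (freed _ _ _) (freed _ _ _) = refl

      back : ∀ A → μ M (ι (μ M (μ M (ι (μ M A))))) ≡ A
      back A = trans (cong (μ M ∘ ι) (μμ M _)) (trans (cong (μ M) (ιι _)) (μμ M A))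

      -- The path from `A` to its new partner, read backwards, is the path of the partner.
      reverse-view : ∀ {A} (p : View A) → ∃[ q ] target {target p} q ≡ A
      reverse-view p@(removed _) = p , refl
      reverse-view {A} (kept out₀ out′) = kept out′ (subst (λ C → ¬ C ∈⟨ B ⟩) (sym (μμ M A)) out₀) , μμ M A
      reverse-view {A} (joined out₀ in₀ out′) =
        joined out′ (subst (_∈⟨ B ⟩) (sym (μμ M _)) (ι-∈ in₀)) (subst (λ C → ¬ C ∈⟨ B ⟩) (sym (back A)) out₀) , back A
      reverse-view p@(freed _ _ _) = p , refl

      spliced : Matching
      spliced = record
        { μ   = λ A → target (view A)
        ; μμ  = λ A → let q , eq = reverse-view (view A) in trans (target-unique (view (target (view A))) q) eq
        ; μ-~ = λ A → related (view A)
        }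
        where
        related : ∀ {A} (p : View A) → target p ~ A
        related (removed _)    = ~-refl
        related {A} (kept _ _) = μ-~ M A
        related {A} (joined _ _ _) = ~-trans (μ-~ M _) (~-trans (ι-~ _) (μ-~ M A))
        related (freed _ _ _)  = ~-refl

      spliced-fixed : ∀ {A} → μ M A ≡ A → μ spliced A ≡ A
      spliced-fixed {A} eq with view A
      ... | removed _     = refl
      ... | kept _ _      = eq
      ... | joined out₀ in₀ _  = contradiction (subst (_∈⟨ B ⟩) eq in₀) out₀
      ... | freed _ _ _   = refl

      spliced-removed : ∀ {A} → A ∈⟨ B ⟩ → μ spliced A ≡ A
      spliced-removed {A} in₀ = target-unique (view A) (removed in₀)

      module _ (x : Carrier X → ℤ) (x-sym : ∀ A → x (μ spliced A) ≡ x A) where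

        private
          x-target : ∀ {A} (p : View A) → x (target p) ≡ x A
          x-target {A} p = trans (cong x (target-unique p (view A))) (x-sym A)

        -- The common value at `B` and `ι B`, dictated by the partner of either of them outside. If
        -- both have one, these two are joined and `x` takes the same value at them. If neither has,
        -- any value would do and 0 is taken.
        value : ℤ
        value with μ M B ∈⟨ B ⟩? | μ M (ι B) ∈⟨ B ⟩?
        ... | no _  | _     = x (μ M B)
        ... | yes _ | no _  = x (μ M (ι B))
        ... | yes _ | yes _ = 0ℤ

        value-B : ¬ μ M B ∈⟨ B ⟩ → value ≡ x (μ M B)
        value-B out₀ with μ M B ∈⟨ B ⟩?
        ... | no _  = refl
        ... | yes in₀ = contradiction in₀ out₀

        value-ιB : ¬ μ M (ι B) ∈⟨ B ⟩ → value ≡ x (μ M (ι B))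
        value-ιB out₀ with μ M B ∈⟨ B ⟩? | μ M (ι B) ∈⟨ B ⟩?
        ... | yes _ | no _  = refl
        ... | _     | yes in₀ = contradiction in₀ out₀
        ... | no out′ | no _  = sym (trans
          (cong (x ∘ μ M ∘ ι) (sym (μμ M B)))
          (x-target (joined out′ (subst (_∈⟨ B ⟩) (sym (μμ M B)) (inj₁ refl))
                       (subst (λ C → ¬ μ M (ι C) ∈⟨ B ⟩) (sym (μμ M B)) out₀))))

        extended : Carrier X → ℤ
        extended A with A ∈⟨ B ⟩?
        ... | yes _ = value
        ... | no  _ = x A

        extended-in : ∀ {A} → A ∈⟨ B ⟩ → extended A ≡ value
        extended-in {A} in₀ with A ∈⟨ B ⟩?
        ... | yes _ = refl
        ... | no out₀  = contradiction in₀ out₀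

        extended-out : ∀ {A} → ¬ A ∈⟨ B ⟩ → extended A ≡ x A
        extended-out {A} out₀ with A ∈⟨ B ⟩?
        ... | yes in₀ = contradiction in₀ out₀
        ... | no _  = refl

        private
          boundary : ∀ {A} → ¬ A ∈⟨ B ⟩ → μ M A ∈⟨ B ⟩ → value ≡ x A
          boundary {A} out₀ (inj₁ eq) = trans (value-B (subst (λ C → ¬ C ∈⟨ B ⟩) A≡ out₀)) (cong x (sym A≡))
            where
            A≡ : A ≡ μ M B
            A≡ = trans (sym (μμ M A)) (cong (μ M) eq)
          boundary {A} out₀ (inj₂ eq) = trans (value-ιB (subst (λ C → ¬ C ∈⟨ B ⟩) A≡ out₀)) (cong x (sym A≡))
            where
            A≡ : A ≡ μ M (ι B)
            A≡ = trans (sym (μμ M A)) (cong (μ M) eq)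

        extended-sym : ∀ A → extended (μ M A) ≡ extended A
        extended-sym A = by-cases (A ∈⟨ B ⟩?) (μ M A ∈⟨ B ⟩?)
          where
          by-cases : Dec (A ∈⟨ B ⟩) → Dec (μ M A ∈⟨ B ⟩) → extended (μ M A) ≡ extended A
          by-cases (yes in₀) (yes in′) = trans (extended-in in′) (sym (extended-in in₀))
          by-cases (no out₀)  (no out′)  = trans (extended-out out′) (trans (x-target (kept out₀ out′)) (sym (extended-out out₀)))
          by-cases (no out₀)  (yes in′) = trans (extended-in in′) (trans (boundary out₀ in′) (sym (extended-out out₀)))
          by-cases (yes in₀) (no out′)  = trans (extended-out out′)
            (trans (sym (boundary out′ (subst (_∈⟨ B ⟩) (sym (μμ M A)) in₀))) (sym (extended-in in₀)))

    record Extension (M : Matching) (bs : List (Carrier X)) (x : Carrier X → ℤ) : Set where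
      field
        extended  : Carrier X → ℤ
        symmetric : ∀ A → extended (μ M A) ≡ extended A
        ι-invariant : ∀ {B} → B ∈ bs → extended (ι B) ≡ extended B
        extends   : ∀ A → (∀ {B} → B ∈ bs → A ≢ B × A ≢ ι B) → extended A ≡ x A

    record Spliced (M : Matching) (bs : List (Carrier X)) : Set ℓ where
      field
        result  : Matching
        -- This keeps a letter unmatched in the later splices once it has been removed.
        fixed   : ∀ {A} → μ M A ≡ A → μ result A ≡ A
        removed : ∀ {B} → B ∈ bs → μ result B ≡ B
        extend  : ∀ x → (∀ A → x (μ result A) ≡ x A) → Extension M bs x

    -- Letters are removed in the order of the list, and vectors are extended in the opposite order.
    -- Giving a common value to `B` and `ι B` does not disturb the invariance at the other letters,
    -- since `ι` preserves this pair.
    splice-all : ∀ M bs → Spliced M bs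
    splice-all M [] = record
      { result = M ; fixed = id ; removed = λ ()
      ; extend = λ x x-sym → record { extended = x ; symmetric = x-sym ; ι-invariant = λ () ; extends = λ _ _ → refl } }
    splice-all M (B ∷ bs) = record
      { result  = R.result
      ; fixed   = λ eq → R.fixed (S.spliced-fixed eq)
      ; removed = λ { (here refl) → R.fixed (S.spliced-removed (inj₁ refl)) ; (there in₀) → R.removed in₀ }
      ; extend  = λ x x-sym → further (R.extend x x-sym)
      }
      where
      module S = Splice M B
      module R = Spliced (splice-all S.spliced bs)

      further : ∀ {x} → Extension S.spliced bs x → Extension M (B ∷ bs) x
      further {x} ext = record
        { extended = z ; symmetric = S.extended-sym y e.symmetric ; ι-invariant = invariant ; extends = agrees }
        where
        module e = Extension ext
        y = e.extended
        z = S.extended y e.symmetric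

        z-in : ∀ {C} → C ∈⟨ B ⟩ → z C ≡ S.value y e.symmetric
        z-in = S.extended-in y e.symmetric

        z-out : ∀ {C} → ¬ C ∈⟨ B ⟩ → z C ≡ y C
        z-out = S.extended-out y e.symmetric

        agrees : ∀ A → (∀ {C} → C ∈ B ∷ bs → A ≢ C × A ≢ ι C) → z A ≡ x A
        agrees A A∉ = trans (z-out [ proj₁ (A∉ (here refl)) , proj₂ (A∉ (here refl)) ]′)
                            (e.extends A λ C∈ → A∉ (there C∈))

        by-cases : ∀ {C} → Dec (C ∈⟨ B ⟩) → C ∈ B ∷ bs → z (ι C) ≡ z C
        by-cases (yes in₀) _           = trans (z-in (ι-∈ in₀)) (sym (z-in in₀))
        by-cases (no out₀) (here eq)   = contradiction (inj₁ eq) out₀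
        by-cases {C} (no out₀) (there ∈bs) = trans
          (z-out (λ in₀ → out₀ (subst (_∈⟨ B ⟩) (ιι C) (ι-∈ in₀))))
          (trans (e.ι-invariant ∈bs) (sym (z-out out₀)))

        invariant : ∀ {C} → C ∈ B ∷ bs → z (ι C) ≡ z C
        invariant {C} = by-cases (C ∈⟨ B ⟩?)

-- Transport of matchings with a form of small rank

module _ {a} {α : Set a} (τ : α → α) (ττ : Involutive _≡_ τ) (sign : α → ℤ) where

  infix 4 _~_
  _~_ : α → α → Set a
  b ~ c = b ≡ c ⊎ b ≡ τ c

  ~-trans : ∀ {b c d} → b ~ c → c ~ d → b ~ d
  ~-trans (inj₁ refl) c~d         = c~d
  ~-trans (inj₂ refl) (inj₁ refl) = inj₂ refl
  ~-trans (inj₂ refl) (inj₂ refl) = inj₁ (ττ _)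

  LetterMatching : Nanoword α → Set a
  LetterMatching w = Matching (Nanoword.alphabet w) (λ A B → Nanoword.∣_∣ w A ~ Nanoword.∣_∣ w B) (inj₁ refl) ~-trans

  form : (w : Nanoword α) → ℤ × (Letter w → ℤ) → ℤ × (Letter w → ℤ) → ℤ
  form w = Diagram.E (diagram w sign)

  -- The orbits of the matching give a filling whose Gram matrix has rank at most N.
  record Null (w : Nanoword α) (N : ℕ) : Set a where
    field
      matching : LetterMatching w
    open Matching matching public
    field
      rank : HasRank {SymmetricVector (Nanoword.alphabet w) μ} N (λ x y → form w (vector x) (vector y))

  -- What all the moves have in common: enough to transport a matching in both directions, with a
  -- loss of at most `N` in the rank.
  record Step (w v : Nanoword α) (N : ℕ) : Set a where
    private
      module w = Nanoword w
      module v = Nanoword v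
    field
      incl       : v.Letter → w.Letter
      injective  : Injective _≡_ _≡_ incl
      projection : ∀ A → w.∣ incl A ∣ ≡ v.∣ A ∣
      ι          : w.Letter → w.Letter
      ιι         : ∀ A → ι (ι A) ≡ A
      ι-label    : ∀ A → w.∣ ι A ∣ ~ w.∣ A ∣
      ι-incl     : ∀ A → ι (incl A) ≡ incl A

    restriction : SymmetricVector w.alphabet ι → ℤ × (v.Letter → ℤ)
    restriction (c , x , _) = c , x ∘ incl

    field
      rank : HasRank {SymmetricVector w.alphabet ι} N
               (λ x y → form w (vector x) (vector y) - form v (restriction x) (restriction y))

  module _ {w v : Nanoword α} {N M : ℕ} (S : Step w v M) where
    open Step S
    private
      module w = Nanoword w
      module v = Nanoword v

      kept? : ∀ A → Dec (∃[ B ] incl B ≡ A)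
      kept? = image? w.alphabet v.alphabet incl

      ι-deleted : ∀ {A} → ¬ (∃[ B ] incl B ≡ A) → ¬ (∃[ B ] incl B ≡ ι A)
      ι-deleted {A} deleted (B , eq) = deleted (B , trans (sym (ι-incl B)) (trans (cong ι eq) (ιι A)))

    -- A vector invariant under the extended matching is invariant under `ι`, and its restriction is
    -- invariant under the matching of `v`. Both bounds apply to it and add up.
    null-forward : Null v N → Null w (N ℕ.+ M)
    null-forward null = record
      { matching = record { μ = μ′ ; μμ = μ′μ′ ; μ-~ = μ′-~ }
      ; rank = hasRank-resp (λ x y → recombine (form w (vector x) (vector y)) (form v (vector (toNull x)) (vector (toNull y))))
          (hasRank-+ (hasRank-pullback toNull n.rank) (hasRank-pullback toStep rank))
      }
      where
      module n = Null null
      recombine : ∀ p q → p ≡ q + (p - q)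
      recombine = solve-∀

      μ′ : w.Letter → w.Letter
      μ′ A with kept? A
      ... | yes (B , _) = incl (n.μ B)
      ... | no _        = ι A

      μ′-kept : ∀ B → μ′ (incl B) ≡ incl (n.μ B)
      μ′-kept B with kept? (incl B)
      ... | yes (B′ , eq) = cong (incl ∘ n.μ) (injective eq)
      ... | no deleted    = contradiction (B , refl) deleted

      μ′-deleted : ∀ {A} → ¬ (∃[ B ] incl B ≡ A) → μ′ A ≡ ι A
      μ′-deleted {A} deleted with kept? A
      ... | yes kept = contradiction kept deleted
      ... | no _     = refl

      μ′μ′ : ∀ A → μ′ (μ′ A) ≡ A
      μ′μ′ A = by-cases (kept? A)
        where
        by-cases : Dec (∃[ B ] incl B ≡ A) → μ′ (μ′ A) ≡ A
        by-cases (yes (B , refl)) = trans (cong μ′ (μ′-kept B)) (trans (μ′-kept (n.μ B)) (cong incl (n.μμ B)))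
        by-cases (no deleted) = trans (cong μ′ (μ′-deleted deleted)) (trans (μ′-deleted (ι-deleted deleted)) (ιι A))

      μ′-~ : ∀ A → w.∣ μ′ A ∣ ~ w.∣ A ∣
      μ′-~ A with kept? A
      ... | yes (B , refl) = subst₂ _~_ (sym (projection (n.μ B))) (sym (projection B)) (n.μ-~ B)
      ... | no _           = ι-label A

      toNull : SymmetricVector w.alphabet μ′ → SymmetricVector v.alphabet n.μ
      toNull (c , x , x-sym) = c , x ∘ incl , λ B → trans (cong x (sym (μ′-kept B))) (x-sym (incl B))

      toStep : SymmetricVector w.alphabet μ′ → SymmetricVector w.alphabet ι
      toStep (c , x , x-sym) = c , x , λ A → by-cases A (kept? A)
        where
        by-cases : ∀ A → Dec (∃[ B ] incl B ≡ A) → x (ι A) ≡ x A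
        by-cases A (yes (B , refl)) = cong x (ι-incl B)
        by-cases A (no deleted) = trans (cong x (sym (μ′-deleted deleted))) (x-sym A)

    -- An invariant vector on `v` is lifted to one on `w` that is invariant under the matching of
    -- `w` and under `ι`, as both bounds have to be applied to the same lift. The matching of `v` is
    -- obtained by splicing out the deleted letters precisely so that such a lift exists.
    null-backward : Null w N → Null v (N ℕ.+ M)
    null-backward null = record
      { matching = record { μ = ν ; μμ = νν ; μ-~ = ν-~ }
      ; rank = hasRank-resp (λ x@(c , x₀ , _) y@(d , y₀ , _) → trans
            (sym (Diagram.E-cong (diagram v sign) c d (agree x) (agree y)))
            (recombine (form w (vector (toNull x)) (vector (toNull y))) (form v (restriction (toStep x)) (restriction (toStep y)))))
          (hasRank-+ (hasRank-pullback toNull n.rank) (hasRank-neg (hasRank-pullback toStep rank)))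
      }
      where
      module n = Null null
      recombine : ∀ p q → q ≡ p + - (p - q)
      recombine = solve-∀

      deleted? : ∀ A → Dec (¬ (∃[ B ] incl B ≡ A))
      deleted? A = ¬? (kept? A)

      deletedLetters : List w.Letter
      deletedLetters = filter deleted? (tabulate (element w.alphabet))

      ∈-deleted⁺ : ∀ {A} → ¬ (∃[ B ] incl B ≡ A) → A ∈ deletedLetters
      ∈-deleted⁺ {A} deleted = ∈-filter⁺ deleted? (subst (_∈ tabulate (element w.alphabet)) (element-index w.alphabet A)
        (∈-tabulate⁺ (index w.alphabet A))) deleted

      ∈-deleted⁻ : ∀ {A} → A ∈ deletedLetters → ¬ (∃[ B ] incl B ≡ A)
      ∈-deleted⁻ in₀ = proj₂ (∈-filter⁻ deleted? {xs = tabulate (element w.alphabet)} in₀)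

      open Spliced (splice-all w.alphabet _ (inj₁ refl) ~-trans ι ιι ι-label n.matching deletedLetters)
      module r = Matching result

      -- After the splicing a deleted letter is its own partner, so it cannot be the partner of a
      -- kept one.
      partner : ∀ B → ∃[ C ] incl C ≡ r.μ (incl B)
      partner B with kept? (r.μ (incl B))
      ... | yes kept   = kept
      ... | no deleted = contradiction (B , trans (sym (r.μμ (incl B))) (removed (∈-deleted⁺ deleted))) deleted

      ν : v.Letter → v.Letter
      ν = proj₁ ∘ partner

      incl-ν : ∀ B → incl (ν B) ≡ r.μ (incl B)
      incl-ν = proj₂ ∘ partner

      νν : ∀ B → ν (ν B) ≡ B
      νν B = injective (trans (incl-ν (ν B)) (trans (cong r.μ (incl-ν B)) (r.μμ (incl B))))

      ν-~ : ∀ B → v.∣ ν B ∣ ~ v.∣ B ∣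
      ν-~ B = subst₂ _~_ (trans (cong w.∣_∣ (sym (incl-ν B))) (projection (ν B))) (projection B) (r.μ-~ (incl B))

      module _ (x : v.Letter → ℤ) (x-sym : ∀ B → x (ν B) ≡ x B) where
        -- A provisional extension. The spliced matching fixes the deleted letters, so zero there
        -- preserves invariance; `Ext.extended` then supplies the correct values.
        byZero : w.Letter → ℤ
        byZero A with kept? A
        ... | yes (B , _) = x B
        ... | no _        = 0ℤ

        byZero-incl : ∀ B → byZero (incl B) ≡ x B
        byZero-incl B with kept? (incl B)
        ... | yes (B′ , eq) = cong x (injective eq)
        ... | no deleted    = contradiction (B , refl) deleted

        byZero-sym : ∀ A → byZero (r.μ A) ≡ byZero A
        byZero-sym A = by-cases (kept? A)
          where
          by-cases : Dec (∃[ B ] incl B ≡ A) → byZero (r.μ A) ≡ byZero A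
          by-cases (yes (B , refl)) = trans (cong byZero (sym (incl-ν B)))
            (trans (byZero-incl (ν B)) (trans (x-sym B) (sym (byZero-incl B))))
          by-cases (no deleted) = cong byZero (removed (∈-deleted⁺ deleted))

        module Ext = Extension (extend byZero byZero-sym)

        extension-ι : ∀ A → Ext.extended (ι A) ≡ Ext.extended A
        extension-ι A = by-cases (kept? A)
          where
          by-cases : Dec (∃[ B ] incl B ≡ A) → Ext.extended (ι A) ≡ Ext.extended A
          by-cases (yes (B , refl)) = cong Ext.extended (ι-incl B)
          by-cases (no deleted) = Ext.ι-invariant (∈-deleted⁺ deleted)

        extension-incl : ∀ B → Ext.extended (incl B) ≡ x B
        extension-incl B = trans (Ext.extends (incl B) λ {C} C∈ →
            (λ eq → ∈-deleted⁻ C∈ (B , eq)) , (λ eq → ι-deleted (∈-deleted⁻ C∈) (B , eq)))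
          (byZero-incl B)

      toNull : SymmetricVector v.alphabet ν → SymmetricVector w.alphabet n.μ
      toNull (c , x , x-sym) = c , Ext.extended x x-sym , Ext.symmetric x x-sym

      toStep : SymmetricVector v.alphabet ν → SymmetricVector w.alphabet ι
      toStep (c , x , x-sym) = c , Ext.extended x x-sym , extension-ι x x-sym

      agree : ∀ (x : SymmetricVector v.alphabet ν) B → proj₂ (restriction (toStep x)) B ≡ proj₁ (proj₂ x) B
      agree (c , x , x-sym) = extension-incl x x-sym

-- Bridges

module _ {X Y : Set} {f : X → Y} where

  embedding : ∀ {xs ys} → Sublist (λ x y → f x ≡ y) xs ys → ℕ → ℕ
  embedding []        n       = n
  embedding (y ∷ʳ e)  n       = suc (embedding e n)
  embedding (eq ∷ e)  zero    = zero
  embedding (eq ∷ e)  (suc n) = suc (embedding e n)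

  embedding-< : ∀ {xs ys} (e : Sublist (λ x y → f x ≡ y) xs ys) {m n} → m < n → embedding e m < embedding e n
  embedding-< []       m<n                 = m<n
  embedding-< (y ∷ʳ e) m<n                 = s≤s (embedding-< e m<n)
  embedding-< (eq ∷ e) {zero}  {suc n} m<n = s≤s z≤n
  embedding-< (eq ∷ e) {suc m} {suc n} m<n = s≤s (embedding-< e (ℕ.s≤s⁻¹ m<n))

  nth-embedding : ∀ {xs ys} (e : Sublist (λ x y → f x ≡ y) xs ys) n → nth ys (embedding e n) ≡ Maybe.map f (nth xs n)
  nth-embedding []       n       = refl
  nth-embedding (y ∷ʳ e) n       = nth-embedding e n
  nth-embedding (eq ∷ e) zero    = cong just (sym eq)
  nth-embedding (eq ∷ e) (suc n) = nth-embedding e n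

nth-total : ∀ {X : Set} (xs : List X) {n} → n < length xs → ∃[ A ] nth xs n ≡ just A
nth-total (x ∷ xs) {zero}  _  = x , refl
nth-total (x ∷ xs) {suc n} n< = nth-total xs (ℕ.s≤s⁻¹ n<)

reflect-reflect : ∀ {L j} → j < L → L ∸ suc (L ∸ suc j) ≡ j
reflect-reflect (s≤s j≤L) = ℕ.m∸[m∸n]≡n j≤L

nth-opposite : ∀ {X : Set} {ι : X → X} (v v′ : List X) → map ι v ≡ reverse v′ → length v ≡ length v′ →
               ∀ {j A} → nth v j ≡ just A → nth v′ (length v ∸ suc j) ≡ just (ι A)
nth-opposite {ι = ι} v v′ rev len {j} {A} eq = begin
  nth v′ (length v ∸ suc j)
    ≡⟨ nth-reverse v′ (subst (length v ∸ suc j <_) len (ℕ.∸-monoʳ-< (s≤s z≤n) j<)) ⟨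
  nth (reverse v′) (length v′ ∸ suc (length v ∸ suc j))
    ≡⟨ cong₂ nth (sym rev) (trans (cong (_∸ suc (length v ∸ suc j)) (sym len)) (reflect-reflect j<)) ⟩
  nth (map ι v) j
    ≡⟨ trans (nth-map ι v j) (cong (Maybe.map ι) eq) ⟩
  just (ι A) ∎
  where
  open ≡-Reasoning
  j< : j < length v
  j< = nth-bound v eq

same-letter : ∀ {X : Set} (o p : X ⊎ X) → letterOf o ≡ letterOf p → o ≡ p ⊎ o ≡ swap p
same-letter (inj₁ A) (inj₁ _) refl = inj₁ refl
same-letter (inj₁ A) (inj₂ _) refl = inj₂ refl
same-letter (inj₂ A) (inj₁ _) refl = inj₂ refl
same-letter (inj₂ A) (inj₂ _) refl = inj₁ refl

swap-≢ : ∀ {X : Set} (o : X ⊎ X) → swap o ≢ o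
swap-≢ (inj₁ A) ()
swap-≢ (inj₂ A) ()

module _ {a} {α : Set a} {w v : Nanoword α} {f : Letter v → Letter w}
         (e : Sublist (λ A B → f A ≡ B) (word v) (word w)) where

  -- The embedding preserves the order, so the images of the two occurrences of a letter are the
  -- first and the last occurrence of its image, by `pinned`.
  pos-embedding : ∀ o → pos w (Sum.map f f o) ≡ embedding e (pos v o)
  pos-embedding o = occurrence o (pinned w (embedding-< e (pos-< v (letterOf o))) (at (inj₁ (letterOf o))) (at (inj₂ (letterOf o))))
    where
    at : ∀ o → nth (word w) (embedding e (pos v o)) ≡ just (f (letterOf o))
    at o = trans (nth-embedding e (pos v o)) (cong (Maybe.map f) (nth-pos v o))
    occurrence : ∀ o → pos w (inj₁ (f (letterOf o))) ≡ embedding e (pos v (inj₁ (letterOf o)))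
                     × pos w (inj₂ (f (letterOf o))) ≡ embedding e (pos v (inj₂ (letterOf o))) →
                 pos w (Sum.map f f o) ≡ embedding e (pos v o)
    occurrence (inj₁ A) = proj₁
    occurrence (inj₂ A) = proj₂

  order-embedding : ∀ o p → order (pos w (Sum.map f f o)) (pos w (Sum.map f f p)) ≡ order (pos v o) (pos v p)
  order-embedding o p = trans (cong₂ order (pos-embedding o) (pos-embedding p))
    (order-monotone (embedding e) (embedding-< e) (pos v o) (pos v p))

module _ {a} {α : Set a} (τ : α → α) where

  -- A bridge, with the words V t given by their positions in w.
  record WordReversal (w v : Nanoword α) : Set a where
    open Nanoword w using (∣_∣)
    field
      incl       : Letter v → Letter w
      injective  : Injective _≡_ _≡_ incl
      projection : ∀ A → ∣ incl A ∣ ≡ Nanoword.∣_∣ v A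
      embed      : Sublist (λ A B → incl A ≡ B) (word v) (word w)
      k          : ℕ
      κ          : Fin k → Fin k
      κκ         : ∀ t → κ (κ t) ≡ t
      start      : Fin k → ℕ
      V          : Fin k → List (Letter w)
      V-at       : ∀ t {j A} → nth (V t) j ≡ just A → nth (word w) (start t ℕ.+ j) ≡ just A
      disjoint   : ∀ {t u} → t Fin.< u → start t ℕ.+ length (V t) ≤ start u
      locate     : ∀ o → (∃[ B ] incl B ≡ letterOf o) ⊎ (∃[ t ] ∃[ j ] pos w o ≡ start t ℕ.+ j × j < length (V t))
      V-deleted  : ∀ t {j A} → nth (V t) j ≡ just A → ∀ B → incl B ≢ A
      ι          : Letter w → Letter w
      ι-reverse  : ∀ t → map ι (V t) ≡ reverse (V (κ t))
      -- The two alternatives are the cases ε = 1 and ε = 0 of the condition on a bridge.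
      mirror     : ∀ A t j → pos w (inj₁ A) ≡ start t ℕ.+ j → j < length (V t) →
                   (pos w (inj₁ (ι A)) ≡ start (κ t) ℕ.+ (length (V t) ∸ suc j) × ∣ ι A ∣ ≡ τ ∣ A ∣) ⊎
                   (pos w (inj₂ (ι A)) ≡ start (κ t) ℕ.+ (length (V t) ∸ suc j) × ∣ ι A ∣ ≡ ∣ A ∣)

  module _ (ττ : Involutive _≡_ τ) (sign : α → ℤ) (sign-τ : ∀ b → sign (τ b) ≡ - sign b)
           {w v : Nanoword α} (R : WordReversal w v) where
    open WordReversal R
    open Nanoword w using (∣_∣)

    private
      O O′ : Set
      O = Letter w ⊎ Letter w
      O′ = Letter v ⊎ Letter v

      len : Fin k → ℕ
      len t = length (V t)

      len-κ : ∀ t → len (κ t) ≡ len t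
      len-κ t = trans (sym (List.length-reverse (V (κ t)))) (trans (cong length (sym (ι-reverse t))) (List.length-map ι (V t)))

      record Loc (o : O) (t : Fin k) (j : ℕ) : Set where
        constructor at
        field
          pos-eq : pos w o ≡ start t ℕ.+ j
          bounded : j < len t

      loc-letter : ∀ {o t j} → Loc o t j → nth (V t) j ≡ just (letterOf o)
      loc-letter {o} {t} {j} (at eq j<) =
        let A , nth≡ = nth-total (V t) j<
        in trans nth≡ (trans (sym (V-at t nth≡)) (trans (cong (nth (word w)) (sym eq)) (nth-pos w o)))

      Loc-deleted : ∀ {o t j} → Loc o t j → ∀ B → incl B ≢ letterOf o
      Loc-deleted {t = t} l = V-deleted t (loc-letter l)

      before : ∀ {t u j i n} → n ≡ start t ℕ.+ j → j < len t → n ≡ start u ℕ.+ i → ¬ t Fin.< u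
      before {t} {u} {j} {i} eq j< eq′ t<u = ℕ.<-irrefl refl (ℕ.<-≤-trans (ℕ.+-monoʳ-< (start t) j<)
        (ℕ.≤-trans (disjoint t<u) (ℕ.≤-trans (ℕ.m≤m+n (start u) i) (ℕ.≤-reflexive (trans (sym eq′) eq)))))

      Loc-unique : ∀ {o t u j i} → Loc o t j → Loc o u i → t ≡ u × j ≡ i
      Loc-unique {t = t} {u} (at eq j<) (at eq′ i<) with Fin.<-cmp t u
      ... | tri< t<u _ _ = contradiction t<u (before eq j< eq′)
      ... | tri> _ _ u<t = contradiction u<t (before eq′ i< eq)
      ... | tri≈ _ refl _ = refl , ℕ.+-cancelˡ-≡ (start t) _ _ (trans (sym eq) eq′)

      inc : O′ → O
      inc = Sum.map incl incl

      Located : O → Set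
      Located o = (∃[ o′ ] inc o′ ≡ o) ⊎ (∃[ t ] ∃[ j ] Loc o t j)

      located : ∀ o → Located o
      located (inj₁ A) = Sum.map (λ (B , eq) → inj₁ B , cong inj₁ eq) (λ (t , j , eq , j<) → t , j , at eq j<) (locate (inj₁ A))
      located (inj₂ A) = Sum.map (λ (B , eq) → inj₂ B , cong inj₂ eq) (λ (t , j , eq , j<) → t , j , at eq j<) (locate (inj₂ A))

      inc-injective : ∀ {o o′} → inc o ≡ inc o′ → o ≡ o′
      inc-injective {inj₁ A} {inj₁ B} eq = cong inj₁ (injective (Sum.inj₁-injective eq))
      inc-injective {inj₂ A} {inj₂ B} eq = cong inj₂ (injective (Sum.inj₂-injective eq))

      letter-inc : ∀ o → letterOf (inc o) ≡ incl (letterOf o)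
      letter-inc (inj₁ A) = refl
      letter-inc (inj₂ A) = refl

      Loc-inc : ∀ {o t j} → ¬ Loc (inc o) t j
      Loc-inc {o} l = Loc-deleted l (letterOf o) (sym (letter-inc o))

      loc′ : ∀ {o} → Located o → O′ ⊎ Fin k
      loc′ (inj₁ (o′ , _)) = inj₁ o′
      loc′ (inj₂ (t , _))  = inj₂ t

      loc : O → O′ ⊎ Fin k
      loc o = loc′ (located o)

      loc-inc : ∀ o → loc (inc o) ≡ inj₁ o
      loc-inc o with located (inc o)
      ... | inj₁ (o′ , eq) = cong inj₁ (inc-injective eq)
      ... | inj₂ (t , j , l) = contradiction l (Loc-inc {o})

      inc-loc : ∀ {o o′} → loc o ≡ inj₁ o′ → inc o′ ≡ o
      inc-loc {o} eq with located o
      inc-loc refl | inj₁ (o′ , eq) = eq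

      loc-Loc : ∀ {o t} → loc o ≡ inj₂ t → ∃[ j ] Loc o t j
      loc-Loc {o} eq with located o
      loc-Loc refl | inj₂ (t , j , l) = j , l

      Loc-loc : ∀ {o t j} → Loc o t j → loc o ≡ inj₂ t
      Loc-loc {o} l with located o
      ... | inj₁ (o′ , refl) = contradiction l (Loc-inc {o′})
      ... | inj₂ (u , i , l′) = cong inj₂ (proj₁ (Loc-unique l′ l))

      reflected : ∀ {L j} → j < L → L ∸ suc j < L
      reflected {L} {j} j< = ℕ.∸-monoʳ-< (s≤s z≤n) j<

      opposite-at : ∀ {o t j} → Loc o t j → nth (word w) (start (κ t) ℕ.+ (len t ∸ suc j)) ≡ just (ι (letterOf o))
      opposite-at {o} {t} {j} l = V-at (κ t) (nth-opposite (V t) (V (κ t)) (ι-reverse t) (sym (len-κ t)) (loc-letter l))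

      J′ : ∀ {o} → Located o → O
      J′ {o} (inj₁ _)           = o
      J′ (inj₂ (t , j , l)) = proj₁ (pos-surjective w (opposite-at l))

      J : O → O
      J o = J′ (located o)

      J-spec : ∀ {o t j} → Loc o t j → pos w (J o) ≡ start (κ t) ℕ.+ (len t ∸ suc j) × letterOf (J o) ≡ ι (letterOf o)
      J-spec {o} l with located o
      ... | inj₁ (o′ , refl) = contradiction l (Loc-inc {o′})
      ... | inj₂ (u , i , l′) with Loc-unique l′ l
      ...   | refl , refl = proj₂ (pos-surjective w (opposite-at l′))

      J-Loc : ∀ {o t j} → Loc o t j → Loc (J o) (κ t) (len t ∸ suc j)
      J-Loc {t = t} l@(at _ j<) = at (proj₁ (J-spec l)) (subst (len t ∸ suc _ <_) (sym (len-κ t)) (reflected j<))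

      J-kept : ∀ {o o′} → loc o ≡ inj₁ o′ → J o ≡ o
      J-kept {o} eq with located o
      J-kept refl | inj₁ _ = refl

      JJ-Loc : ∀ {o t j} → Loc o t j → J (J o) ≡ o
      JJ-Loc {o} {t} {j} l@(at eq j<) = pos-injective w (begin
        pos w (J (J o))
          ≡⟨ proj₁ (J-spec (J-Loc l)) ⟩
        start (κ (κ t)) ℕ.+ (len (κ t) ∸ suc (len t ∸ suc j))
          ≡⟨ cong₂ ℕ._+_ (cong start (κκ t)) (trans (cong (_∸ suc (len t ∸ suc j)) (len-κ t)) (reflect-reflect j<)) ⟩
        start t ℕ.+ j
          ≡⟨ eq ⟨
        pos w o ∎)
        where open ≡-Reasoning

      JJ : ∀ o → J (J o) ≡ o
      JJ o = by-cases (located o)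
        where
        by-cases : Located o → J (J o) ≡ o
        by-cases (inj₁ (o′ , refl)) = trans (cong J (J-kept (loc-inc o′))) (J-kept (loc-inc o′))
        by-cases (inj₂ (t , j , l)) = JJ-Loc l

      Loc-sibling : ∀ {o p t j} → Loc o t j → letterOf p ≡ letterOf o → ∃[ u ] ∃[ i ] Loc p u i
      Loc-sibling {o} {p} l eq with located p
      ... | inj₁ (o′ , refl) = contradiction (trans (sym (letter-inc o′)) eq) (Loc-deleted l (letterOf o′))
      ... | inj₂ found = found

      -- Both sides are occurrences of the same letter. The values of the involution `J` at `o` and
      -- at `swap o` differ, so they are the two occurrences of that letter.
      J-swap : ∀ {o t j} → Loc o t j → J (swap o) ≡ swap (J o)
      J-swap {o} l with Loc-sibling {p = swap o} l (letter-swap o)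
      ... | u , i , l′ with same-letter (J (swap o)) (J o)
                              (trans (proj₂ (J-spec l′)) (trans (cong ι (letter-swap o)) (sym (proj₂ (J-spec l)))))
      ...   | inj₂ eq = eq
      ...   | inj₁ eq = contradiction (trans (sym (JJ (swap o))) (trans (cong J eq) (JJ o))) (swap-≢ o)

      open Diagram (diagram w sign) using (ψ; ψ-swap)

      -- This is the role of the condition on labels in a bridge. If the image is a first
      -- occurrence, the label changes by `τ`, which reverses its sign; if it is a last occurrence,
      -- the label is the same and the sign comes from `ψ`.
      J-ψ₁ : ∀ {A t j} → Loc (inj₁ A) t j → ψ (J (inj₁ A)) ≡ - sign ∣ A ∣
      J-ψ₁ {A} {t} {j} l@(at eq j<) with mirror A t j eq j<
      ... | inj₁ (eq′ , label) = trans (cong ψ (pos-injective w {J (inj₁ A)} {inj₁ (ι A)} (trans (proj₁ (J-spec l)) (sym eq′))))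
              (trans (cong sign label) (sign-τ ∣ A ∣))
      ... | inj₂ (eq′ , label) = trans (cong ψ (pos-injective w {J (inj₁ A)} {inj₂ (ι A)} (trans (proj₁ (J-spec l)) (sym eq′))))
              (cong (-_ ∘ sign) label)

      J-ψ : ∀ {o t j} → Loc o t j → ψ (J o) ≡ - ψ o
      J-ψ {inj₁ A} l = J-ψ₁ l
      J-ψ {inj₂ A} l with Loc-sibling {p = inj₁ A} l refl
      ... | u , i , l′ = trans (cong ψ (J-swap l′)) (trans (ψ-swap (J (inj₁ A))) (cong -_ (J-ψ₁ l′)))

      J-s : ∀ {o p t j i} → Loc o t j → Loc p t i → order (pos w (J o)) (pos w (J p)) ≡ - order (pos w o) (pos w p)
      J-s {o} {p} {t} {j} {i} l@(at eq j<) l′@(at eq′ i<) = begin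
        order (pos w (J o)) (pos w (J p))
          ≡⟨ cong₂ order (proj₁ (J-spec l)) (proj₁ (J-spec l′)) ⟩
        order (start (κ t) ℕ.+ (len t ∸ suc j)) (start (κ t) ℕ.+ (len t ∸ suc i))
          ≡⟨ trans (order-+ (start (κ t)) _ _) (order-reverse j< i<) ⟩
        - order j i
          ≡⟨ cong -_ (order-+ (start t) j i) ⟨
        - order (start t ℕ.+ j) (start t ℕ.+ i)
          ≡⟨ cong -_ (cong₂ order eq eq′) ⟨
        - order (pos w o) (pos w p) ∎
        where open ≡-Reasoning

      -- One comparison suffices: an occurrence outside the interval that does not precede its start
      -- comes after its end.
      sep : Fin k → O → ℤ
      sep t o = if pos w o <ᵇ start t then 1ℤ else -1ℤ

      s-sep : ∀ {o p t j} → Loc o t j → loc p ≢ inj₂ t → order (pos w o) (pos w p) ≡ sep t p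
      s-sep {o} {p} {t} {j} (at eq j<) out with pos w p ℕ.<? start t
      ... | yes p< = trans (order-> (ℕ.<-≤-trans p< (subst (start t ≤_) (sym eq) (ℕ.m≤m+n (start t) j))))
              (sym (cong (λ b → if b then 1ℤ else -1ℤ) (<⇒<ᵇ p<)))
      ... | no p≮ with pos w p ℕ.<? start t ℕ.+ len t
      ...   | yes p<end = contradiction (Loc-loc {p} {t} {pos w p ∸ start t} (at (sym (ℕ.m+[n∸m]≡n (ℕ.≮⇒≥ p≮)))
              (ℕ.+-cancelˡ-< (start t) _ _ (subst (_< start t ℕ.+ len t) (sym (ℕ.m+[n∸m]≡n (ℕ.≮⇒≥ p≮))) p<end)))) out
      ...   | no p≮end = trans (order-< (subst (_< pos w p) (sym eq)
                (ℕ.<-≤-trans (ℕ.+-monoʳ-< (start t) j<) (ℕ.≮⇒≥ p≮end))))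
              (sym (cong (λ b → if b then 1ℤ else -1ℤ) (≤⇒≯ᵇ (ℕ.≮⇒≥ p≮))))

      -- The map `ι` is arbitrary on the kept letters and is replaced by the identity there.
      ι̂′ : ∀ {A} → Located (inj₁ A) → Letter w
      ι̂′ {A} (inj₁ _) = A
      ι̂′ {A} (inj₂ _) = ι A

      ι̂ : Letter w → Letter w
      ι̂ A = ι̂′ (located (inj₁ A))

      ι̂-Loc : ∀ {o t j} → Loc o t j → ι̂ (letterOf o) ≡ ι (letterOf o)
      ι̂-Loc {o} l with located (inj₁ (letterOf o))
      ... | inj₁ (inj₁ B , eq) = contradiction (Sum.inj₁-injective eq) (Loc-deleted l B)
      ... | inj₂ _ = refl

      ι̂-incl : ∀ B → ι̂ (incl B) ≡ incl B
      ι̂-incl B with located (inj₁ (incl B))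
      ... | inj₁ _ = refl
      ... | inj₂ (t , j , l) = contradiction l (Loc-inc {inj₁ B})

      J-letter : ∀ {o t j} → Loc o t j → letterOf (J o) ≡ ι̂ (letterOf o)
      J-letter l = trans (proj₂ (J-spec l)) (sym (ι̂-Loc l))

      -- For the deleted letters this is inherited from `J`: reflecting an occurrence twice restores
      -- it, and with it its letter.
      ι̂ι̂ : ∀ A → ι̂ (ι̂ A) ≡ A
      ι̂ι̂ A = by-cases (located (inj₁ A))
        where
        by-cases : Located (inj₁ A) → ι̂ (ι̂ A) ≡ A
        by-cases (inj₁ (inj₁ B , refl)) = trans (cong ι̂ (ι̂-incl B)) (ι̂-incl B)
        by-cases (inj₂ (t , j , l)) = begin
          ι̂ (ι̂ A)                         ≡⟨ cong ι̂ (J-letter l) ⟨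
          ι̂ (letterOf (J (inj₁ A)))       ≡⟨ J-letter (J-Loc l) ⟨
          letterOf (J (J (inj₁ A)))       ≡⟨ cong letterOf (JJ (inj₁ A)) ⟩
          A                               ∎
          where open ≡-Reasoning

      ι̂-label : ∀ A → ∣ ι̂ A ∣ ≡ ∣ A ∣ ⊎ ∣ ι̂ A ∣ ≡ τ ∣ A ∣
      ι̂-label A with located (inj₁ A)
      ... | inj₁ _ = inj₁ refl
      ... | inj₂ (t , j , at eq j<) = Sum.swap (Sum.map proj₂ proj₂ (mirror A t j eq j<))

    diagramReversal : Reversal (diagram w sign) (diagram v sign)
    diagramReversal = record
      { incl = incl ; injective = injective ; ε-incl = λ A → cong sign (projection A)
      ; s-inc = order-embedding {w = w} {v} embed
      ; s-antisym = λ o p → order-antisym (pos w o) (pos w p)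
      ; k = k ; κ = κ ; κκ = κκ ; loc = loc ; loc-inc = loc-inc ; inc-loc = inc-loc
      ; ι = ι̂ ; J = J ; JJ = JJ
      ; loc-J₁ = λ eq → trans (cong loc (J-kept eq)) eq
      ; loc-J₂ = λ eq → Loc-loc (J-Loc (proj₂ (loc-Loc eq)))
      ; J-swap = λ eq → J-swap (proj₂ (loc-Loc eq))
      ; J-ψ = λ eq → J-ψ (proj₂ (loc-Loc eq))
      ; J-letter = λ eq → J-letter (proj₂ (loc-Loc eq))
      ; J-s = λ eq eq′ → J-s (proj₂ (loc-Loc eq)) (proj₂ (loc-Loc eq′))
      ; sep = sep
      ; s-sep = λ eq out → s-sep (proj₂ (loc-Loc eq)) out
      }

    reversal-step : Step τ ττ sign w v (4 ℕ.* length (orbits κ κκ))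
    reversal-step = record
      { incl = incl ; injective = injective ; projection = projection
      ; ι = ι̂ ; ιι = ι̂ι̂ ; ι-label = ι̂-label ; ι-incl = ι̂-incl
      ; rank = reversal-rank diagramReversal
      }

-- The third homotopy move

order-adjacent : ∀ {m n} → m ≢ n → m ≢ suc n → order m n ≡ order m (suc n)
order-adjacent {m} {n} m≢n m≢1+n with ℕ.<-cmp m n
... | tri< m<n _ _ = trans (order-< m<n) (sym (order-< (ℕ.m<n⇒m<1+n m<n)))
... | tri≈ _ m≡n _ = contradiction m≡n m≢n
... | tri> _ _ n<m = trans (order-> n<m) (sym (order-> (ℕ.≤∧≢⇒< n<m (m≢1+n ∘ sym))))

order-adjacentˡ : ∀ {m n} → m ≢ n → m ≢ suc n → order n m ≡ order (suc n) m
order-adjacentˡ {m} {n} m≢n m≢1+n =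
  trans (order-antisym n m) (trans (cong -_ (order-adjacent m≢n m≢1+n)) (sym (order-antisym (suc n) m)))

increasing : (f : ℕ → ℕ) → (∀ n → f n < f (suc n)) → ∀ {m n} → m < n → f m < f n
increasing f step {m} {suc n} (s≤s m≤n) with ℕ.m≤n⇒m<n∨m≡n m≤n
... | inj₁ m<n  = ℕ.<-trans (increasing f step m<n) (step n)
... | inj₂ refl = step m

-- Positions are a parameter, so that the words before and after the third move give diagrams on the
-- same letters.
positioned : (X : FiniteSet) → (Carrier X → ℤ) → (Occurrence X → ℕ) → Diagram
positioned X ε p = record { letters = X ; ε = ε ; sgn = λ o o′ → order (p o) (p o′) }

U-letters : ∀ X ε p c x o → Diagram.U (positioned X ε p) (c , x) o ≡
            c + Σℤ X (λ A → (ε A * x A) * chord (p (inj₁ A)) (p (inj₂ A)) (p o))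
U-letters X ε p c x o = cong (c +_) (trans (Σ-⊎ X X _) (trans (sym (Σ-+ X _ _))
  (Σ-cong X λ A → collect (ε A) (x A) (order (p o) (p (inj₁ A))) (order (p o) (p (inj₂ A))))))
  where
  collect : ∀ e x a b → e * x * a + (- e) * x * b ≡ (e * x) * (a - b)
  collect = solve-∀

module _ (X : FiniteSet) {A B C : Carrier X} (A≢B : A ≢ B) (A≢C : A ≢ C) (B≢C : B ≢ C) where

  Triple : Carrier X → Set
  Triple D = D ≡ A ⊎ D ≡ B ⊎ D ≡ C

  opaque
    triple? : ∀ D → Dec (Triple D)
    triple? D = FiniteSet._≟_ X D A ⊎-dec (FiniteSet._≟_ X D B ⊎-dec FiniteSet._≟_ X D C)

  offTriple : (Carrier X → ℤ) → Carrier X → ℤ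
  offTriple f D with triple? D
  ... | yes _ = 0ℤ
  ... | no  _ = f D

  offTriple-cong : ∀ {f g} → (∀ D → ¬ Triple D → f D ≡ g D) → ∀ D → offTriple f D ≡ offTriple g D
  offTriple-cong f≡g D with triple? D
  ... | yes _ = refl
  ... | no ¬t = f≡g D ¬t

  private
    off-yes : ∀ {D} f → Triple D → offTriple f D ≡ 0ℤ
    off-yes {D} f t with triple? D
    ... | yes _ = refl
    ... | no ¬t = contradiction t ¬t

    off-no : ∀ {D} f → ¬ Triple D → offTriple f D ≡ f D
    off-no {D} f ¬t with triple? D
    ... | yes t = contradiction t ¬t
    ... | no _  = refl

  Σ-triple : ∀ f → Σℤ X f ≡ Σℤ X (offTriple f) + (f A + (f B + f C))
  Σ-triple f = begin
    Σℤ X f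
      ≡⟨ Σ-cong X (λ D → by-cases D (triple? D)) ⟩
    Σℤ X (λ D → offTriple f D + (onlyAt X A f D + (onlyAt X B f D + onlyAt X C f D)))
      ≡⟨ trans (Σ-+ X _ _) (cong (Σℤ X (offTriple f) +_) (trans (Σ-+ X _ _) (cong (Σℤ X (onlyAt X A f) +_) (Σ-+ X _ _)))) ⟩
    Σℤ X (offTriple f) + (Σℤ X (onlyAt X A f) + (Σℤ X (onlyAt X B f) + Σℤ X (onlyAt X C f)))
      ≡⟨ cong (Σℤ X (offTriple f) +_) (cong₂ _+_ (Σ-onlyAt X A f) (cong₂ _+_ (Σ-onlyAt X B f) (Σ-onlyAt X C f))) ⟩
    Σℤ X (offTriple f) + (f A + (f B + f C)) ∎
    where
    open ≡-Reasoning
    four : ∀ D {a b c d} → offTriple f D ≡ a → onlyAt X A f D ≡ b → onlyAt X B f D ≡ c → onlyAt X C f D ≡ d →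
           f D ≡ a + (b + (c + d)) → f D ≡ offTriple f D + (onlyAt X A f D + (onlyAt X B f D + onlyAt X C f D))
    four D refl refl refl refl eq = eq
    1st : ∀ a → a ≡ 0ℤ + (a + (0ℤ + 0ℤ))
    1st = solve-∀
    2nd : ∀ a → a ≡ 0ℤ + (0ℤ + (a + 0ℤ))
    2nd = solve-∀
    3rd : ∀ a → a ≡ 0ℤ + (0ℤ + (0ℤ + a))
    3rd = solve-∀
    0th : ∀ a → a ≡ a + (0ℤ + (0ℤ + 0ℤ))
    0th = solve-∀
    by-cases : ∀ D → Dec (Triple D) → f D ≡ offTriple f D + (onlyAt X A f D + (onlyAt X B f D + onlyAt X C f D))
    by-cases D (yes t@(inj₁ refl)) = four D (off-yes f t) (onlyAt-self X A f) (onlyAt-other X f A≢B) (onlyAt-other X f A≢C) (1st (f D))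
    by-cases D (yes t@(inj₂ (inj₁ refl))) = four D (off-yes f t) (onlyAt-other X f (A≢B ∘ sym)) (onlyAt-self X B f) (onlyAt-other X f B≢C) (2nd (f D))
    by-cases D (yes t@(inj₂ (inj₂ refl))) = four D (off-yes f t) (onlyAt-other X f (A≢C ∘ sym)) (onlyAt-other X f (B≢C ∘ sym)) (onlyAt-self X C f) (3rd (f D))
    by-cases D (no ¬t) = four D (off-no f ¬t) (onlyAt-other X f (¬t ∘ inj₁)) (onlyAt-other X f (¬t ∘ inj₂ ∘ inj₁)) (onlyAt-other X f (¬t ∘ inj₂ ∘ inj₂)) (0th (f D))

  -- The positions p before and q after the third move, which exchanges the entries at
  -- N 0 and N 1, at N 2 and N 3, and at N 4 and N 5.
  record Slide (p q : Occurrence X → ℕ) (N : ℕ → ℕ) : Set where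
    field
      N-step   : ∀ n → N n < N (suc n)
      N₁       : N 1 ≡ suc (N 0)
      N₃       : N 3 ≡ suc (N 2)
      N₅       : N 5 ≡ suc (N 4)
      pA₁      : p (inj₁ A) ≡ N 0
      pB₁      : p (inj₁ B) ≡ N 1
      pA₂      : p (inj₂ A) ≡ N 2
      pC₁      : p (inj₁ C) ≡ N 3
      pB₂      : p (inj₂ B) ≡ N 4
      pC₂      : p (inj₂ C) ≡ N 5
      qB₁      : q (inj₁ B) ≡ N 0
      qA₁      : q (inj₁ A) ≡ N 1
      qC₁      : q (inj₁ C) ≡ N 2
      qA₂      : q (inj₂ A) ≡ N 3
      qC₂      : q (inj₂ C) ≡ N 4
      qB₂      : q (inj₂ B) ≡ N 5
      other    : ∀ o → ¬ Triple (letterOf o) → p o ≡ q o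
      distinct : ∀ o → ¬ Triple (letterOf o) → ∀ {i} → i < 6 → p o ≢ N i

  module _ {p q : Occurrence X → ℕ} {N : ℕ → ℕ} (S : Slide p q N) (ε : Carrier X → ℤ)
           (εA≡εB : ε A ≡ ε B) (εB≡εC : ε B ≡ ε C) where
    open Slide S
    private
      P Q : Diagram
      P = positioned X ε p
      Q = positioned X ε q

      chord-N : ∀ i j k → chord (N i) (N j) (N k) ≡ chord i j k
      chord-N i j k = cong₂ _-_ (order-monotone N (increasing N N-step) k i) (order-monotone N (increasing N N-step) k j)

      module Vector (c : ℤ) (x : Carrier X → ℤ) where
        ex : Carrier X → ℤ
        ex D = ε D * x D

        -- The part of `U` that does not involve `A`, `B`, `C`, as a function of the place. It
        -- serves for `P` and for `Q`, since the other letters do not move.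
        rest : ℕ → ℤ
        rest n = c + Σℤ X (offTriple (λ D → ex D * chord (p (inj₁ D)) (p (inj₂ D)) n))

        U-P : ∀ o → Diagram.U P (c , x) o ≡ rest (p o) +
              (ex A * chord (N 0) (N 2) (p o) + (ex B * chord (N 1) (N 4) (p o) + ex C * chord (N 3) (N 5) (p o)))
        U-P o = trans (U-letters X ε p c x o) (trans (cong (c +_) (Σ-triple _))
          (trans (sym (ℤ.+-assoc c _ _)) (cong (rest (p o) +_)
            (cong₂ _+_ (cong (ex A *_) (cong₂ (λ a b → chord a b (p o)) pA₁ pA₂))
              (cong₂ _+_ (cong (ex B *_) (cong₂ (λ a b → chord a b (p o)) pB₁ pB₂))
                         (cong (ex C *_) (cong₂ (λ a b → chord a b (p o)) pC₁ pC₂)))))))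

        U-Q : ∀ o → Diagram.U Q (c , x) o ≡ rest (q o) +
              (ex A * chord (N 1) (N 3) (q o) + (ex B * chord (N 0) (N 5) (q o) + ex C * chord (N 2) (N 4) (q o)))
        U-Q o = trans (U-letters X ε q c x o) (trans (cong (c +_) (trans (Σ-triple _)
          (cong (_+ _) (Σ-cong X (offTriple-cong λ D ¬t → cong (ex D *_)
            (cong₂ (λ a b → chord a b (q o)) (sym (other (inj₁ D) ¬t)) (sym (other (inj₂ D) ¬t))))))))
          (trans (sym (ℤ.+-assoc c _ _)) (cong (rest (q o) +_)
            (cong₂ _+_ (cong (ex A *_) (cong₂ (λ a b → chord a b (q o)) qA₁ qA₂))
              (cong₂ _+_ (cong (ex B *_) (cong₂ (λ a b → chord a b (q o)) qB₁ qB₂))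
                         (cong (ex C *_) (cong₂ (λ a b → chord a b (q o)) qC₁ qC₂)))))))

        -- No end of another letter occupies either of the two adjacent places, so such ends do not
        -- distinguish them.
        g-adjacent : ∀ i → suc i < 6 → N (suc i) ≡ suc (N i) → rest (N (suc i)) ≡ rest (N i)
        g-adjacent i i<5 eq = cong (c +_) (Σ-cong X (offTriple-cong λ D ¬t → cong (ex D *_)
          (cong₂ _-_ (side (inj₁ D) ¬t) (side (inj₂ D) ¬t))))
          where
          side : ∀ o → ¬ Triple (letterOf o) → order (N (suc i)) (p o) ≡ order (N i) (p o)
          side o ¬t = trans (cong (λ n → order n (p o)) eq) (sym (order-adjacentˡ (distinct o ¬t (ℕ.<-trans (ℕ.n<1+n i) i<5))
            (λ p≡ → distinct o ¬t i<5 (trans p≡ (sym eq)))))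

        at-P : ∀ o k {h} → p o ≡ N k → rest (N k) ≡ h →
               Diagram.U P (c , x) o ≡ h + (ex A * chord 0 2 k + (ex B * chord 1 4 k + ex C * chord 3 5 k))
        at-P o k eq gk = trans (U-P o) (trans (cong (λ n → rest n +
            (ex A * chord (N 0) (N 2) n + (ex B * chord (N 1) (N 4) n + ex C * chord (N 3) (N 5) n))) eq)
          (cong₂ _+_ gk (cong₂ _+_ (cong (ex A *_) (chord-N 0 2 k))
            (cong₂ _+_ (cong (ex B *_) (chord-N 1 4 k)) (cong (ex C *_) (chord-N 3 5 k))))))

        at-Q : ∀ o k {h} → q o ≡ N k → rest (N k) ≡ h →
               Diagram.U Q (c , x) o ≡ h + (ex A * chord 1 3 k + (ex B * chord 0 5 k + ex C * chord 2 4 k))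
        at-Q o k eq gk = trans (U-Q o) (trans (cong (λ n → rest n +
            (ex A * chord (N 1) (N 3) n + (ex B * chord (N 0) (N 5) n + ex C * chord (N 2) (N 4) n))) eq)
          (cong₂ _+_ gk (cong₂ _+_ (cong (ex A *_) (chord-N 1 3 k))
            (cong₂ _+_ (cong (ex B *_) (chord-N 0 5 k)) (cong (ex C *_) (chord-N 2 4 k))))))

        -- Seen from any other place, two adjacent ends lie on the same side, and their exchange is
        -- not noticed.
        U-other : ∀ o → ¬ Triple (letterOf o) → Diagram.U P (c , x) o ≡ Diagram.U Q (c , x) o
        U-other o ¬t = trans (U-P o) (trans
          (cong₂ _+_ (cong rest (other o ¬t)) (cong₂ _+_ (cong (ex A *_) (cong₂ _-_ to₁ to₃))
            (cong₂ _+_ (cong (ex B *_) (cong₂ _-_ (sym to₁) to₅)) (cong (ex C *_) (cong₂ _-_ (sym to₃) (sym to₅))))))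
          (trans (cong (λ n → rest (q o) + (ex A * chord (N 1) (N 3) n + (ex B * chord (N 0) (N 5) n + ex C * chord (N 2) (N 4) n))) (other o ¬t))
          (sym (U-Q o))))
          where
          next : ∀ i → suc i < 6 → N (suc i) ≡ suc (N i) → order (p o) (N i) ≡ order (p o) (N (suc i))
          next i i<5 eq = trans (order-adjacent (distinct o ¬t (ℕ.<-trans (ℕ.n<1+n i) i<5))
            (λ p≡ → distinct o ¬t i<5 (trans p≡ (sym eq)))) (cong (order (p o)) (sym eq))
          to₁ : order (p o) (N 0) ≡ order (p o) (N 1)
          to₁ = next 0 (s≤s (s≤s z≤n)) N₁
          to₃ : order (p o) (N 2) ≡ order (p o) (N 3)
          to₃ = next 2 (s≤s (s≤s (s≤s (s≤s z≤n)))) N₃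
          to₅ : order (p o) (N 4) ≡ order (p o) (N 5)
          to₅ = next 4 ℕ.≤-refl N₅

        g₁ : rest (N 1) ≡ rest (N 0)
        g₁ = g-adjacent 0 (s≤s (s≤s z≤n)) N₁
        g₃ : rest (N 3) ≡ rest (N 2)
        g₃ = g-adjacent 2 (s≤s (s≤s (s≤s (s≤s z≤n)))) N₃
        g₅ : rest (N 5) ≡ rest (N 4)
        g₅ = g-adjacent 4 ℕ.≤-refl N₅

      term : ∀ (D : Diagram) (v v′ : Diagram.Vector D) → Carrier (Diagram.letters D) → ℤ
      term D v v′ L = U v (inj₁ L) * U v′ (inj₂ L) - U v (inj₂ L) * U v′ (inj₁ L)
        where open Diagram D using (U)

      term-cong : ∀ (D : Diagram) v v′ L {a b a′ b′} → Diagram.U D v (inj₁ L) ≡ a → Diagram.U D v (inj₂ L) ≡ b →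
                  Diagram.U D v′ (inj₁ L) ≡ a′ → Diagram.U D v′ (inj₂ L) ≡ b′ → term D v v′ L ≡ a * b′ - b * a′
      term-cong D v v′ L refl refl refl refl = refl

    -- The terms of the other letters agree one by one. Those of `A`, `B`, `C` are compared only in
    -- their sum, after the common `ε` has been taken out: this uses that the three labels are
    -- equal.
    slide-form : ∀ v v′ → Diagram.E P v v′ ≡ Diagram.E Q v v′
    slide-form v@(c , x) v′@(d , y) = begin
      Diagram.E P v v′
        ≡⟨ trans (Ω-letters P (Diagram.U P v) (Diagram.U P v′)) (Σ-triple _) ⟩
      Σℤ X (offTriple (λ D → ε D * term P v v′ D)) + (ε A * term P v v′ A + (ε B * term P v v′ B + ε C * term P v v′ C))
        ≡⟨ cong₂ _+_
             (Σ-cong X (offTriple-cong λ D ¬t → cong (ε D *_)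
               (term-cong P v v′ D (V.U-other (inj₁ D) ¬t) (V.U-other (inj₂ D) ¬t) (W.U-other (inj₁ D) ¬t) (W.U-other (inj₂ D) ¬t))))
             middle ⟩
      Σℤ X (offTriple (λ D → ε D * term Q v v′ D)) + (ε A * term Q v v′ A + (ε B * term Q v v′ B + ε C * term Q v v′ C))
        ≡⟨ trans (Ω-letters Q (Diagram.U Q v) (Diagram.U Q v′)) (Σ-triple _) ⟨
      Diagram.E Q v v′ ∎
      where
      open ≡-Reasoning
      module V = Vector c x
      module W = Vector d y
      factor : ∀ e₁ e₂ e₃ a b c → e₁ ≡ e₂ → e₂ ≡ e₃ → e₁ * a + (e₂ * b + e₃ * c) ≡ e₃ * (a + (b + c))
      factor e₁ e₂ e₃ a b c refl refl = collect e₁ a b c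
        where
        collect : ∀ e a b c → e * a + (e * b + e * c) ≡ e * (a + (b + c))
        collect = solve-∀
      -- The constants are the values `chord i j k` at the places 0 to 5. On the left the chords of
      -- `A`, `B`, `C` are 0-2, 1-4, 3-5, on the right 1-3, 0-5, 2-4. The variables `g` and `h` are
      -- the values of `rest` at the three pairs of adjacent places.
      identity : ∀ g₁ g₂ g₃ h₁ h₂ h₃ a b c a′ b′ c′ →
        ((g₁ + (a * ℤ.+ 1 + (b * ℤ.+ 0 + c * ℤ.+ 0))) * (h₂ + (a′ * ℤ.+ 1 + (b′ * ℤ.+ 2 + c′ * ℤ.+ 0)))
          - (g₂ + (a * ℤ.+ 1 + (b * ℤ.+ 2 + c * ℤ.+ 0))) * (h₁ + (a′ * ℤ.+ 1 + (b′ * ℤ.+ 0 + c′ * ℤ.+ 0))))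
        + (((g₁ + (a * ℤ.+ 2 + (b * ℤ.+ 1 + c * ℤ.+ 0))) * (h₃ + (a′ * ℤ.+ 0 + (b′ * ℤ.+ 1 + c′ * ℤ.+ 2)))
          - (g₃ + (a * ℤ.+ 0 + (b * ℤ.+ 1 + c * ℤ.+ 2))) * (h₁ + (a′ * ℤ.+ 2 + (b′ * ℤ.+ 1 + c′ * ℤ.+ 0))))
        + ((g₂ + (a * ℤ.+ 0 + (b * ℤ.+ 2 + c * ℤ.+ 1))) * (h₃ + (a′ * ℤ.+ 0 + (b′ * ℤ.+ 0 + c′ * ℤ.+ 1)))
          - (g₃ + (a * ℤ.+ 0 + (b * ℤ.+ 0 + c * ℤ.+ 1))) * (h₂ + (a′ * ℤ.+ 0 + (b′ * ℤ.+ 2 + c′ * ℤ.+ 1)))))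
        ≡
        ((g₁ + (a * ℤ.+ 1 + (b * ℤ.+ 2 + c * ℤ.+ 0))) * (h₂ + (a′ * ℤ.+ 1 + (b′ * ℤ.+ 2 + c′ * ℤ.+ 2)))
          - (g₂ + (a * ℤ.+ 1 + (b * ℤ.+ 2 + c * ℤ.+ 2))) * (h₁ + (a′ * ℤ.+ 1 + (b′ * ℤ.+ 2 + c′ * ℤ.+ 0))))
        + (((g₁ + (a * ℤ.+ 0 + (b * ℤ.+ 1 + c * ℤ.+ 0))) * (h₃ + (a′ * ℤ.+ 0 + (b′ * ℤ.+ 1 + c′ * ℤ.+ 0)))
          - (g₃ + (a * ℤ.+ 0 + (b * ℤ.+ 1 + c * ℤ.+ 0))) * (h₁ + (a′ * ℤ.+ 0 + (b′ * ℤ.+ 1 + c′ * ℤ.+ 0))))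
        + ((g₂ + (a * ℤ.+ 2 + (b * ℤ.+ 2 + c * ℤ.+ 1))) * (h₃ + (a′ * ℤ.+ 0 + (b′ * ℤ.+ 2 + c′ * ℤ.+ 1)))
          - (g₃ + (a * ℤ.+ 0 + (b * ℤ.+ 2 + c * ℤ.+ 1))) * (h₂ + (a′ * ℤ.+ 2 + (b′ * ℤ.+ 2 + c′ * ℤ.+ 1)))))
      identity = solve-∀
      middle : ε A * term P v v′ A + (ε B * term P v v′ B + ε C * term P v v′ C) ≡
               ε A * term Q v v′ A + (ε B * term Q v v′ B + ε C * term Q v v′ C)
      middle = begin
        ε A * term P v v′ A + (ε B * term P v v′ B + ε C * term P v v′ C)
          ≡⟨ factor (ε A) (ε B) (ε C) (term P v v′ A) (term P v v′ B) (term P v v′ C) εA≡εB εB≡εC ⟩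
        ε C * (term P v v′ A + (term P v v′ B + term P v v′ C))
          ≡⟨ cong (ε C *_) (trans (cong₂ _+_
               (term-cong P v v′ A (V.at-P (inj₁ A) 0 pA₁ refl) (V.at-P (inj₂ A) 2 pA₂ refl) (W.at-P (inj₁ A) 0 pA₁ refl) (W.at-P (inj₂ A) 2 pA₂ refl))
               (cong₂ _+_
               (term-cong P v v′ B (V.at-P (inj₁ B) 1 pB₁ V.g₁) (V.at-P (inj₂ B) 4 pB₂ refl) (W.at-P (inj₁ B) 1 pB₁ W.g₁) (W.at-P (inj₂ B) 4 pB₂ refl))
               (term-cong P v v′ C (V.at-P (inj₁ C) 3 pC₁ V.g₃) (V.at-P (inj₂ C) 5 pC₂ V.g₅) (W.at-P (inj₁ C) 3 pC₁ W.g₃) (W.at-P (inj₂ C) 5 pC₂ W.g₅))))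
             (trans (identity (V.rest (N 0)) (V.rest (N 2)) (V.rest (N 4)) (W.rest (N 0)) (W.rest (N 2)) (W.rest (N 4))
                      (V.ex A) (V.ex B) (V.ex C) (W.ex A) (W.ex B) (W.ex C))
             (sym (cong₂ _+_
               (term-cong Q v v′ A (V.at-Q (inj₁ A) 1 qA₁ V.g₁) (V.at-Q (inj₂ A) 3 qA₂ V.g₃) (W.at-Q (inj₁ A) 1 qA₁ W.g₁) (W.at-Q (inj₂ A) 3 qA₂ W.g₃))
               (cong₂ _+_
               (term-cong Q v v′ B (V.at-Q (inj₁ B) 0 qB₁ refl) (V.at-Q (inj₂ B) 5 qB₂ V.g₅) (W.at-Q (inj₁ B) 0 qB₁ refl) (W.at-Q (inj₂ B) 5 qB₂ W.g₅))
               (term-cong Q v v′ C (V.at-Q (inj₁ C) 2 qC₁ refl) (V.at-Q (inj₂ C) 4 qC₂ refl) (W.at-Q (inj₁ C) 2 qC₁ refl) (W.at-Q (inj₂ C) 4 qC₂ refl))))))) ⟩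
        ε C * (term Q v v′ A + (term Q v v′ B + term Q v v′ C))
          ≡⟨ factor (ε A) (ε B) (ε C) (term Q v v′ A) (term Q v v′ B) (term Q v v′ C) εA≡εB εB≡εC ⟨
        ε A * term Q v v′ A + (ε B * term Q v v′ B + ε C * term Q v v′ C) ∎

-- Homotopy moves and bridge moves

⊆-map : ∀ {X Y : Set} {f : X → Y} us {zs ys} → map f us ≡ zs → zs ⊆ ys → Sublist (λ x y → f x ≡ y) us ys
⊆-map []       refl sub          = empty sub
  where
  empty : ∀ {ys} → [] ⊆ ys → Sublist _ [] ys
  empty []         = []
  empty (y ∷ʳ sub) = y ∷ʳ empty sub
⊆-map (u ∷ us) refl (y ∷ʳ sub)   = y ∷ʳ ⊆-map (u ∷ us) refl sub
⊆-map (u ∷ us) refl (eq ∷ sub)   = eq ∷ ⊆-map us refl sub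

nth-∈ : ∀ {X : Set} (xs : List X) {n A} → nth xs n ≡ just A → A ∈ xs
nth-∈ (x ∷ xs) {zero}  refl = here refl
nth-∈ (x ∷ xs) {suc n} eq   = there (nth-∈ xs eq)

module _ {X : Set} where

  wordStart : ∀ k → (Fin (suc k) → List X) → (Fin k → List X) → Fin k → ℕ
  wordStart (suc k) x v zero    = length (x zero)
  wordStart (suc k) x v (suc t) = length (x zero) ℕ.+ (length (v zero) ℕ.+ wordStart k (x ∘ suc) (v ∘ suc) t)

  nth-interleave : ∀ k x v t {j A} → nth (v t) j ≡ just A → nth (interleave k x v) (wordStart k x v t ℕ.+ j) ≡ just A
  nth-interleave (suc k) x v zero {j} eq = trans (nth-++ʳ (x zero) _ j) (trans (nth-++ˡ (v zero) _ (nth-bound (v zero) eq)) eq)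
  nth-interleave (suc k) x v (suc t) {j} eq = trans
    (cong (nth (interleave (suc k) x v)) (trans (ℕ.+-assoc (length (x zero)) _ j)
      (cong (length (x zero) ℕ.+_) (ℕ.+-assoc (length (v zero)) _ j))))
    (trans (nth-++ʳ (x zero) _ _) (trans (nth-++ʳ (v zero) _ _) (nth-interleave k (x ∘ suc) (v ∘ suc) t eq)))

  wordStart-disjoint : ∀ k x v {t u} → t Fin.< u → wordStart k x v t ℕ.+ length (v t) ≤ wordStart k x v u
  wordStart-disjoint (suc k) x v {zero} {suc u} _ = ℕ.+-monoʳ-≤ (length (x zero)) (ℕ.m≤m+n (length (v zero)) _)
  wordStart-disjoint (suc k) x v {suc t} {suc u} (s≤s t<u) =
    subst (_≤ wordStart (suc k) x v (suc u))
      (sym (trans (ℕ.+-assoc (length (x zero)) _ _) (cong (length (x zero) ℕ.+_) (ℕ.+-assoc (length (v zero)) _ _))))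
      (ℕ.+-monoʳ-≤ (length (x zero)) (ℕ.+-monoʳ-≤ (length (v zero)) (wordStart-disjoint k (x ∘ suc) (v ∘ suc) t<u)))

  nth-++-cases : ∀ (xs : List X) ys {n A} → nth (xs ++ ys) n ≡ just A →
                 nth xs n ≡ just A ⊎ ∃[ m ] n ≡ length xs ℕ.+ m × nth ys m ≡ just A
  nth-++-cases []       ys {n} eq       = inj₂ (n , refl , eq)
  nth-++-cases (x ∷ xs) ys {zero} eq    = inj₁ eq
  nth-++-cases (x ∷ xs) ys {suc n} eq   = Sum.map₂ (λ (m , n≡ , at) → m , cong suc n≡ , at) (nth-++-cases xs ys eq)

  interleave-cases : ∀ k x v {n A} → nth (interleave k x v) n ≡ just A →
                     (∃[ r ] A ∈ x r) ⊎ (∃[ t ] ∃[ j ] n ≡ wordStart k x v t ℕ.+ j × nth (v t) j ≡ just A)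
  interleave-cases zero    x v eq = inj₁ (zero , nth-∈ (x zero) eq)
  interleave-cases (suc k) x v eq with nth-++-cases (x zero) _ eq
  ... | inj₁ at = inj₁ (zero , nth-∈ (x zero) at)
  ... | inj₂ (m , refl , at) with nth-++-cases (v zero) _ at
  ...   | inj₁ at′ = inj₂ (zero , m , refl , at′)
  ...   | inj₂ (m′ , refl , at′) with interleave-cases k (x ∘ suc) (v ∘ suc) at′
  ...     | inj₁ (r , ∈) = inj₁ (suc r , ∈)
  ...     | inj₂ (t , j , refl , at″) = inj₂ (suc t , j ,
              sym (trans (ℕ.+-assoc (length (x zero)) _ j) (cong (length (x zero) ℕ.+_) (ℕ.+-assoc (length (v zero)) _ j))) , at″)

  concat-⊆-interleave : ∀ k x v → concat (tabulate x) ⊆ interleave k x v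
  concat-⊆-interleave zero    x v = subst (_⊆ x zero) (sym (List.++-identityʳ (x zero))) (⊆-refl {A = X})
  concat-⊆-interleave (suc k) x v = ++⁺ {A = X} (⊆-refl {A = X} {x zero}) (++⁺ˡ {A = X} (v zero) (concat-⊆-interleave k (x ∘ suc) (v ∘ suc)))

module _ {a} {α : Set a} (τ : α → α) {w v : Nanoword α} where

  -- An isomorphism deletes nothing: the list of words is empty.
  isomorphism-reversal : w ≅ v → WordReversal τ w v
  isomorphism-reversal iso = record
    { incl = from ; injective = λ {A} {B} eq → trans (sym (to-from A)) (trans (cong to eq) (to-from B))
    ; projection = λ A → trans (sym (projection (from A))) (cong (Nanoword.∣_∣ v) (to-from A))
    ; embed = subst (λ l → Sublist (λ A B → from A ≡ B) l (word w)) (sym relabelled) (embed (word w))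
    ; k = 0 ; κ = λ () ; κκ = λ () ; start = λ () ; V = λ () ; V-at = λ () ; disjoint = λ {}
    ; locate = λ o → inj₁ (to (letterOf o) , from-to (letterOf o))
    ; V-deleted = λ () ; ι = id ; ι-reverse = λ () ; mirror = λ A ()
    }
    where
    open _≅_ iso
    open Inverse bijection using (to; from)
    to-from : ∀ A → to (from A) ≡ A
    to-from A = Inverse.inverseˡ bijection refl
    from-to : ∀ A → from (to A) ≡ A
    from-to A = Inverse.inverseʳ bijection refl
    embed : ∀ ys → Sublist (λ A B → from A ≡ B) (map to ys) ys
    embed []       = []
    embed (y ∷ ys) = from-to y ∷ embed ys

  module _ {ℬ} (sub : v IsAlphabetOf w Minus ℬ) where
    open _IsAlphabetOf_Minus_ sub

    kept : ∀ {A} → ¬ ℬ A → ∃[ B ] incl B ≡ A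
    kept = Equivalence.from (image _)

    deleted : ∀ {A} → ℬ A → ∀ B → incl B ≢ A
    deleted b B eq = Equivalence.to (image _) (B , eq) b

  module _ (m : BridgeMove τ w v) where
    open BridgeMove m using (sub) renaming (bridge to theBridge; deleted to deletedWord)
    open Bridge theBridge using (isBridge; quasiBridge)
    open QuasiBridge quasiBridge renaming (v to V)
    open Nanoword w using (∣_∣)
    private
      start : Fin k → ℕ
      start = wordStart k x V

      V-at : ∀ t {j A} → nth (V t) j ≡ just A → nth (word w) (start t ℕ.+ j) ≡ just A
      V-at t {j} eq = trans (cong (λ l → nth l (start t ℕ.+ j)) factorise) (nth-interleave k x V t eq)

      V-ℬ : ∀ t {j A} → nth (V t) j ≡ just A → ℬ A
      V-ℬ t eq = v-in-ℬ t (nth-∈ (V t) eq)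

      cases : ∀ {n A} → nth (word w) n ≡ just A → (¬ ℬ A) ⊎ (∃[ t ] ∃[ j ] n ≡ start t ℕ.+ j × nth (V t) j ≡ just A)
      cases {n} eq = Sum.map₁ (λ (r , ∈) → x-not-ℬ r ∈) (interleave-cases k x V (trans (cong (λ l → nth l n) (sym factorise)) eq))

      len-κ : ∀ t → length (V t) ≡ length (V (κ t))
      len-κ t = trans (sym (List.length-map ι (V t))) (trans (cong length (ι-reverse t)) (List.length-reverse (V (κ t))))

      place : Position → ℕ
      place (t , j) = start t ℕ.+ toℕ j

      place-letter : ∀ p → nth (word w) (place p) ≡ just (letter p)
      place-letter (t , j) = V-at t (nth-lookup (V t) j)

      place-< : ∀ {p q} → p ≺ q → place p < place q
      place-< {t , i} {u , j} (inj₁ t<u) = ℕ.<-≤-trans (ℕ.+-monoʳ-< (start t) (Fin.toℕ<n i))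
        (ℕ.≤-trans (wordStart-disjoint k x V t<u) (ℕ.m≤m+n (start u) (toℕ j)))
      place-< {t , i} {u , j} (inj₂ (refl , i<j)) = ℕ.+-monoʳ-< (start t) i<j

      place-reflects-< : ∀ {p q} → place p < place q → p ≺ q
      place-reflects-< {t , i} {u , j} lt with Fin.<-cmp t u
      ... | tri< t<u _ _ = inj₁ t<u
      ... | tri≈ _ refl _ = inj₂ (refl , ℕ.+-cancelˡ-< (start t) _ _ lt)
      ... | tri> _ _ u<t = contradiction (place-< {u , j} {t , i} (inj₁ u<t)) (ℕ.<-asym lt)

      leftmost : ∀ {A p} → place p ≡ pos w (inj₁ A) → LeftmostOccurrence A p
      leftmost {A} {p} eq = Maybe.just-injective (trans (sym (place-letter p)) (trans (cong (nth (word w)) eq) (nth-pos w (inj₁ A))))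
        , λ q at q≺p → earlier q at (subst (place q <_) eq (place-< q≺p))
        where
        earlier : ∀ q → letter q ≡ A → ¬ place q < pos w (inj₁ A)
        earlier q at lt with pos-cover w (trans (place-letter q) (cong just at))
        ... | inj₁ eq′ = ℕ.<-irrefl eq′ lt
        ... | inj₂ eq′ = ℕ.<-asym (pos-< w A) (subst (_< pos w (inj₁ A)) eq′ lt)

      positionOf : ∀ {t n A} → nth (V t) n ≡ just A → ∃[ j ] place (t , j) ≡ start t ℕ.+ n × toℕ j ≡ n
      positionOf {t} eq = let j , j≡ , _ = nth-Fin (V t) eq in j , cong (start t ℕ.+_) j≡ , j≡

      -- The occurrence of `ι A` at the mirror place is its first or its last one. Accordingly it is
      -- leftmost or not, which determines ε and thereby the label.
      mirror : ∀ A t j → pos w (inj₁ A) ≡ start t ℕ.+ j → j < length (V t) →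
               (pos w (inj₁ (ι A)) ≡ start (κ t) ℕ.+ (length (V t) ∸ suc j) × ∣ ι A ∣ ≡ τ ∣ A ∣) ⊎
               (pos w (inj₂ (ι A)) ≡ start (κ t) ℕ.+ (length (V t) ∸ suc j) × ∣ ι A ∣ ≡ ∣ A ∣)
      mirror A t j eq j< = by-cases (pos-cover w (V-at (κ t) at-q))
        where
        at-p : nth (V t) j ≡ just A
        at-p = let B , at = nth-total (V t) j< in
          trans at (trans (sym (V-at t at)) (trans (cong (nth (word w)) (sym eq)) (nth-pos w (inj₁ A))))
        at-q : nth (V (κ t)) (length (V t) ∸ suc j) ≡ just (ι A)
        at-q = nth-opposite (V t) (V (κ t)) (ι-reverse t) (len-κ t) at-p
        p q : Position
        p = t , proj₁ (positionOf at-p)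
        q = κ t , proj₁ (positionOf at-q)
        p-leftmost : LeftmostOccurrence A p
        p-leftmost = leftmost (trans (proj₁ (proj₂ (positionOf at-p))) (sym eq))
        symmetric : Symmetric p q
        symmetric = refl , trans (cong₂ (λ m n → suc (m ℕ.+ n)) (proj₂ (proj₂ (positionOf at-p))) (proj₂ (proj₂ (positionOf at-q))))
          (ℕ.m+[n∸m]≡n j<)
        place-q : place q ≡ start (κ t) ℕ.+ (length (V t) ∸ suc j)
        place-q = proj₁ (proj₂ (positionOf at-q))
        n = start (κ t) ℕ.+ (length (V t) ∸ suc j)
        by-cases : n ≡ pos w (inj₁ (ι A)) ⊎ n ≡ pos w (inj₂ (ι A)) →
                   (pos w (inj₁ (ι A)) ≡ n × ∣ ι A ∣ ≡ τ ∣ A ∣) ⊎ (pos w (inj₂ (ι A)) ≡ n × ∣ ι A ∣ ≡ ∣ A ∣)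
        by-cases (inj₁ eq′) = inj₁ (sym eq′ , isBridge A (V-ℬ t at-p) 1
          (one p q p-leftmost symmetric (leftmost (trans place-q eq′))))
        by-cases (inj₂ eq′) = inj₂ (sym eq′ , isBridge A (V-ℬ t at-p) 0
          (zero p q p-leftmost symmetric λ (_ , first) → not-first first (cases (nth-pos w (inj₁ (ι A))))))
          where
          -- As `ι A` lies in `ℬ`, its first occurrence in `w` belongs to a word of the bridge. It
          -- precedes `q`, which is the last one.
          not-first : (∀ r → letter r ≡ ι A → ¬ (r ≺ q)) →
            ¬ ((¬ ℬ (ι A)) ⊎ (∃[ u ] ∃[ i ] pos w (inj₁ (ι A)) ≡ start u ℕ.+ i × nth (V u) i ≡ just (ι A)))
          not-first first (inj₁ ¬ℬ) = ¬ℬ (ι-in-ℬ A (V-ℬ t at-p))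
          not-first first (inj₂ (u , i , eq₁ , at-r)) =
            let j′ , place-r , _ = positionOf at-r
            in first (u , j′)
                 (Maybe.just-injective (trans (sym (nth-lookup (V u) j′)) (trans (cong (nth (V u)) (proj₂ (proj₂ (positionOf at-r)))) at-r)))
                 (place-reflects-< {u , j′} {q} (subst₂ _<_ (trans eq₁ (sym place-r)) (trans (sym eq′) (sym place-q)) (pos-< w (ι A))))

    bridge-reversal : WordReversal τ w v
    bridge-reversal = record
      { incl = _IsAlphabetOf_Minus_.incl sub ; injective = _IsAlphabetOf_Minus_.injective sub
      ; projection = _IsAlphabetOf_Minus_.projection sub
      ; embed = ⊆-map (word v) deletedWord (subst (concat (tabulate x) ⊆_) (sym factorise) (concat-⊆-interleave k x V))
      ; k = k ; κ = κ ; κκ = κ-involutive ; start = start ; V = V ; V-at = V-at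
      ; disjoint = wordStart-disjoint k x V
      ; locate = λ o → Sum.map (kept sub) (λ (t , j , eq , at) → t , j , eq , nth-bound (V t) at) (cases (nth-pos w o))
      ; V-deleted = λ t eq → deleted sub (V-ℬ t eq)
      ; ι = ι ; ι-reverse = ι-reverse ; mirror = mirror
      }

open _IsAlphabetOf_Minus_ using (incl)

nth-drop : ∀ {X : Set} {l : List X} xs ys → l ≡ xs ++ ys → ∀ n → nth l (length xs ℕ.+ n) ≡ nth ys n
nth-drop xs ys refl = nth-++ʳ xs ys

nth-++-just : ∀ {X : Set} (xs ys : List X) n {A} → nth xs n ≡ just A → nth (xs ++ ys) n ≡ just A
nth-++-just xs ys n eq = trans (nth-++ˡ xs ys {n} (nth-bound xs {n} eq)) eq

module _ {a} {α : Set a} (w : Nanoword α) where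

  letter-at : ∀ {n o A} → pos w o ≡ n → nth (word w) n ≡ just A → letterOf o ≡ A
  letter-at {o = o} refl at = Maybe.just-injective (trans (sym (nth-pos w o)) at)

module _ {a} {α : Set a} (τ : α → α) (ττ : Involutive _≡_ τ) {w v : Nanoword α} where
  open Nanoword w using (∣_∣; alphabet)

  module _ (x : List (Letter w)) (A : Letter w) (y : List (Letter w)) (w≡ : word w ≡ x ++ A ∷ A ∷ y)
           (sub : v IsAlphabetOf w Minus (λ D → D ≡ A)) (v≡ : map (incl sub) (word v) ≡ x ++ y) where
    open _IsAlphabetOf_Minus_ sub using (injective; projection)
    private
      n₀ = length x

      V : List (Letter w)
      V = A ∷ A ∷ []

      V-at : ∀ j {B} → nth V j ≡ just B → nth (word w) (n₀ ℕ.+ j) ≡ just B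
      V-at j eq = trans (nth-drop x (A ∷ A ∷ y) w≡ j) (nth-++-just V y j eq)

      V-A : ∀ j {B} → nth V j ≡ just B → B ≡ A
      V-A zero       refl = refl
      V-A (suc zero) refl = refl

      first-last : pos w (inj₁ A) ≡ n₀ ℕ.+ 0 × pos w (inj₂ A) ≡ n₀ ℕ.+ 1
      first-last = pinned w (ℕ.+-monoʳ-< n₀ (s≤s z≤n)) (V-at 0 refl) (V-at 1 refl)

      locate : ∀ o → Dec (letterOf o ≡ A) → (∃[ B ] incl sub B ≡ letterOf o) ⊎
               (Σ (Fin 1) λ _ → ∃[ j ] pos w o ≡ n₀ ℕ.+ j × j < 2)
      locate o        (no ≢)     = inj₁ (kept τ {w} {v} sub ≢)
      locate (inj₁ A) (yes refl) = inj₂ (zero , 0 , proj₁ first-last , s≤s z≤n)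
      locate (inj₂ A) (yes refl) = inj₂ (zero , 1 , proj₂ first-last , s≤s (s≤s z≤n))

      mirror : ∀ B (t : Fin 1) j → pos w (inj₁ B) ≡ n₀ ℕ.+ j → j < 2 →
               (pos w (inj₁ B) ≡ n₀ ℕ.+ (2 ∸ suc j) × ∣ B ∣ ≡ τ ∣ B ∣) ⊎
               (pos w (inj₂ B) ≡ n₀ ℕ.+ (2 ∸ suc j) × ∣ B ∣ ≡ ∣ B ∣)
      mirror B t zero eq _ with letter-at w {o = inj₁ B} eq (V-at 0 refl)
      ... | refl = inj₂ (proj₂ first-last , refl)
      mirror B t (suc zero) eq _ with letter-at w {o = inj₁ B} eq (V-at 1 refl)
      ... | refl = contradiction (ℕ.+-cancelˡ-≡ n₀ 0 1 (trans (sym (proj₁ first-last)) eq)) λ ()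
      mirror B t (suc (suc j)) eq (s≤s (s≤s ()))

    -- The single word AA is reflected onto itself with `ι` the identity. The first occurrence goes
    -- to the last one, so no condition on the label arises.
    move₁-reversal : WordReversal τ w v
    move₁-reversal = record
      { incl = incl sub ; injective = injective ; projection = projection
      ; embed = ⊆-map (word v) v≡ (subst (x ++ y ⊆_) (sym w≡) (++⁺ (⊆-refl {x = x}) (++⁺ˡ V ⊆-refl)))
      ; k = 1 ; κ = id ; κκ = λ _ → refl ; start = const n₀ ; V = const V ; V-at = λ _ {j} → V-at j
      ; disjoint = λ { {zero} {zero} () }
      ; locate = λ o → locate o (FiniteSet._≟_ alphabet (letterOf o) A)
      ; V-deleted = λ _ {j} eq B → deleted τ {w} {v} sub (V-A j eq) B
      ; ι = id ; ι-reverse = λ _ → refl ; mirror = mirror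
      }

  module _ (x : List (Letter w)) (A B : Letter w) (y z : List (Letter w))
           (w≡ : word w ≡ x ++ A ∷ B ∷ y ++ B ∷ A ∷ z) (label : ∣ B ∣ ≡ τ ∣ A ∣)
           (sub : v IsAlphabetOf w Minus (λ D → D ≡ A ⊎ D ≡ B)) (v≡ : map (incl sub) (word v) ≡ x ++ y ++ z) where
    open _IsAlphabetOf_Minus_ sub using (injective; projection)
    private
      n₀ n₁ : ℕ
      n₀ = length x
      n₁ = length x ℕ.+ (2 ℕ.+ length y)

      start : Fin 2 → ℕ
      start zero       = n₀
      start (suc zero) = n₁

      V : Fin 2 → List (Letter w)
      V zero       = A ∷ B ∷ []
      V (suc zero) = B ∷ A ∷ []

      V-at : ∀ t j {C} → nth (V t) j ≡ just C → nth (word w) (start t ℕ.+ j) ≡ just C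
      V-at zero j eq = trans (nth-drop x (A ∷ B ∷ y ++ B ∷ A ∷ z) w≡ j) (nth-++-just (A ∷ B ∷ []) (y ++ B ∷ A ∷ z) j eq)
      V-at (suc zero) j eq = trans (cong (nth (word w)) (ℕ.+-assoc n₀ (2 ℕ.+ length y) j))
        (trans (nth-drop x (A ∷ B ∷ y ++ B ∷ A ∷ z) w≡ (2 ℕ.+ (length y ℕ.+ j)))
          (trans (nth-++ʳ y (B ∷ A ∷ z) j) (nth-++-just (B ∷ A ∷ []) z j eq)))

      n₀<n₁ : n₀ ℕ.+ 2 ≤ n₁
      n₀<n₁ = ℕ.+-monoʳ-≤ n₀ (ℕ.m≤m+n 2 (length y))

      posA : pos w (inj₁ A) ≡ n₀ ℕ.+ 0 × pos w (inj₂ A) ≡ n₁ ℕ.+ 1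
      posA = pinned w (ℕ.<-≤-trans (ℕ.+-monoʳ-< n₀ (s≤s z≤n)) (ℕ.≤-trans n₀<n₁ (ℕ.m≤m+n n₁ 1)))
        (V-at zero 0 refl) (V-at (suc zero) 1 refl)

      posB : pos w (inj₁ B) ≡ n₀ ℕ.+ 1 × pos w (inj₂ B) ≡ n₁ ℕ.+ 0
      posB = pinned w (ℕ.<-≤-trans (ℕ.+-monoʳ-< n₀ (s≤s (s≤s z≤n))) (ℕ.≤-trans n₀<n₁ (ℕ.m≤m+n n₁ 0)))
        (V-at zero 1 refl) (V-at (suc zero) 0 refl)

      A≢B : A ≢ B
      A≢B refl = contradiction (ℕ.+-cancelˡ-≡ n₀ 0 1 (trans (sym (proj₁ posA)) (proj₁ posB))) λ ()

      early : ∀ {i j} → i < 2 → n₁ ℕ.+ j ≢ n₀ ℕ.+ i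
      early {j = j} i<2 eq = ℕ.<⇒≱ (ℕ.<-≤-trans (ℕ.+-monoʳ-< n₀ i<2) n₀<n₁) (subst (n₁ ≤_) eq (ℕ.m≤m+n n₁ j))

      V-AB : ∀ t j {C} → nth (V t) j ≡ just C → C ≡ A ⊎ C ≡ B
      V-AB zero       zero       refl = inj₁ refl
      V-AB zero       (suc zero) refl = inj₂ refl
      V-AB (suc zero) zero       refl = inj₂ refl
      V-AB (suc zero) (suc zero) refl = inj₁ refl

      exchange : ∀ D → Dec (D ≡ A) → Dec (D ≡ B) → Letter w
      exchange D (yes _) _       = B
      exchange D (no _)  (yes _) = A
      exchange D (no _)  (no _)  = D

      _≟_ = FiniteSet._≟_ alphabet

      ι : Letter w → Letter w
      ι D = exchange D (D ≟ A) (D ≟ B)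

      ιA : ι A ≡ B
      ιA = by-cases (A ≟ A) (A ≟ B)
        where
        by-cases : ∀ p q → exchange A p q ≡ B
        by-cases (yes _) q = refl
        by-cases (no ≢)  q = contradiction refl ≢

      ιB : ι B ≡ A
      ιB = by-cases (B ≟ A) (B ≟ B)
        where
        by-cases : ∀ p q → exchange B p q ≡ A
        by-cases (yes eq) q       = contradiction (sym eq) A≢B
        by-cases (no _)   (yes _) = refl
        by-cases (no _)   (no ≢)  = contradiction refl ≢

      locate : ∀ o → Dec (letterOf o ≡ A) → Dec (letterOf o ≡ B) → (∃[ B ] incl sub B ≡ letterOf o) ⊎
               (∃[ t ] ∃[ j ] pos w o ≡ start t ℕ.+ j × j < length (V t))
      locate o        (no ≢A)    (no ≢B)    = inj₁ (kept τ {w} {v} sub [ ≢A , ≢B ]′)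
      locate (inj₁ A) (yes refl) _          = inj₂ (zero , 0 , proj₁ posA , s≤s z≤n)
      locate (inj₂ A) (yes refl) _          = inj₂ (suc zero , 1 , proj₂ posA , s≤s (s≤s z≤n))
      locate (inj₁ B) (no _)     (yes refl) = inj₂ (zero , 1 , proj₁ posB , s≤s (s≤s z≤n))
      locate (inj₂ B) (no _)     (yes refl) = inj₂ (suc zero , 0 , proj₂ posB , s≤s z≤n)

      Mirror : Letter w → Letter w → ℕ → Set a
      Mirror C C′ n = (pos w (inj₁ C′) ≡ n × ∣ C′ ∣ ≡ τ ∣ C ∣) ⊎ (pos w (inj₂ C′) ≡ n × ∣ C′ ∣ ≡ ∣ C ∣)

      mirror : ∀ C t j → pos w (inj₁ C) ≡ start t ℕ.+ j → j < length (V t) →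
               Mirror C (ι C) (start t ℕ.+ (length (V t) ∸ suc j))
      mirror C zero zero eq _ with letter-at w {o = inj₁ C} eq (V-at zero 0 refl)
      ... | refl = subst (λ D → Mirror A D (n₀ ℕ.+ 1)) (sym ιA) (inj₁ (proj₁ posB , label))
      mirror C zero (suc zero) eq _ with letter-at w {o = inj₁ C} eq (V-at zero 1 refl)
      ... | refl = subst (λ D → Mirror B D (n₀ ℕ.+ 0)) (sym ιB) (inj₁ (proj₁ posA , trans (sym (ττ ∣ A ∣)) (cong τ (sym label))))
      mirror C (suc zero) zero eq _ with letter-at w {o = inj₁ C} eq (V-at (suc zero) 0 refl)
      ... | refl = contradiction (trans (sym eq) (proj₁ posB)) (early (s≤s (s≤s z≤n)))
      mirror C (suc zero) (suc zero) eq _ with letter-at w {o = inj₁ C} eq (V-at (suc zero) 1 refl)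
      ... | refl = contradiction (trans (sym eq) (proj₁ posA)) (early (s≤s z≤n))
      mirror C zero       (suc (suc j)) eq (s≤s (s≤s ()))
      mirror C (suc zero) (suc (suc j)) eq (s≤s (s≤s ()))

      ι-reverse : ∀ t → map ι (V t) ≡ reverse (V t)
      ι-reverse zero       = cong₂ (λ C D → C ∷ D ∷ []) ιA ιB
      ι-reverse (suc zero) = cong₂ (λ C D → C ∷ D ∷ []) ιB ιA

    -- The words AB and BA are each reflected onto themselves, and `ι` exchanges the two letters.
    -- First occurrences go to first occurrences, so the condition on labels is the one of the move.
    move₂-reversal : WordReversal τ w v
    move₂-reversal = record
      { incl = incl sub ; injective = injective ; projection = projection
      ; embed = ⊆-map (word v) v≡ (subst (x ++ y ++ z ⊆_) (sym w≡)
          (++⁺ (⊆-refl {x = x}) (++⁺ˡ (A ∷ B ∷ []) (++⁺ (⊆-refl {x = y}) (++⁺ˡ (B ∷ A ∷ []) ⊆-refl)))))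
      ; k = 2 ; κ = id ; κκ = λ _ → refl ; start = start ; V = V ; V-at = λ t {j} → V-at t j
      ; disjoint = λ { {zero} {suc zero} _ → n₀<n₁ ; {suc zero} {zero} () ; {suc zero} {suc zero} (s≤s ()) }
      ; locate = λ o → locate o (letterOf o ≟ A) (letterOf o ≟ B)
      ; V-deleted = λ t {j} eq C → deleted τ {w} {v} sub (V-AB t j eq) C
      ; ι = ι ; ι-reverse = ι-reverse ; mirror = mirror
      }

-- Relabelling, and the third move between nanowords

relabel-form : ∀ (D D′ : Diagram) (let module D = Diagram D ; module D′ = Diagram D′)
               (f : Carrier D′.letters → Carrier D.letters) (f⁻¹ : Carrier D.letters → Carrier D′.letters) →
               (∀ A → f (f⁻¹ A) ≡ A) → Injective _≡_ _≡_ f → (∀ A → D.ε (f A) ≡ D′.ε A) →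
               (∀ o p → D.sgn (Sum.map f f o) (Sum.map f f p) ≡ D′.sgn o p) →
               ∀ c d x y → D.E (c , x) (d , y) ≡ D′.E (c , x ∘ f) (d , y ∘ f)
relabel-form D D′ f f⁻¹ ff⁻¹ f-injective ε-f sgn-f c d x y = begin
  D.E (c , x) (d , y)
    ≡⟨ Σ-image D.occurrences D′.occurrences (λ {o} {p} → inc-injective o p) (λ o → inj₂ (preimage o)) ⟩
  Σℤ D′.occurrences (λ o → D.ψ (inc o) * (D.U (c , x) (inc o) * D.U (d , y) (swap (inc o))))
    ≡⟨ (Σ-cong D′.occurrences λ o → cong₂ _*_ (ψ-inc o)
         (cong₂ _*_ (U-inc c x o) (trans (cong (D.U (d , y)) (swap-inc f o)) (U-inc d y (swap o))))) ⟩
  D′.E (c , x ∘ f) (d , y ∘ f) ∎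
  where
  open ≡-Reasoning
  module D = Diagram D
  module D′ = Diagram D′
  inc : Occurrence D′.letters → Occurrence D.letters
  inc = Sum.map f f
  inc-injective : ∀ o p → inc o ≡ inc p → o ≡ p
  inc-injective (inj₁ A) (inj₁ B) eq = cong inj₁ (f-injective (Sum.inj₁-injective eq))
  inc-injective (inj₂ A) (inj₂ B) eq = cong inj₂ (f-injective (Sum.inj₂-injective eq))
  preimage : ∀ o → ∃[ p ] inc p ≡ o
  preimage (inj₁ A) = inj₁ (f⁻¹ A) , cong inj₁ (ff⁻¹ A)
  preimage (inj₂ A) = inj₂ (f⁻¹ A) , cong inj₂ (ff⁻¹ A)
  ψ-inc : ∀ o → D.ψ (inc o) ≡ D′.ψ o
  ψ-inc (inj₁ A) = ε-f A
  ψ-inc (inj₂ A) = cong -_ (ε-f A)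
  letter-inc : ∀ o → letterOf (inc o) ≡ f (letterOf o)
  letter-inc (inj₁ A) = refl
  letter-inc (inj₂ A) = refl
  U-inc : ∀ c x o → D.U (c , x) (inc o) ≡ D′.U (c , x ∘ f) o
  U-inc c x o = cong (c +_) (trans
    (Σ-image D.occurrences D′.occurrences (λ {o} {p} → inc-injective o p) (λ o → inj₂ (preimage o)))
    (Σ-cong D′.occurrences λ p → cong₂ _*_ (cong₂ _*_ (ψ-inc p) (cong x (letter-inc p))) (sgn-f o p)))

module _ {X : Set} {D : X} where

  swap-adjacent : ∀ xs {a b r r′} → D ≢ a → D ≢ b → (∀ n → nth r n ≡ just D → nth r′ n ≡ just D) →
                  ∀ n → nth (xs ++ a ∷ b ∷ r) n ≡ just D → nth (xs ++ b ∷ a ∷ r′) n ≡ just D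
  swap-adjacent []       D≢a D≢b rest zero          eq = contradiction (sym (Maybe.just-injective eq)) D≢a
  swap-adjacent []       D≢a D≢b rest (suc zero)    eq = contradiction (sym (Maybe.just-injective eq)) D≢b
  swap-adjacent []       D≢a D≢b rest (suc (suc n)) eq = rest n eq
  swap-adjacent (x ∷ xs) D≢a D≢b rest zero          eq = eq
  swap-adjacent (x ∷ xs) D≢a D≢b rest (suc n)       eq = swap-adjacent xs D≢a D≢b rest n eq

module _ {a} {α : Set a} (τ : α → α) (ττ : Involutive _≡_ τ) (sign : α → ℤ) {w v : Nanoword α} where
  open Nanoword w using (∣_∣; alphabet)

  module _ (x : List (Letter w)) (A B : Letter w) (y : List (Letter w)) (C : Letter w) (z t : List (Letter w))
           (w≡ : word w ≡ x ++ A ∷ B ∷ y ++ A ∷ C ∷ z ++ B ∷ C ∷ t)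
           (A≢B : A ≢ B) (A≢C : A ≢ C) (B≢C : B ≢ C) (A~B : ∣ A ∣ ≡ ∣ B ∣) (B~C : ∣ B ∣ ≡ ∣ C ∣)
           (sub : v IsAlphabetOf w Minus (λ _ → ⊥))
           (v≡ : map (incl sub) (word v) ≡ x ++ B ∷ A ∷ y ++ C ∷ A ∷ z ++ C ∷ B ∷ t) where
    open _IsAlphabetOf_Minus_ sub using (injective; projection)
    private
      back : Letter w → Letter v
      back D = proj₁ (kept τ {w} {v} sub {D} id)

      incl-back : ∀ D → incl sub (back D) ≡ D
      incl-back D = proj₂ (kept τ {w} {v} sub {D} id)

      W W′ : List (Letter w)
      W = x ++ A ∷ B ∷ y ++ A ∷ C ∷ z ++ B ∷ C ∷ t
      W′ = x ++ B ∷ A ∷ y ++ C ∷ A ∷ z ++ C ∷ B ∷ t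

      M N : ℕ → ℕ
      M 0 = 0
      M 1 = 1
      M 2 = 2 ℕ.+ (length y ℕ.+ 0)
      M 3 = 2 ℕ.+ (length y ℕ.+ 1)
      M 4 = 2 ℕ.+ (length y ℕ.+ (2 ℕ.+ (length z ℕ.+ 0)))
      -- The places that move are `N 0` to `N 5`. The sequence is continued so that it increases
      -- strictly on all of ℕ, as `Slide` demands.
      M (suc (suc (suc (suc (suc n))))) = 2 ℕ.+ (length y ℕ.+ (2 ℕ.+ (length z ℕ.+ suc n)))
      N n = length x ℕ.+ M n

      M-step : ∀ n → M n < M (suc n)
      M-step 0 = s≤s z≤n
      M-step 1 = s≤s (s≤s z≤n)
      M-step 2 = ℕ.+-monoʳ-< 2 (ℕ.+-monoʳ-< (length y) (s≤s z≤n))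
      M-step 3 = ℕ.+-monoʳ-< 2 (ℕ.+-monoʳ-< (length y) (s≤s (s≤s z≤n)))
      M-step 4 = ℕ.+-monoʳ-< 2 (ℕ.+-monoʳ-< (length y) (ℕ.+-monoʳ-< 2 (ℕ.+-monoʳ-< (length z) (s≤s z≤n))))
      M-step (suc (suc (suc (suc (suc n))))) =
        ℕ.+-monoʳ-< 2 (ℕ.+-monoʳ-< (length y) (ℕ.+-monoʳ-< 2 (ℕ.+-monoʳ-< (length z) (s≤s (ℕ.n<1+n n)))))

      N-step : ∀ n → N n < N (suc n)
      N-step n = ℕ.+-monoʳ-< (length x) (M-step n)

      N-< : ∀ {i j} → i < j → N i < N j
      N-< = increasing N N-step

      second : ∀ {l} {b b′ c c′ : Letter w} {r} → l ≡ x ++ b ∷ b′ ∷ y ++ c ∷ c′ ∷ r →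
               ∀ n → nth l (length x ℕ.+ (2 ℕ.+ (length y ℕ.+ n))) ≡ nth (c ∷ c′ ∷ r) n
      second eq n = trans (nth-drop x _ eq _) (nth-++ʳ y _ n)

      third : ∀ {l} {b b′ c c′ d d′ : Letter w} {r} → l ≡ x ++ b ∷ b′ ∷ y ++ c ∷ c′ ∷ z ++ d ∷ d′ ∷ r →
              ∀ n → nth l (length x ℕ.+ (2 ℕ.+ (length y ℕ.+ (2 ℕ.+ (length z ℕ.+ n))))) ≡ nth (d ∷ d′ ∷ r) n
      third eq n = trans (second eq _) (nth-++ʳ z _ n)

      named : ∀ {l} {b b′ c c′ d d′ : Letter w} {r} → l ≡ x ++ b ∷ b′ ∷ y ++ c ∷ c′ ∷ z ++ d ∷ d′ ∷ r →
              (nth l (N 0) ≡ just b × nth l (N 1) ≡ just b′) × (nth l (N 2) ≡ just c × nth l (N 3) ≡ just c′) ×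
              (nth l (N 4) ≡ just d × nth l (N 5) ≡ just d′)
      named eq = (nth-drop x _ eq 0 , nth-drop x _ eq 1) , (second eq 0 , second eq 1) , (third eq 0 , third eq 1)

      -- The positions in `v`, read on the letters of `w`; the third move keeps the alphabet up to
      -- the bijection `back`.
      q : Occurrence alphabet → ℕ
      q = pos v ∘ Sum.map back back

      q-pinned : ∀ {m n D} → m < n → nth W′ m ≡ just D → nth W′ n ≡ just D → q (inj₁ D) ≡ m × q (inj₂ D) ≡ n
      q-pinned {D = D} m<n at-m at-n = pinned v m<n (pull at-m) (pull at-n)
        where
        pull′ : ∀ {c : Maybe (Letter v)} → Maybe.map (incl sub) c ≡ just D → c ≡ just (back D)
        pull′ {just E} eq = cong just (injective (trans (Maybe.just-injective eq) (sym (incl-back D))))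
        pull : ∀ {n} → nth W′ n ≡ just D → nth (word v) n ≡ just (back D)
        pull {n} eq = pull′ (trans (sym (nth-map (incl sub) (word v) n)) (trans (cong (λ l → nth l n) v≡) eq))

      before = named w≡
      after = named {W′} refl

      Off : Letter w → Set
      Off D = ¬ Triple alphabet A≢B A≢C B≢C D

      other : ∀ o → Off (letterOf o) → pos w o ≡ q o
      other o off = occurrence o (q-pinned (pos-< w D) (moved (inj₁ D) refl) (moved (inj₂ D) refl))
        where
        D = letterOf o
        moved : ∀ p → letterOf p ≡ D → nth W′ (pos w p) ≡ just D
        moved p eq₀ = swap-adjacent x (off ∘ inj₁) (off ∘ inj₂ ∘ inj₁)
          (swap-adjacent y (off ∘ inj₁) (off ∘ inj₂ ∘ inj₂)
            (swap-adjacent z (off ∘ inj₂ ∘ inj₁) (off ∘ inj₂ ∘ inj₂) (λ n eq → eq)))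
          (pos w p) (trans (cong (λ l → nth l (pos w p)) (sym w≡)) (trans (nth-pos w p) (cong just eq₀)))
        occurrence : ∀ o → q (inj₁ (letterOf o)) ≡ pos w (inj₁ (letterOf o)) × q (inj₂ (letterOf o)) ≡ pos w (inj₂ (letterOf o)) →
                     pos w o ≡ q o
        occurrence (inj₁ D) (eq , _) = sym eq
        occurrence (inj₂ D) (_ , eq) = sym eq

      distinct : ∀ o → Off (letterOf o) → ∀ {i} → i < 6 → pos w o ≢ N i
      distinct o off {0} _ eq = off (inj₁ (letter-at w {o = o} eq (proj₁ (proj₁ before))))
      distinct o off {1} _ eq = off (inj₂ (inj₁ (letter-at w {o = o} eq (proj₂ (proj₁ before)))))
      distinct o off {2} _ eq = off (inj₁ (letter-at w {o = o} eq (proj₁ (proj₁ (proj₂ before)))))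
      distinct o off {3} _ eq = off (inj₂ (inj₂ (letter-at w {o = o} eq (proj₂ (proj₁ (proj₂ before))))))
      distinct o off {4} _ eq = off (inj₂ (inj₁ (letter-at w {o = o} eq (proj₁ (proj₂ (proj₂ before))))))
      distinct o off {5} _ eq = off (inj₂ (inj₂ (letter-at w {o = o} eq (proj₂ (proj₂ (proj₂ before))))))
      distinct o off {suc (suc (suc (suc (suc (suc i)))))} (s≤s (s≤s (s≤s (s≤s (s≤s (s≤s ()))))))

      lt : ∀ i j → {_ : (i ℕ.<ᵇ j) ≡ true} → N i < N j
      lt i j {eq} = N-< (ℕ.<ᵇ⇒< i j (subst T (sym eq) _))

      slide : Slide alphabet A≢B A≢C B≢C (pos w) q N
      slide = record
        { N-step = N-step
        ; N₁ = ℕ.+-suc (length x) 0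
        ; N₃ = trans (cong (λ n → length x ℕ.+ (2 ℕ.+ n)) (ℕ.+-suc (length y) 0)) (ℕ.+-suc (length x) _)
        ; N₅ = trans (cong (length x ℕ.+_) (cong (2 ℕ.+_) (trans (cong (λ n → length y ℕ.+ (2 ℕ.+ n)) (ℕ.+-suc (length z) 0)) (ℕ.+-suc (length y) _))))
                 (ℕ.+-suc (length x) _)
        ; pA₁ = proj₁ pA ; pA₂ = proj₂ pA ; pB₁ = proj₁ pB ; pB₂ = proj₂ pB ; pC₁ = proj₁ pC ; pC₂ = proj₂ pC
        ; qA₁ = proj₁ qA ; qA₂ = proj₂ qA ; qB₁ = proj₁ qB ; qB₂ = proj₂ qB ; qC₁ = proj₁ qC ; qC₂ = proj₂ qC
        ; other = other ; distinct = distinct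
        }
        where
        pA = pinned w (lt 0 2 {refl}) (proj₁ (proj₁ before)) (proj₁ (proj₁ (proj₂ before)))
        pB = pinned w (lt 1 4 {refl}) (proj₂ (proj₁ before)) (proj₁ (proj₂ (proj₂ before)))
        pC = pinned w (lt 3 5 {refl}) (proj₂ (proj₁ (proj₂ before))) (proj₂ (proj₂ (proj₂ before)))
        qA = q-pinned (lt 1 3 {refl}) (proj₂ (proj₁ after)) (proj₂ (proj₁ (proj₂ after)))
        qB = q-pinned (lt 0 5 {refl}) (proj₁ (proj₁ after)) (proj₂ (proj₂ (proj₂ after)))
        qC = q-pinned (lt 2 4 {refl}) (proj₁ (proj₁ (proj₂ after))) (proj₁ (proj₂ (proj₂ after)))

    move₃-form : ∀ c d f g → form τ ττ sign w (c , f) (d , g) ≡ form τ ττ sign v (c , f ∘ incl sub) (d , g ∘ incl sub)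
    move₃-form c d f g = trans
      (slide-form alphabet A≢B A≢C B≢C slide (sign ∘ ∣_∣) (cong sign A~B) (cong sign B~C) (c , f) (d , g))
      (relabel-form (positioned alphabet (sign ∘ ∣_∣) q) (diagram v sign) (incl sub) back incl-back injective
        (λ D → cong sign (projection D))
        (λ o p → cong₂ order (cong (pos v) (round-trip o)) (cong (pos v) (round-trip p))) c d f g)
      where
      back-incl : ∀ D → back (incl sub D) ≡ D
      back-incl D = injective (incl-back (incl sub D))
      round-trip : ∀ o → Sum.map back back (Sum.map (incl sub) (incl sub) o) ≡ o
      round-trip (inj₁ D) = cong inj₁ (back-incl D)
      round-trip (inj₂ D) = cong inj₂ (back-incl D)

    move₃-step : Step τ ττ sign w v 0
    move₃-step = record
      { incl = incl sub ; injective = injective ; projection = projection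
      ; ι = id ; ιι = λ _ → refl ; ι-label = λ _ → inj₁ refl ; ι-incl = λ _ → refl
      ; rank = hasRank-zero λ (c , f , _) (d , g , _) →
          trans (cong (λ e → e - form τ ττ sign v (c , f ∘ incl sub) (d , g ∘ incl sub)) (move₃-form c d f g)) (ℤ.+-inverseʳ (form τ ττ sign v (c , f ∘ incl sub) (d , g ∘ incl sub)))
      }

-- Every move is a step

module _ {a} {α : Set a} (τ : α → α) (ττ : Involutive _≡_ τ) (sign : α → ℤ) (sign-τ : ∀ b → sign (τ b) ≡ - sign b) where

  -- For isomorphisms and the first two homotopy moves the list of orbits evaluates to the empty
  -- one; for a bridge move it is the list whose length is the number of arches.
  move-step : ∀ {w v} (m : Move τ w v) → Step τ ττ sign w v (4 ℕ.* move-arches τ m)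
  move-step (isomorphism iso) = reversal-step τ ττ sign sign-τ (isomorphism-reversal τ iso)
  move-step (homotopy (move₁ x A y w≡ sub v≡)) = reversal-step τ ττ sign sign-τ (move₁-reversal τ ττ x A y w≡ sub v≡)
  move-step (homotopy (move₂ x A B y z w≡ label sub v≡)) = reversal-step τ ττ sign sign-τ (move₂-reversal τ ττ x A B y z w≡ label sub v≡)
  move-step (homotopy (move₃ x A B y C z t w≡ A≢B A≢C B≢C A~B B~C sub v≡)) =
    move₃-step τ ττ sign x A B y C z t w≡ A≢B A≢C B≢C A~B B~C sub v≡
  move-step (bridge m) = reversal-step τ ττ sign sign-τ (bridge-reversal τ m)

-- Fillings

module _ {a} {α : Set a} (τ : α → α) (ττ : Involutive _≡_ τ) (sign : α → ℤ) (sign-τ : ∀ b → sign (τ b) ≡ - sign b) where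

  null-∅ : Null τ ττ sign ∅ 0
  null-∅ = record
    { matching = record { μ = id ; μμ = λ _ → refl ; μ-~ = λ () }
    ; rank = hasRank-zero λ x y → Σ-zero (∅ᶠ ⊎ᶠ ∅ᶠ) λ { (inj₁ ()) ; (inj₂ ()) }
    }

  null-≤ : ∀ {w N M} → N ℕ.≤ M → Null τ ττ sign w N → Null τ ττ sign w M
  null-≤ N≤M null = record { matching = Null.matching null ; rank = hasRank-≤ N≤M (Null.rank null) }

  private
    total : ∀ a b → 4 ℕ.* b ℕ.+ 4 ℕ.* a ≡ 4 ℕ.* (a ℕ.+ b)
    total a b = trans (ℕ.+-comm (4 ℕ.* b) (4 ℕ.* a)) (sym (ℕ.*-distribˡ-+ 4 a b))

  null : ∀ {w} (m : Metamorphosis τ w ∅) → Null τ ττ sign w (4 ℕ.* g τ m)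
  null []           = null-∅
  null (fwd m ◅ ms) = null-≤ (ℕ.≤-reflexive (total (move-arches τ m) (g τ ms)))
    (null-forward τ ττ sign (move-step τ ττ sign sign-τ m) (null ms))
  null (bwd m ◅ ms) = null-≤ (ℕ.≤-reflexive (total (move-arches τ m) (g τ ms)))
    (null-backward τ ττ sign (move-step τ ττ sign sign-τ m) (null ms))

lookup-injective : ∀ {A : Set} {xs : List A} → Unique xs → ∀ i j → lookup xs i ≡ lookup xs j → i ≡ j
lookup-injective (x∉ ∷ u) zero    zero    eq = refl
lookup-injective {xs = x ∷ xs} (x∉ ∷ u) zero    (suc j) eq = contradiction eq (All.lookup x∉ (∈-lookup {xs = xs} j))
lookup-injective {xs = x ∷ xs} (x∉ ∷ u) (suc i) zero    eq = contradiction (sym eq) (All.lookup x∉ (∈-lookup {xs = xs} i))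
lookup-injective (x∉ ∷ u) (suc i) (suc j) eq = cong suc (lookup-injective u i j eq)

module _ {a} {α : Set a} (τ : α → α) (ττ : Involutive _≡_ τ) (sign : α → ℤ) (sign-τ : ∀ b → sign (τ b) ≡ - sign b)
         (P : Pairing α) where
  open Pairing P

  private
    X = S°
    L = Carrier X

  basis-self : ∀ A → basis τ P A A ≡ 1ℤ
  basis-self A = cong (λ b → if b then 1ℤ else 0ℤ) (dec-true (Maybe.≡-dec (FiniteSet._≟_ S°) A A) refl)

  basis-other : ∀ {A B} → A ≢ B → basis τ P A B ≡ 0ℤ
  basis-other {A} {B} A≢B = cong (λ b → if b then 1ℤ else 0ℤ) (dec-false (Maybe.≡-dec (FiniteSet._≟_ S°) A B) A≢B)

  basis-letter : ∀ {A B} → A ≢ B → basis τ P (just A) (just B) ≡ 0ℤ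
  basis-letter A≢B = basis-other (A≢B ∘ Maybe.just-injective)

  module _ (M : Matching X (λ A B → _~_ τ ττ sign ∣ A ∣ ∣ B ∣) (inj₁ refl) (~-trans τ ττ sign)) where
    open Matching M

    -- The short vector carried by the orbit of `A`. By `x-sign` its rescaled coordinates are
    -- invariant under the matching: equal labels give a sum, and labels exchanged by `τ`, whose
    -- signs are opposite, a difference.
    record ShortAt (A : L) : Set a where
      field
        x       : ℤS τ P
        short   : Short τ P x
        x-self  : x (just A) ≢ 0ℤ
        x-mate  : x (just (μ A)) ≢ 0ℤ
        x-other : ∀ C → C ≢ A → C ≢ μ A → x (just C) ≡ 0ℤ
        x-sign  : sign ∣ μ A ∣ * x (just (μ A)) ≡ sign ∣ A ∣ * x (just A)

    private
      1≢0 : ∀ {n} → n ≡ 1ℤ → n ≢ 0ℤ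
      1≢0 refl ()
      -1≢0 : ∀ {n} → n ≡ -1ℤ → n ≢ 0ℤ
      -1≢0 refl ()

    singleAt : ∀ A → μ A ≡ A → ShortAt A
    singleAt A eq = record
      { x = basis τ P (just A) ; short = single A (λ _ → refl)
      ; x-self = 1≢0 (basis-self (just A))
      ; x-mate = 1≢0 (trans (cong (basis τ P (just A) ∘ just) eq) (basis-self (just A)))
      ; x-other = λ C C≢A _ → basis-letter (C≢A ∘ sym)
      ; x-sign = cong (λ B → sign ∣ B ∣ * basis τ P (just A) (just B)) eq
      }

    pairAt : ∀ A → A ≢ μ A → _~_ τ ττ sign ∣ μ A ∣ ∣ A ∣ → ShortAt A
    pairAt A A≢μA (inj₁ eq) = record
      { x = λ C → basis τ P (just A) C + basis τ P (just (μ A)) C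
      ; short = sum A (μ A) A≢μA (sym eq) (λ _ → refl)
      ; x-self = 1≢0 self ; x-mate = 1≢0 mate
      ; x-other = λ C C≢A C≢μA → cong₂ _+_ (basis-letter (C≢A ∘ sym)) (basis-letter (C≢μA ∘ sym))
      ; x-sign = cong₂ _*_ (cong sign eq) (trans mate (sym self))
      }
      where
      self : basis τ P (just A) (just A) + basis τ P (just (μ A)) (just A) ≡ 1ℤ
      self = cong₂ _+_ (basis-self (just A)) (basis-letter (A≢μA ∘ sym))
      mate : basis τ P (just A) (just (μ A)) + basis τ P (just (μ A)) (just (μ A)) ≡ 1ℤ
      mate = cong₂ _+_ (basis-letter A≢μA) (basis-self (just (μ A)))
    pairAt A A≢μA (inj₂ eq) = record
      { x = λ C → basis τ P (just A) C - basis τ P (just (μ A)) C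
      ; short = difference A (μ A) A≢μA (trans (sym (ττ ∣ A ∣)) (cong τ (sym eq))) (λ _ → refl)
      ; x-self = 1≢0 self ; x-mate = -1≢0 mate
      ; x-other = λ C C≢A C≢μA → cong₂ _-_ (basis-letter (C≢A ∘ sym)) (basis-letter (C≢μA ∘ sym))
      ; x-sign = trans (cong₂ _*_ (trans (cong sign eq) (sign-τ ∣ A ∣)) mate)
          (trans (opposite-sign (sign ∣ A ∣)) (cong (sign ∣ A ∣ *_) (sym self)))
      }
      where
      opposite-sign : ∀ b → (- b) * -1ℤ ≡ b * 1ℤ
      opposite-sign = solve-∀
      self : basis τ P (just A) (just A) - basis τ P (just (μ A)) (just A) ≡ 1ℤ
      self = cong₂ _-_ (basis-self (just A)) (basis-letter (A≢μA ∘ sym))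
      mate : basis τ P (just A) (just (μ A)) - basis τ P (just (μ A)) (just (μ A)) ≡ -1ℤ
      mate = cong₂ _-_ (basis-letter A≢μA) (basis-self (just (μ A)))

    shortAt : ∀ A → ShortAt A
    shortAt A = by-cases (FiniteSet._≟_ X A (μ A))
      where
      by-cases : Dec (A ≡ μ A) → ShortAt A
      by-cases (yes eq)   = singleAt A (sym eq)
      by-cases (no A≢μA) = pairAt A A≢μA (μ-~ A)

    private
      rank′ : L → ℕ
      rank′ A = toℕ (index X A)

      rank-injective : ∀ {A B} → rank′ A ≡ rank′ B → A ≡ B
      rank-injective {A} {B} eq = trans (sym (element-index X A)) (trans (cong (element X) (Fin.toℕ-injective eq)) (element-index X B))

      first? : ∀ A → Dec (rank′ A ℕ.≤ rank′ (μ A))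
      first? A = rank′ A ℕ.≤? rank′ (μ A)

      all-letters : List L
      all-letters = tabulate (element X)

    -- One representative from each orbit of μ.
    representatives : List L
    representatives = filter first? all-letters

    private
      ∈-representatives : ∀ {A} → rank′ A ℕ.≤ rank′ (μ A) → A ∈ representatives
      ∈-representatives {A} le = ∈-filter⁺ first? (subst (_∈ all-letters) (element-index X A) (∈-tabulate⁺ (index X A))) le

      representative-first : ∀ i → rank′ (lookup representatives i) ℕ.≤ rank′ (μ (lookup representatives i))
      representative-first i = proj₂ (∈-filter⁻ first? {xs = all-letters} (∈-lookup {xs = representatives} i))

      unique : Unique representatives
      unique = Unique.filter⁺ first? (Unique.tabulate⁺ λ {i} {j} eq →
        trans (sym (index-element X i)) (trans (cong (index X) eq) (index-element X j)))

      vec : Fin (suc (length representatives)) → ℤS τ P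
      vec zero    = basis τ P nothing
      vec (suc i) = ShortAt.x (shortAt (lookup representatives i))

      vec-at : ∀ i {R} → lookup representatives i ≡ R → ∀ {A} → A ≡ R ⊎ A ≡ μ R → vec (suc i) (just A) ≢ 0ℤ
      vec-at i refl (inj₁ refl) = ShortAt.x-self (shortAt _)
      vec-at i refl (inj₂ refl) = ShortAt.x-mate (shortAt _)

      vec-only : ∀ {A} i → vec i (just A) ≢ 0ℤ →
                 ∃[ j ] i ≡ suc j × (lookup representatives j ≡ A ⊎ lookup representatives j ≡ μ A)
      vec-only zero ≢0 = contradiction refl ≢0
      vec-only {A} (suc j) ≢0 = j , refl , by-cases (FiniteSet._≟_ X A R) (FiniteSet._≟_ X A (μ R))
        where
        R = lookup representatives j
        by-cases : Dec (A ≡ R) → Dec (A ≡ μ R) → R ≡ A ⊎ R ≡ μ A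
        by-cases (yes eq) _        = inj₁ (sym eq)
        by-cases (no _) (yes eq)   = inj₂ (trans (sym (μμ R)) (cong μ (sym eq)))
        by-cases (no ≢R) (no ≢μR) = contradiction (ShortAt.x-other (shortAt R) A ≢R ≢μR) ≢0

      covered : ∀ A → ∃[ R ] rank′ R ℕ.≤ rank′ (μ R) × (A ≡ R ⊎ A ≡ μ R)
      covered A with ℕ.≤-total (rank′ A) (rank′ (μ A))
      ... | inj₁ le = A , le , inj₁ refl
      ... | inj₂ ge = μ A , subst (rank′ (μ A) ℕ.≤_) (cong rank′ (sym (μμ A))) ge , inj₂ (sym (μμ A))

      same-representative : ∀ {R R′} → rank′ R ℕ.≤ rank′ (μ R) → rank′ R′ ℕ.≤ rank′ (μ R′) → R′ ≡ R ⊎ R′ ≡ μ R → R′ ≡ R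
      same-representative le le′ (inj₁ eq) = eq
      same-representative {R} le le′ (inj₂ refl) = sym (rank-injective (ℕ.≤-antisym le (subst (rank′ (μ R) ℕ.≤_) (cong rank′ (μμ R)) le′)))

      orbit : ∀ {A R R′} → A ≡ R ⊎ A ≡ μ R → R′ ≡ A ⊎ R′ ≡ μ A → R′ ≡ R ⊎ R′ ≡ μ R
      orbit (inj₁ refl) R′~A = R′~A
      orbit (inj₂ refl) (inj₁ eq) = inj₂ eq
      orbit {R = R} (inj₂ refl) (inj₂ eq) = inj₁ (trans eq (μμ R))

    filling : Filling τ P
    filling = record
      { n = suc (length representatives)
      ; vec = vec
      ; base = zero
      ; base-is-s = λ _ → refl
      ; others = λ { zero ≢ → contradiction refl ≢ ; (suc i) _ → ShortAt.short (shortAt (lookup representatives i)) }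
      ; exactly-one = exactly-one
      }
      where
      exactly-one : ∀ A → ∃ λ i → vec i (just A) ≢ 0ℤ × (∀ {j} → vec j (just A) ≢ 0ℤ → i ≡ j)
      exactly-one A =
        let R , le , A~R = covered A
            R∈ = ∈-representatives le
            i = Any.index R∈
            at-i = sym (lookup-index R∈)
        in suc i , vec-at i at-i A~R , λ {j} ≢0 →
           let j′ , j≡ , R′~A = vec-only j ≢0
           in trans (cong suc (lookup-injective unique i j′ (trans at-i
                (sym (same-representative le (representative-first j′) (orbit A~R R′~A)))))) (sym j≡)

    -- The rescaled vectors of the filling are thus among those on which the matching bounds the
    -- rank of the form.
    filling-symmetric : ∀ i A → sign ∣ μ A ∣ * Filling.vec filling i (just (μ A)) ≡ sign ∣ A ∣ * Filling.vec filling i (just A)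
    filling-symmetric zero A = trans (vanish (sign ∣ μ A ∣) refl) (sym (vanish (sign ∣ A ∣) refl))
      where
      vanish : ∀ b {n} → n ≡ 0ℤ → b * n ≡ 0ℤ
      vanish b refl = ℤ.*-zeroʳ b
    filling-symmetric (suc i) A = by-cases (FiniteSet._≟_ X A R) (FiniteSet._≟_ X A (μ R))
      where
      R = lookup representatives i
      module r = ShortAt (shortAt R)
      vanish : ∀ b {n} → n ≡ 0ℤ → b * n ≡ 0ℤ
      vanish b refl = ℤ.*-zeroʳ b
      by-cases : Dec (A ≡ R) → Dec (A ≡ μ R) → sign ∣ μ A ∣ * r.x (just (μ A)) ≡ sign ∣ A ∣ * r.x (just A)
      by-cases (yes refl) _ = r.x-sign
      by-cases (no _) (yes refl) = trans (cong (λ B → sign ∣ B ∣ * r.x (just B)) (μμ R)) (sym r.x-sign)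
      by-cases (no ≢R) (no ≢μR) = trans
        (vanish (sign ∣ μ A ∣) (r.x-other (μ A) (λ eq → ≢μR (trans (sym (μμ A)) (cong μ eq))) (λ eq → ≢R (trans (sym (μμ A)) (trans (cong μ eq) (μμ R))))))
        (sym (vanish (sign ∣ A ∣) (r.x-other A ≢R ≢μR)))

-- The inequality

/1-≤ : ∀ {m n} → m ℕ.≤ n → (ℤ.+ m / 1) ℚ.≤ (ℤ.+ n / 1)
/1-≤ {m} {n} m≤n = ℚ.toℚᵘ-cancel-≤ (begin
  ℚ.toℚᵘ (ℤ.+ m / 1)  ≃⟨ toℚᵘ-/1 (ℤ.+ m) ⟩
  mkℚᵘ (ℤ.+ m) 0      ≤⟨ *≤* (ℤ.*-monoʳ-≤-nonNeg 1ℤ (ℤ.+≤+ m≤n)) ⟩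
  mkℚᵘ (ℤ.+ n) 0      ≃⟨ toℚᵘ-/1 (ℤ.+ n) ⟨
  ℚ.toℚᵘ (ℤ.+ n / 1)  ∎)
  where open ℚᵘ.≤-Reasoning

-- One ½ belongs to the genus and one to the inequality; together they cancel the factor 4 of the
-- rank bound.
quarter : ∀ n → ½ ℚ.* (½ ℚ.* (ℤ.+ (4 ℕ.* n) / 1)) ≡ ℤ.+ n / 1
quarter n = begin
  ½ ℚ.* (½ ℚ.* (ℤ.+ (4 ℕ.* n) / 1))                ≡⟨ cong (λ m → ½ ℚ.* (½ ℚ.* (m / 1))) (ℤ.pos-* 4 n) ⟩
  ½ ℚ.* (½ ℚ.* ((ℤ.+ 4 * ℤ.+ n) / 1))                ≡⟨ cong (λ q → ½ ℚ.* (½ ℚ.* q)) (/1-* (ℤ.+ 4) (ℤ.+ n)) ⟨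
  ½ ℚ.* (½ ℚ.* ((ℤ.+ 4 / 1) ℚ.* (ℤ.+ n / 1)))        ≡⟨ cong (½ ℚ.*_) (ℚ.*-assoc ½ (ℤ.+ 4 / 1) (ℤ.+ n / 1)) ⟨
  ½ ℚ.* ((½ ℚ.* (ℤ.+ 4 / 1)) ℚ.* (ℤ.+ n / 1))        ≡⟨ ℚ.*-assoc ½ (½ ℚ.* (ℤ.+ 4 / 1)) (ℤ.+ n / 1) ⟨
  (½ ℚ.* (½ ℚ.* (ℤ.+ 4 / 1))) ℚ.* (ℤ.+ n / 1)        ≡⟨ ℚ.*-identityˡ (ℤ.+ n / 1) ⟩
  ℤ.+ n / 1                                        ∎
  where open ≡-Reasoning

corollary9p4p3 :
    ∀ {a} {α : Set a} (τ : α → α) → Involutive _≡_ τ →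
    (φ : AbelianGroup.Carrier (π τ) → ℤ) →
    GroupMorphisms.IsGroupHomomorphism (AbelianGroup.rawGroup (π τ)) +-0-rawGroup φ →
    (∀ b → φ (gen b) ≡ 1ℤ ⊎ φ (gen b) ≡ -1ℤ) →
    (w v : Nanoword α) →
    (ρ : ℕ) → IsBridgeDistance τ w v ρ →
    (σ : ℚ) → IsGenus τ (pairing w ⊕ opposite (pairing v)) φ σ →
    ℤ.+ ρ / 1 ℚ.≥ ½ ℚ.* σ
corollary9p4p3 τ ττ φ hom unit w v ρ ((m , g≡ρ) , _) σ (_ , σ-min) =
  -- The rank of the Gram matrix is known to exist only up to double negation. The inequality is
  -- decidable, hence may be proved by refuting its negation.
  decidable-stable (½ ℚ.* σ ℚ.≤? ℤ.+ ρ / 1) λ fails →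
    ¬¬-maximum {P = λ k → ∃[ f ] LinearlyIndependent {k} (G ∘ f)}
      ((λ ()) , λ _ _ ()) (λ k (f , indep) → bounded f indep)
      λ (r , (f , indep) , maximal) → fails (begin
        ½ ℚ.* σ                          ≤⟨ ℚ.*-monoˡ-≤-nonNeg ½ (σ-min (λ′ , r , (f , indep) , λ k f indep → maximal k (f , indep))) ⟩
        ½ ℚ.* (½ ℚ.* (ℤ.+ r / 1))          ≤⟨ ℚ.*-monoˡ-≤-nonNeg ½ (ℚ.*-monoˡ-≤-nonNeg ½ (/1-≤ (bounded f indep))) ⟩
        ½ ℚ.* (½ ℚ.* (ℤ.+ (4 ℕ.* ρ) / 1))  ≡⟨ quarter ρ ⟩
        ℤ.+ ρ / 1                          ∎)
  where
  open ℚ.≤-Reasoning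
  open GroupMorphisms.IsGroupHomomorphism hom
  sign = φ ∘ gen
  P = pairing w ⊕ opposite (pairing v)
  wv = w · v ⁻

  sign-τ : ∀ b → sign (τ b) ≡ - sign b
  sign-τ b = trans (expand (sign b) (sign (τ b)))
    (trans (cong (- sign b +_) (trans (sym (homo (gen b) (gen (τ b)))) (trans (⟦⟧-cong (relation b)) ε-homo))) (ℤ.+-identityʳ _))
    where
    expand : ∀ p q → q ≡ - p + (p + q)
    expand = solve-∀

  null-wv : Null τ ττ sign wv (4 ℕ.* ρ)
  null-wv = subst (λ n → Null τ ττ sign wv (4 ℕ.* n)) g≡ρ (null τ ττ sign sign-τ m)
  open Null null-wv using (matching; rank; μ)

  λ′ : Filling τ P
  λ′ = filling τ ττ sign sign-τ P matching
  open Filling λ′ using (n; vec)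

  G : Fin n → Fin n → ℚ
  G = gram τ P φ λ′

  symmetrized : Fin n → SymmetricVector (Nanoword.alphabet wv) μ
  symmetrized i = proj₁ (rescaled i) , proj₂ (rescaled i) , filling-symmetric τ ττ sign sign-τ P matching i
    where
    rescaled : Fin n → ℤ × (Letter wv → ℤ)
    rescaled i = rescale τ φ hom unit wv (vec i)

  -- The form is twice the pairing, and the factor 2 does not affect the rank.
  gram-rank : HasRank {Fin n} (4 ℕ.* ρ) (λ i j → φ (ẽ τ P (vec i) (vec j)))
  gram-rank = hasRank-divide (ℤ.+ 2) (λ ()) (λ i j → ẽ-form τ φ hom unit w v (vec i) (vec j))
    (hasRank-pullback symmetrized rank)

  bounded : ∀ {k} (f : Fin k → Fin n) → LinearlyIndependent (G ∘ f) → k ℕ.≤ 4 ℕ.* ρ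
  bounded = rank-bound gram-rank id id
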